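{- There exist absolute constants $c,C>0$ such that the following holds. Let $\mathbb{F}$ be a field of characteristic $p$, and let $P$ be a set of $m$ points and $\Pi$ a set of $n$ planes in $\mathbb{P}^3(\mathbb{F})$, with $m\geq n$. If $p>0$, assume $p\neq 2$ and $n\leq cp^2$. Let $L^*$ be a finite set of lines in $\mathbb{P}^3$, and let $k^*$ be the maximum number of planes of $\Pi$ incident to (i.e. containing) any single line not in $L^*$. Then $$|I^*(P,\Pi)|\leq C\left(m\sqrt{n}+k^*m\right).$$
   Context: $I^*(P,\Pi)=\{(q,\pi)\in P\times\Pi:\ q\in\pi,\ \text{and for every } l\in L^*,\ q\notin l \text{ or } l\not\subset\pi\}$, i.e. point-plane incidences are discounted when they occur along a line of $L^*$. If $p=0$ there is no restriction on $n$. -}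

module Defs where

open import Level using (Level; _⊔_; Setω) renaming (suc to lsuc)
open import Algebra.Bundles using (CommutativeRing)
open import Data.Nat as ℕ using (ℕ; zero; suc)
open import Data.Nat.Divisibility using (_∣_)
open import Data.Fin as Fn using (Fin)
open import Data.Product using (_×_; ∃; ∃₂; _,_; proj₁; proj₂)
open import Data.Sum using (_⊎_)
open import Relation.Nullary using (¬_)
open import Relation.Binary.PropositionalEquality using (_≡_; _≢_)
open import Function.Definitions using (Injective)

record Field (c ℓ : Level) : Set (lsuc (c ⊔ ℓ)) where
  field
    commutativeRing : CommutativeRing c ℓ
  open CommutativeRing commutativeRing public
  field
    0≉1     : ¬ (0# ≈ 1#)
    inverse : ∀ x → ¬ (x ≈ 0#) → ∃ λ y → x * y ≈ 1#

module Geometry {c ℓ : Level} (F : Field c ℓ) where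
  open Field F

  natMul : ℕ → Carrier
  natMul zero    = 0#
  natMul (suc k) = 1# + natMul k

  -- F has characteristic p  (p = 0 means characteristic zero):
  -- k · 1 = 0  iff  p ∣ k.
  HasChar : ℕ → Set ℓ
  HasChar p = ∀ k → (natMul k ≈ 0# → p ∣ k) × (p ∣ k → natMul k ≈ 0#)

  -- homogeneous coordinates in F^4
  V4 : Set c
  V4 = Fin 4 → Carrier

  NonZero : V4 → Set ℓ
  NonZero v = ¬ (∀ i → v i ≈ 0#)

  -- v and w represent the same point (resp. plane) of P^3(F)
  Proportional : V4 → V4 → Set (c ⊔ ℓ)
  Proportional v w = ∃ λ t → ∀ i → v i ≈ t * w i

  dot : V4 → V4 → Carrier
  dot a q = a Fn.zero * q Fn.zero + (a (Fn.suc Fn.zero) * q (Fn.suc Fn.zero)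
          + (a (Fn.suc (Fn.suc Fn.zero)) * q (Fn.suc (Fn.suc Fn.zero))
          + a (Fn.suc (Fn.suc (Fn.suc Fn.zero))) * q (Fn.suc (Fn.suc (Fn.suc Fn.zero)))))

  -- the point q lies on the plane with dual coordinates a
  OnPlane : V4 → V4 → Set ℓ
  OnPlane q a = dot a q ≈ 0#

  -- a line of P^3(F): the projectivisation of the span of two
  -- linearly independent vectors
  record Line : Set (c ⊔ ℓ) where
    field
      u v         : V4
      independent : ∀ s t → (∀ i → s * u i + t * v i ≈ 0#) → (s ≈ 0#) × (t ≈ 0#)
  open Line public

  InSpan : V4 → Line → Set (c ⊔ ℓ)
  InSpan q l = ∃₂ λ s t → ∀ i → q i ≈ s * u l i + t * v l i

  OnLine : V4 → Line → Set (c ⊔ ℓ)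
  OnLine = InSpan

  LineInPlane : Line → V4 → Set ℓ
  LineInPlane l a = OnPlane (u l) a × OnPlane (v l) a

  SameLine : Line → Line → Set (c ⊔ ℓ)
  SameLine l l' = (InSpan (u l) l' × InSpan (v l) l') × (InSpan (u l') l × InSpan (v l') l)

  -- a set of m points (resp. planes): nonzero, pairwise non-proportional
  -- representatives indexed by Fin m
  IsProjSet : ∀ {m} → (Fin m → V4) → Set (c ⊔ ℓ)
  IsProjSet {m} X = (∀ i → NonZero (X i)) × (∀ i j → Proportional (X i) (X j) → i ≡ j)

  IStar : ∀ {r} → (Fin r → Line) → V4 → V4 → Set (c ⊔ ℓ)
  IStar Ls q a = OnPlane q a × (∀ j → ¬ OnLine q (Ls j) ⊎ ¬ LineInPlane (Ls j) a)

  PlanesPerLineAtMost : ∀ {r n} → (Fin r → Line) → (Fin n → V4) → ℕ → Set (c ⊔ ℓ)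
  PlanesPerLineAtMost {n = n} Ls Π k =
    ∀ (l : Line) → (∀ j → ¬ SameLine l (Ls j)) →
    ∀ (N : ℕ) (g : Fin N → Fin n) → Injective _≡_ _≡_ g →
    (∀ x → LineInPlane l (Π (g x))) → N ℕ.≤ k

  -- |I*(P,Π)| ≤ C (m √n + k m), written without square roots:
  -- every family of N distinct elements of I* satisfies
  -- (N ∸ C k m)^2 ≤ (C m)^2 n.
  IStarBound : ∀ {m n r} → (Fin m → V4) → (Fin n → V4) → (Fin r → Line) → ℕ → ℕ → Set (c ⊔ ℓ)
  IStarBound {m} {n} P Π Ls C k =
    ∀ (N : ℕ) (f : Fin N → Fin m × Fin n) → Injective _≡_ _≡_ f →
    (∀ x → IStar Ls (P (proj₁ (f x))) (Π (proj₂ (f x)))) →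
    (N ℕ.∸ C ℕ.* k ℕ.* m) ℕ.^ 2 ℕ.≤ (C ℕ.* m) ℕ.^ 2 ℕ.* n

-- The absolute constants c = a / b > 0 and C > 0 and the claim.
record Theorem6Constants : Setω where
  field
    a b C : ℕ
    a>0   : 0 ℕ.< a
    b>0   : 0 ℕ.< b
    C>0   : 0 ℕ.< C
    claim : ∀ {c ℓ} (F : Field c ℓ) → let open Geometry F in
      ∀ (p : ℕ) → HasChar p →
      ∀ (m n r : ℕ) (P : Fin m → V4) (Π : Fin n → V4) (Ls : Fin r → Line) (k : ℕ) →
      IsProjSet P → IsProjSet Π → n ℕ.≤ m →
      (p ≢ 0 → p ≢ 2 × b ℕ.* n ℕ.≤ a ℕ.* (p ℕ.* p)) →
      PlanesPerLineAtMost Ls Π k →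
      IStarBound P Π Ls C k

{-# OPTIONS --safe #-}
module Submission where

-- After a generic change of coordinates over F[[t]], incidence of the point (y , z , h) with the
-- plane (a , b , d) reads a + y + b h = d z, which says that the line T = h U - y, W = z ("red")
-- meets the line T = a - d W, U = - b ("blue") in 3-space; crossings on one line are distinct.
-- If there were too many incidences, pruning gives red and blue lines with ≫ √n + k crossings on
-- each red and ≫ √n on each blue line, and counting parameters gives f ≠ 0 of degree O(√n) that
-- vanishes on all blue and hence on all red lines. Low-degree expressions in the derivatives of f
-- that vanish at the crossings vanish on whole lines, and then so do their derivatives along
-- these lines. Write A, B, C for the partial derivatives of f. The plane sections W = const of
-- f = 0 have an inflection on every red line, hence on every blue one; differentiating along the
-- blue lines shows that C / A is an affine function of U along each red line on which A ≠ 0. Since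
-- C = d A at crossings, the blue lines there belong to planes through a common line, and there
-- are more than k of them: a contradiction. So A, and then B and C, vanish on all lines, and
-- descent on the degree (which is below the characteristic) gives f = 0.

open import Level using (Level; _⊔_) renaming (suc to lsuc)
open import Algebra.Bundles using (CommutativeRing)
open import Algebra.Structures using (IsCommutativeRing)
import Algebra.Properties.Ring as RingProperties
import Algebra.Properties.Semiring.Mult as Mult
import Algebra.Solver.Ring as RingSolver
open import Algebra.Solver.Ring.AlmostCommutativeRing using (fromCommutativeRing; _-Raw-AlmostCommutative⟶_)
open import Data.Empty using (⊥; ⊥-elim)
open import Data.Fin as Fin using (Fin; zero; suc; toℕ; punchIn)
open import Data.Fin.Patterns using (0F; 1F; 2F; 3F; 4F; 6F)
import Data.Fin.Properties as Finₚ
open import Data.Integer as ℤ using (ℤ; +_; -[1+_])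
import Data.Integer.Properties as ℤₚ
open import Data.List using (List; []; _∷_; length; map; filter; lookup; allFin; tabulate)
open import Data.List.Membership.Propositional using (_∈_; lose; find)
open import Data.List.Membership.Propositional.Properties using (∈-filter⁺; ∈-filter⁻; ∈-lookup; ∈-allFin)
open import Data.List.Properties using (length-map; length-tabulate; filter-notAll)
open import Data.List.Relation.Unary.All as All using (All)
import Data.List.Relation.Unary.All.Properties as Allₚ
import Data.List.Relation.Unary.AllPairs as AllPairs
open import Data.List.Relation.Unary.Unique.Propositional using (Unique)
import Data.List.Relation.Unary.Unique.Propositional.Properties as Uniqueₚ
open import Data.Maybe as Maybe using (Maybe)
open import Data.Nat as ℕ using (ℕ; zero; suc; pred; z≤n; s≤s)
open import Data.Nat.Divisibility using (∣⇒≤; 0∣⇒≡0)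
import Data.Nat.Properties as ℕₚ
open import Data.Nat.Tactic.RingSolver using (solve-∀)
open import Data.Product using (_×_; ∃; ∃₂; _,_; proj₁; proj₂)
open import Data.Sum using (_⊎_; inj₁; inj₂)
open import Data.Vec.Functional using (insertAt)
open import Data.Vec.Functional.Properties using (insertAt-lookup; insertAt-punchIn)
open import Function using (_∘_; id)
open import Function.Definitions using (Injective)
open import Relation.Binary.PropositionalEquality as ≡ using (_≡_; _≢_)
import Relation.Binary.Reasoning.Setoid as SetoidReasoning
open import Relation.Nullary using (¬_; yes; no; ¬?)
open import Relation.Nullary.Decidable using (decidable-stable; dec⇒maybe)
open import Relation.Nullary.Negation using (Stable; contradiction)
open import Relation.Unary using (Decidable)

open import Defs

-- The field may be finite and leave no room for general position. F[[t]] repairs this: it offers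
-- infinitely many points at which to test polynomials, it has the characteristic of F, and the
-- powers of t are independent over F, so that one explicit change of coordinates is generic for all
-- points and planes at once. It is a domain and not a field; hence denominators are cleared
-- everywhere, and a quotient such as C / A is handled through its Wronskian. Equality in F need not
-- be decidable. Equations between series hold up to double negation and existence statements are
-- doubly negated; nothing is lost, since the final inequality between natural numbers is decidable.
-- The thresholds are degrees. If f has degree at most σ on lines, the inflection form is cubic in
-- the derivatives of f and asks for 3σ + 1 crossings on a blue line; its derivative along blue
-- lines is quartic and asks for 4σ + 1 on a red one, next to k + 2 crossings reserved for the
-- pencil of planes. The largest degree in the differential equations is 2σ + 1, which must stay
-- below p: this is where n ≤ c p² comes from.

-- Integer coefficients let the solver see that x - x vanishes although
-- equality in R is not decidable.
module IntegerSolver {c ℓ : Level} (R : CommutativeRing c ℓ) where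
  open CommutativeRing R
  open RingProperties ring using (-0#≈0#; -‿involutive; -‿+-comm; -‿distribˡ-*)
  open Mult semiring using (×-homo-+) renaming (_×_ to _·_)
  open SetoidReasoning setoid

  fromℤ : ℤ → Carrier
  fromℤ (+ n)    = n · 1#
  fromℤ -[1+ n ] = - (suc n · 1#)

  fromℤ-⊖ : ∀ m n → fromℤ (m ℤ.⊖ n) ≈ m · 1# - n · 1#
  fromℤ-⊖ m       zero    = sym (trans (+-congˡ -0#≈0#) (+-identityʳ _))
  fromℤ-⊖ zero    (suc n) = sym (+-identityˡ _)
  fromℤ-⊖ (suc m) (suc n) = begin
    fromℤ (suc m ℤ.⊖ suc n)                ≡⟨ ≡.cong fromℤ (ℤₚ.[1+m]⊖[1+n]≡m⊖n m n) ⟩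
    fromℤ (m ℤ.⊖ n)                        ≈⟨ fromℤ-⊖ m n ⟩
    m · 1# - n · 1#                        ≈⟨ +-congʳ (+-identityˡ _) ⟨
    (0# + m · 1#) - n · 1#                 ≈⟨ +-congʳ (+-congʳ (-‿inverseʳ 1#)) ⟨
    ((1# - 1#) + m · 1#) - n · 1#          ≈⟨ +-congʳ (+-assoc _ _ _) ⟩
    (1# + (- 1# + m · 1#)) - n · 1#        ≈⟨ +-congʳ (+-congˡ (+-comm _ _)) ⟩
    (1# + (m · 1# + - 1#)) - n · 1#        ≈⟨ +-congʳ (+-assoc _ _ _) ⟨
    ((1# + m · 1#) + - 1#) - n · 1#        ≈⟨ +-assoc _ _ _ ⟩
    (1# + m · 1#) + (- 1# - n · 1#)        ≈⟨ +-congˡ (-‿+-comm _ _) ⟩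
    (1# + m · 1#) - (1# + n · 1#)          ∎

  fromℤ-neg : ∀ i → fromℤ (ℤ.- i) ≈ - fromℤ i
  fromℤ-neg (+ zero)  = sym -0#≈0#
  fromℤ-neg (+ suc n) = refl
  fromℤ-neg -[1+ n ]  = sym (-‿involutive _)

  fromℤ-+ : ∀ i j → fromℤ (i ℤ.+ j) ≈ fromℤ i + fromℤ j
  fromℤ-+ (+ m)    (+ n)    = ×-homo-+ 1# m n
  fromℤ-+ (+ m)    -[1+ n ] = fromℤ-⊖ m (suc n)
  fromℤ-+ -[1+ m ] (+ n)    = trans (fromℤ-⊖ n (suc m)) (+-comm _ _)
  fromℤ-+ -[1+ m ] -[1+ n ] = begin
    - (suc (suc (m ℕ.+ n)) · 1#)      ≈⟨ -‿cong (+-assoc _ _ _) ⟨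
    - ((1# + 1#) + (m ℕ.+ n) · 1#)    ≈⟨ -‿cong (+-congˡ (×-homo-+ 1# m n)) ⟩
    - ((1# + 1#) + (m · 1# + n · 1#)) ≈⟨ -‿cong (+-assoc _ _ _) ⟩
    - (1# + (1# + (m · 1# + n · 1#))) ≈⟨ -‿cong (+-congˡ (+-assoc _ _ _)) ⟨
    - (1# + ((1# + m · 1#) + n · 1#)) ≈⟨ -‿cong (+-congˡ (+-comm _ _)) ⟩
    - (1# + (n · 1# + (1# + m · 1#))) ≈⟨ -‿cong (+-assoc _ _ _) ⟨
    - ((1# + n · 1#) + (1# + m · 1#)) ≈⟨ -‿cong (+-comm _ _) ⟩
    - ((1# + m · 1#) + (1# + n · 1#)) ≈⟨ -‿+-comm _ _ ⟨
    - (1# + m · 1#) - (1# + n · 1#)   ∎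

  fromℤ-*-pos : ∀ m j → fromℤ (+ m ℤ.* j) ≈ m · 1# * fromℤ j
  fromℤ-*-pos zero    j = sym (zeroˡ _)
  fromℤ-*-pos (suc m) j = begin
    fromℤ (ℤ.suc (+ m) ℤ.* j)            ≡⟨ ≡.cong fromℤ (ℤₚ.suc-* (+ m) j) ⟩
    fromℤ (j ℤ.+ + m ℤ.* j)              ≈⟨ fromℤ-+ j (+ m ℤ.* j) ⟩
    fromℤ j + fromℤ (+ m ℤ.* j)          ≈⟨ +-cong (sym (*-identityˡ _)) (fromℤ-*-pos m j) ⟩
    1# * fromℤ j + m · 1# * fromℤ j      ≈⟨ distribʳ _ _ _ ⟨
    (1# + m · 1#) * fromℤ j              ∎

  fromℤ-* : ∀ i j → fromℤ (i ℤ.* j) ≈ fromℤ i * fromℤ j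
  fromℤ-* (+ m)    j = fromℤ-*-pos m j
  fromℤ-* -[1+ m ] j = begin
    fromℤ (ℤ.- (+ suc m) ℤ.* j)   ≡⟨ ≡.cong fromℤ (ℤₚ.neg-distribˡ-* (+ suc m) j) ⟨
    fromℤ (ℤ.- (+ suc m ℤ.* j))   ≈⟨ fromℤ-neg (+ suc m ℤ.* j) ⟩
    - fromℤ (+ suc m ℤ.* j)       ≈⟨ -‿cong (fromℤ-*-pos (suc m) j) ⟩
    - (suc m · 1# * fromℤ j)      ≈⟨ -‿distribˡ-* _ _ ⟩
    - (suc m · 1#) * fromℤ j      ∎

  private
    morphism : ℤ.+-*-rawRing -Raw-AlmostCommutative⟶ fromCommutativeRing R
    morphism = record
      { ⟦_⟧    = fromℤ
      ; +-homo = fromℤ-+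
      ; *-homo = fromℤ-*
      ; -‿homo = fromℤ-neg
      ; 0-homo = refl
      ; 1-homo = +-identityʳ 1#
      }

    sameImage? : ∀ i j → Maybe (fromℤ i ≈ fromℤ j)
    sameImage? i j = Maybe.map (λ i≡j → reflexive (≡.cong fromℤ i≡j)) (dec⇒maybe (i ℤ.≟ j))

  open RingSolver ℤ.+-*-rawRing (fromCommutativeRing R) morphism sameImage? public
    using (Polynomial; solve; con; _:+_; _:*_; _:-_; :-_; _:=_)

-- Classical reasoning towards stable goals, and domains with stable equality.

by-cases : ∀ {a b} {A : Set a} {B : Set b} → Stable B → (A → B) → (¬ A → B) → B
by-cases stable f g = stable λ ¬b → ¬b (g λ a → ¬b (f a))

-- The ring laws are equations or implications between equations, so they survive when equality is
-- weakened to its double negation; in exchange every equation becomes stable.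
module Stabilise {c ℓ : Level} (R : CommutativeRing c ℓ) where
  private module R = CommutativeRing R
  open R using (Carrier; _+_; _*_; -_; 0#; 1#)

  infix 4 _≈¬¬_
  _≈¬¬_ : Carrier → Carrier → Set ℓ
  x ≈¬¬ y = ¬ ¬ (x R.≈ y)

  private
    η : ∀ {x y} → x R.≈ y → x ≈¬¬ y
    η p k = k p

    lift₂ : ∀ {x y z w u v} → (x R.≈ y → z R.≈ w → u R.≈ v) → x ≈¬¬ y → z ≈¬¬ w → u ≈¬¬ v
    lift₂ f p q k = p λ p′ → q λ q′ → k (f p′ q′)

    isCommutativeRing : IsCommutativeRing _≈¬¬_ _+_ _*_ -_ 0# 1#
    isCommutativeRing = record
      { isRing = record
        { +-isAbelianGroup = record
          { isGroup = record
            { isMonoid = record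
              { isSemigroup = record
                { isMagma = record
                  { isEquivalence = record
                    { refl  = η R.refl
                    ; sym   = λ p k → p (k ∘ R.sym)
                    ; trans = lift₂ R.trans
                    }
                  ; ∙-cong = lift₂ R.+-cong
                  }
                ; assoc = λ x y z → η (R.+-assoc x y z)
                }
              ; identity = (λ x → η (R.+-identityˡ x)) , (λ x → η (R.+-identityʳ x))
              }
            ; inverse = (λ x → η (R.-‿inverseˡ x)) , (λ x → η (R.-‿inverseʳ x))
            ; ⁻¹-cong = λ p k → p (k ∘ R.-‿cong)
            }
          ; comm = λ x y → η (R.+-comm x y)
          }
        ; *-cong = lift₂ R.*-cong
        ; *-assoc = λ x y z → η (R.*-assoc x y z)
        ; *-identity = (λ x → η (R.*-identityˡ x)) , (λ x → η (R.*-identityʳ x))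
        ; distrib = (λ x y z → η (R.distribˡ x y z)) , (λ x y z → η (R.distribʳ x y z))
        }
      ; *-comm = λ x y → η (R.*-comm x y)
      }

  stabilised : CommutativeRing c ℓ
  stabilised = record { isCommutativeRing = isCommutativeRing }

-- `integral` cancels a factor known to be nonzero; the disjunctive form would require deciding
-- which factor vanishes.
record StableDomain (c ℓ : Level) : Set (lsuc (c ⊔ ℓ)) where
  field
    commutativeRing : CommutativeRing c ℓ
  open CommutativeRing commutativeRing public
  field
    stable   : ∀ {x y} → Stable (x ≈ y)
    integral : ∀ {x y} → x * y ≈ 0# → ¬ x ≈ 0# → y ≈ 0#

-- Formal power series over a domain, which form a domain again.

module PowerSeries {c ℓ : Level} (D : StableDomain c ℓ) where
  private module D = StableDomain D
  open D using (Carrier; _+_; _*_; -_; 0#; 1#; _≈_)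
  open SetoidReasoning D.setoid
  open IntegerSolver D.commutativeRing

  Series : Set c
  Series = ℕ → Carrier

  tail : Series → Series
  tail a n = a (suc n)

  infix 4 _≋_
  _≋_ : Series → Series → Set ℓ
  a ≋ b = ∀ n → a n ≈ b n

  infixl 6 _⊕_
  infixl 7 _⊛_

  _⊕_ _⊛_ : Series → Series → Series
  (a ⊕ b) n = a n + b n
  (a ⊛ b) zero    = a 0 * b 0
  (a ⊛ b) (suc n) = a 0 * b (suc n) + (tail a ⊛ b) n

  constant : Carrier → Series
  constant x zero    = x
  constant x (suc n) = 0#

  power : ℕ → Series
  power zero    zero    = 1#
  power zero    (suc n) = 0#
  power (suc i) zero    = 0#
  power (suc i) (suc n) = power i n

  𝟘 : Series
  𝟘 n = 0#

  ⊛-cong : ∀ {a b a′ b′} → a ≋ a′ → b ≋ b′ → a ⊛ b ≋ a′ ⊛ b′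
  ⊛-cong p q zero    = D.*-cong (p 0) (q 0)
  ⊛-cong p q (suc n) = D.+-cong (D.*-cong (p 0) (q (suc n))) (⊛-cong (p ∘ suc) q n)

  ⊛-zeroˡ : ∀ b → 𝟘 ⊛ b ≋ 𝟘
  ⊛-zeroˡ b zero    = D.zeroˡ _
  ⊛-zeroˡ b (suc n) = D.trans (D.+-cong (D.zeroˡ _) (⊛-zeroˡ b n)) (D.+-identityˡ _)

  constant-⊛ : ∀ x b → constant x ⊛ b ≋ λ n → x * b n
  constant-⊛ x b zero    = D.refl
  constant-⊛ x b (suc n) = D.trans (D.+-congˡ (⊛-zeroˡ b n)) (D.+-identityʳ _)

  ⊛-distribʳ : ∀ c a b → (a ⊕ b) ⊛ c ≋ a ⊛ c ⊕ b ⊛ c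
  ⊛-distribʳ c a b zero    = D.distribʳ _ _ _
  ⊛-distribʳ c a b (suc n) = D.trans (D.+-congˡ (⊛-distribʳ c (tail a) (tail b) n))
    (solve 5 (λ a₀ b₀ c₁ x y → (a₀ :+ b₀) :* c₁ :+ (x :+ y) := (a₀ :* c₁ :+ x) :+ (b₀ :* c₁ :+ y))
      D.refl _ _ _ _ _)

  ⊛-scaleˡ : ∀ x a b → (λ n → x * a n) ⊛ b ≋ λ n → x * (a ⊛ b) n
  ⊛-scaleˡ x a b zero    = D.*-assoc _ _ _
  ⊛-scaleˡ x a b (suc n) = D.trans (D.+-cong (D.*-assoc _ _ _) (⊛-scaleˡ x (tail a) b n)) (D.sym (D.distribˡ _ _ _))

  -- The mirror image of the defining recursion, peeling the second factor; comparing the two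
  -- recursions yields commutativity.
  ⊛-sucʳ : ∀ a b n → (a ⊛ b) (suc n) ≈ a (suc n) * b 0 + (a ⊛ tail b) n
  ⊛-sucʳ a b zero    = D.+-comm _ _
  ⊛-sucʳ a b (suc n) = D.trans (D.+-congˡ (⊛-sucʳ (tail a) b n))
    (solve 3 (λ x y z → x :+ (y :+ z) := y :+ (x :+ z)) D.refl _ _ _)

  ⊛-comm : ∀ a b → a ⊛ b ≋ b ⊛ a
  ⊛-comm a b zero    = D.*-comm _ _
  ⊛-comm a b (suc n) = D.trans (D.+-cong (D.*-comm _ _) (⊛-comm (tail a) b n)) (D.sym (⊛-sucʳ b a n))

  ⊛-assoc : ∀ a b c → (a ⊛ b) ⊛ c ≋ a ⊛ (b ⊛ c)
  ⊛-assoc a b c zero    = D.*-assoc _ _ _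
  ⊛-assoc a b c (suc n) = begin
    a 0 * b 0 * c (suc n) + (tail (a ⊛ b) ⊛ c) n
      ≈⟨ D.+-congˡ (⊛-distribʳ c (λ i → a 0 * b (suc i)) (tail a ⊛ b) n) ⟩
    a 0 * b 0 * c (suc n) + (((λ i → a 0 * b (suc i)) ⊛ c) n + ((tail a ⊛ b) ⊛ c) n)
      ≈⟨ D.+-congˡ (D.+-cong (⊛-scaleˡ (a 0) (tail b) c n) (⊛-assoc (tail a) b c n)) ⟩
    a 0 * b 0 * c (suc n) + (a 0 * (tail b ⊛ c) n + (tail a ⊛ (b ⊛ c)) n)
      ≈⟨ solve 5 (λ a₀ b₀ c₁ x y → a₀ :* b₀ :* c₁ :+ (a₀ :* x :+ y) := a₀ :* (b₀ :* c₁ :+ x) :+ y) D.refl _ _ _ _ _ ⟩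
    a 0 * (b 0 * c (suc n) + (tail b ⊛ c) n) + (tail a ⊛ (b ⊛ c)) n ∎

  ⊛-identityˡ : ∀ b → constant 1# ⊛ b ≋ b
  ⊛-identityˡ b n = D.trans (constant-⊛ 1# b n) (D.*-identityˡ _)

  private
    isCommutativeRing : IsCommutativeRing _≋_ _⊕_ _⊛_ (λ a n → - a n) 𝟘 (constant 1#)
    isCommutativeRing = record
      { isRing = record
        { +-isAbelianGroup = record
          { isGroup = record
            { isMonoid = record
              { isSemigroup = record
                { isMagma = record
                  { isEquivalence = record
                    { refl  = λ n → D.refl
                    ; sym   = λ p n → D.sym (p n)
                    ; trans = λ p q n → D.trans (p n) (q n)
                    }
                  ; ∙-cong = λ p q n → D.+-cong (p n) (q n)
                  }
                ; assoc = λ a b c n → D.+-assoc _ _ _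
                }
              ; identity = (λ a n → D.+-identityˡ _) , (λ a n → D.+-identityʳ _)
              }
            ; inverse = (λ a n → D.-‿inverseˡ _) , (λ a n → D.-‿inverseʳ _)
            ; ⁻¹-cong = λ p n → D.-‿cong (p n)
            }
          ; comm = λ a b n → D.+-comm _ _
          }
        ; *-cong = ⊛-cong
        ; *-assoc = ⊛-assoc
        ; *-identity = ⊛-identityˡ , λ b n → D.trans (⊛-comm b (constant 1#) n) (⊛-identityˡ b n)
        ; distrib = (λ a b c n → D.trans (⊛-comm a (b ⊕ c) n)
                      (D.trans (⊛-distribʳ a b c n) (D.+-cong (⊛-comm b a n) (⊛-comm c a n))))
                  , ⊛-distribʳ
        }
      ; *-comm = ⊛-comm
      }

  seriesRing : CommutativeRing c ℓ
  seriesRing = record { isCommutativeRing = isCommutativeRing }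

  ⊛-cancel-unit : ∀ a b → ¬ a 0 ≈ 0# → a ⊛ b ≋ 𝟘 → b ≋ 𝟘
  ⊛-cancel-unit a b a₀≉0 ab≈0 zero    = D.integral (ab≈0 0) a₀≉0
  ⊛-cancel-unit a b a₀≉0 ab≈0 (suc n) = ⊛-cancel-unit a (tail b) a₀≉0 (λ i → begin
    (a ⊛ tail b) i                     ≈⟨ D.+-identityˡ _ ⟨
    0# + (a ⊛ tail b) i                ≈⟨ D.+-congʳ (D.trans (D.*-congˡ b₀≈0) (D.zeroʳ _)) ⟨
    a (suc i) * b 0 + (a ⊛ tail b) i   ≈⟨ ⊛-sucʳ a b i ⟨
    (a ⊛ b) (suc i)                    ≈⟨ ab≈0 (suc i) ⟩
    0#                                 ∎) n
    where
    b₀≈0 : b 0 ≈ 0#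
    b₀≈0 = D.integral (ab≈0 0) a₀≉0

  -- While the constant term of `a` vanishes, `a` is replaced by its tail, whose product with `b` is
  -- still zero. A nonzero constant term is reached at index `i` at the latest.
  ⊛-cancel-at : ∀ i a b → ¬ a i ≈ 0# → a ⊛ b ≋ 𝟘 → b ≋ 𝟘
  ⊛-cancel-at zero    a b aᵢ≉0 ab≈0   = ⊛-cancel-unit a b aᵢ≉0 ab≈0
  ⊛-cancel-at (suc i) a b aᵢ≉0 ab≈0 n = by-cases {A = a 0 ≈ 0#} D.stable
    (λ a₀≈0 → ⊛-cancel-at i (tail a) b aᵢ≉0 (λ j → begin
       (tail a ⊛ b) j                       ≈⟨ D.+-identityˡ _ ⟨
       0# + (tail a ⊛ b) j                  ≈⟨ D.+-congʳ (D.trans (D.*-congʳ a₀≈0) (D.zeroˡ _)) ⟨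
       a 0 * b (suc j) + (tail a ⊛ b) j     ≈⟨ ab≈0 (suc j) ⟩
       0#                                   ∎) n)
    (λ a₀≉0 → ⊛-cancel-unit a b a₀≉0 ab≈0 n)

  series : StableDomain c ℓ
  series = record
    { commutativeRing = seriesRing
    ; stable   = λ ¬¬p n → D.stable λ ¬q → ¬¬p λ p → ¬q (p n)
    -- A nonzero series need not come with a nonzero coefficient, but the goal is stable, so one may
    -- be assumed.
    ; integral = λ {a} {b} ab≈0 a≉0 n → D.stable λ bₙ≉0 →
        a≉0 λ i → D.stable λ aᵢ≉0 → bₙ≉0 (⊛-cancel-at i a b aᵢ≉0 ab≈0 n)
    }

  power-self : ∀ i → power i i ≈ 1#
  power-self zero    = D.refl
  power-self (suc i) = power-self i

  power-other : ∀ i j → i ≢ j → power i j ≈ 0#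
  power-other zero    zero    i≢j = contradiction ≡.refl i≢j
  power-other zero    (suc j) i≢j = D.refl
  power-other (suc i) zero    i≢j = D.refl
  power-other (suc i) (suc j) i≢j = power-other i j (i≢j ∘ ≡.cong suc)

  t : Series
  t = power 1

  t-⊛-suc : ∀ b n → (t ⊛ b) (suc n) ≈ b n
  t-⊛-suc b n = begin
    0# * b (suc n) + (tail t ⊛ b) n   ≈⟨ D.+-congʳ (D.zeroˡ _) ⟩
    0# + (tail t ⊛ b) n               ≈⟨ D.+-identityˡ _ ⟩
    (tail t ⊛ b) n                    ≈⟨ ⊛-cong tail-t (λ _ → D.refl) n ⟩
    (constant 1# ⊛ b) n               ≈⟨ ⊛-identityˡ b n ⟩
    b n                               ∎
    where
    tail-t : tail t ≋ constant 1#
    tail-t zero    = D.refl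
    tail-t (suc n) = D.refl

  constant+t⊛≈0 : ∀ x b → constant x ⊕ t ⊛ b ≋ 𝟘 → x ≈ 0# × b ≋ 𝟘
  constant+t⊛≈0 x b p =
      D.trans (D.sym (D.trans (D.+-congˡ (D.zeroˡ _)) (D.+-identityʳ _))) (p 0)
    , λ n → D.trans (D.sym (D.trans (D.+-congˡ (t-⊛-suc b n)) (D.+-identityˡ _))) (p (suc n))

  constant-cong : ∀ {x y} → x ≈ y → constant x ≋ constant y
  constant-cong p zero    = p
  constant-cong p (suc n) = D.refl

  constant-+ : ∀ x y → constant (x + y) ≋ constant x ⊕ constant y
  constant-+ x y zero    = D.refl
  constant-+ x y (suc n) = D.sym (D.+-identityˡ _)

  constant-neg : ∀ x → constant (- x) ≋ λ n → - constant x n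
  constant-neg x zero    = D.refl
  constant-neg x (suc n) = solve 0 (con (+ 0) := :- con (+ 0)) D.refl

  constant-* : ∀ x y → constant (x * y) ≋ constant x ⊛ constant y
  constant-* x y zero    = D.refl
  constant-* x y (suc n) = D.sym (D.trans (constant-⊛ x (constant y) (suc n)) (D.zeroʳ _))

  private module S = CommutativeRing seriesRing

  constant-term-×1 : ∀ n → Mult._×_ S.semiring n S.1# 0 ≡ Mult._×_ D.semiring n 1#
  constant-term-×1 zero    = ≡.refl
  constant-term-×1 (suc n) = ≡.cong (λ x → 1# + x) (constant-term-×1 n)

-- Polynomial functions of one variable: roots, derivatives and linear differential equations.

record InfiniteDomain (c ℓ : Level) : Set (lsuc (c ⊔ ℓ)) where
  field
    stableDomain : StableDomain c ℓ
  open StableDomain stableDomain public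
  field
    sample          : ℕ → Carrier
    sample-distinct : ∀ i j → i ≢ j → ¬ sample i ≈ sample j
    sample≉0        : ∀ i → ¬ sample i ≈ 0#

module Univariate {c ℓ : Level} (D : InfiniteDomain c ℓ) where
  open InfiniteDomain D hiding (zero)
  open IntegerSolver commutativeRing
  open RingProperties ring using (-1*x≈-x)
  open SetoidReasoning setoid

  nat : ℕ → Carrier
  nat n = Mult._×_ semiring n 1#

  difference≉0 : ∀ {x y} → ¬ x ≈ y → ¬ x - y ≈ 0#
  difference≉0 {x} {y} x≉y p = x≉y (begin
    x           ≈⟨ solve 2 (λ x y → x := (x :- y) :+ y) refl x y ⟩
    (x - y) + y ≈⟨ +-congʳ p ⟩
    0# + y      ≈⟨ +-identityˡ y ⟩
    y           ∎)

  eval : List Carrier → Carrier → Carrier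
  eval []       u = 0#
  eval (a ∷ as) u = a + u * eval as u

  scaleL : Carrier → List Carrier → List Carrier
  scaleL x = map (x *_)

  addL mulL : List Carrier → List Carrier → List Carrier
  addL []       bs       = bs
  addL (a ∷ as) []       = a ∷ as
  addL (a ∷ as) (b ∷ bs) = a + b ∷ addL as bs
  mulL []       bs       = []
  mulL (a ∷ as) bs       = addL (scaleL a bs) (0# ∷ mulL as bs)

  eval-scaleL : ∀ x as u → eval (scaleL x as) u ≈ x * eval as u
  eval-scaleL x []       u = sym (zeroʳ x)
  eval-scaleL x (a ∷ as) u = trans (+-congˡ (*-congˡ (eval-scaleL x as u)))
    (solve 4 (λ x a u e → x :* a :+ u :* (x :* e) := x :* (a :+ u :* e)) refl _ _ _ _)

  eval-addL : ∀ as bs u → eval (addL as bs) u ≈ eval as u + eval bs u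
  eval-addL []       bs       u = sym (+-identityˡ _)
  eval-addL (a ∷ as) []       u = sym (+-identityʳ _)
  eval-addL (a ∷ as) (b ∷ bs) u = trans (+-congˡ (*-congˡ (eval-addL as bs u)))
    (solve 5 (λ a b u x y → (a :+ b) :+ u :* (x :+ y) := (a :+ u :* x) :+ (b :+ u :* y)) refl _ _ _ _ _)

  eval-mulL : ∀ as bs u → eval (mulL as bs) u ≈ eval as u * eval bs u
  eval-mulL []       bs u = sym (zeroˡ _)
  eval-mulL (a ∷ as) bs u = begin
    eval (addL (scaleL a bs) (0# ∷ mulL as bs)) u  ≈⟨ eval-addL (scaleL a bs) _ u ⟩
    eval (scaleL a bs) u + (0# + u * eval (mulL as bs) u)
      ≈⟨ +-cong (eval-scaleL a bs u) (trans (+-identityˡ _) (*-congˡ (eval-mulL as bs u))) ⟩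
    a * eval bs u + u * (eval as u * eval bs u)
      ≈⟨ solve 4 (λ a u x y → a :* y :+ u :* (x :* y) := (a :+ u :* x) :* y) refl _ _ _ _ ⟩
    (a + u * eval as u) * eval bs u ∎

  length-addL : ∀ {n} as bs → length as ℕ.≤ n → length bs ℕ.≤ n → length (addL as bs) ℕ.≤ n
  length-addL []       bs       p       q       = q
  length-addL (a ∷ as) []       p       q       = p
  length-addL (a ∷ as) (b ∷ bs) (s≤s p) (s≤s q) = s≤s (length-addL as bs p q)

  length-mulL : ∀ {m n} as bs → length as ℕ.≤ m → length bs ℕ.≤ suc n → length (mulL as bs) ℕ.≤ m ℕ.+ n
  length-mulL         []       bs p       q = z≤n
  length-mulL {suc m} {n} (a ∷ as) bs (s≤s p) q = length-addL (scaleL a bs) _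
    (ℕₚ.≤-trans (ℕₚ.≤-reflexive (length-map (a *_) bs)) (ℕₚ.≤-trans q (s≤s (ℕₚ.m≤n+m n m))))
    (s≤s (length-mulL as bs p q))

  -- A polynomial is a function together with some list of coefficients. Trailing zeros are allowed,
  -- because without decidable equality they cannot be trimmed.
  record Degree≤ (d : ℕ) (φ : Carrier → Carrier) : Set (c ⊔ ℓ) where
    constructor degree≤
    field
      coefficients : List Carrier
      bounded      : length coefficients ℕ.≤ suc d
      represents   : ∀ u → φ u ≈ eval coefficients u

  degree-cong : ∀ {d φ ψ} → (∀ u → φ u ≈ ψ u) → Degree≤ d φ → Degree≤ d ψ
  degree-cong p (degree≤ as b r) = degree≤ as b (λ u → trans (sym (p u)) (r u))

  degree-weaken : ∀ {d e φ} → d ℕ.≤ e → Degree≤ d φ → Degree≤ e φ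
  degree-weaken d≤e (degree≤ as b r) = degree≤ as (ℕₚ.≤-trans b (s≤s d≤e)) r

  degree-const : ∀ {d} x → Degree≤ d (λ _ → x)
  degree-const x = degree≤ (x ∷ []) (s≤s z≤n) (λ u → sym (trans (+-congˡ (zeroʳ u)) (+-identityʳ x)))

  degree-id : Degree≤ 1 (λ u → u)
  degree-id = degree≤ (0# ∷ 1# ∷ []) ℕₚ.≤-refl
    (λ u → trans (solve 1 (λ u → u := con (+ 0) :+ u :* (con (+ 1) :+ u :* con (+ 0))) refl u)
                 (+-congˡ (*-congˡ (+-congʳ (+-identityʳ 1#)))))

  degree-+ : ∀ {d φ ψ} → Degree≤ d φ → Degree≤ d ψ → Degree≤ d (λ u → φ u + ψ u)
  degree-+ (degree≤ as a r) (degree≤ bs b s) = degree≤ (addL as bs) (length-addL as bs a b)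
    (λ u → trans (+-cong (r u) (s u)) (sym (eval-addL as bs u)))

  degree-* : ∀ {d e φ ψ} → Degree≤ d φ → Degree≤ e ψ → Degree≤ (d ℕ.+ e) (λ u → φ u * ψ u)
  degree-* (degree≤ as a r) (degree≤ bs b s) = degree≤ (mulL as bs) (length-mulL as bs a b)
    (λ u → trans (*-cong (r u) (s u)) (sym (eval-mulL as bs u)))

  degree-scale : ∀ {d φ} x → Degree≤ d φ → Degree≤ d (λ u → x * φ u)
  degree-scale x p = degree-* (degree-const {0} x) p

  degree-neg : ∀ {d φ} → Degree≤ d φ → Degree≤ d (λ u → - φ u)
  degree-neg {φ = φ} p = degree-cong
    (λ u → solve 1 (λ x → (:- con (+ 1)) :* x := :- x) refl (φ u)) (degree-scale _ p)

  -- Synthetic division by `u - r`; the remainder is the value at `r`.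
  quotient : Carrier → List Carrier → List Carrier
  quotient r []       = []
  quotient r (a ∷ as) = addL as (scaleL r (quotient r as))

  length-quotient : ∀ r {n} as → length as ℕ.≤ suc n → length (quotient r as) ℕ.≤ n
  length-quotient r []       p       = z≤n
  length-quotient r {zero}  (a ∷ []) (s≤s p) = z≤n
  length-quotient r {suc n} (a ∷ as) (s≤s p) = length-addL as _ p
    (ℕₚ.≤-trans (ℕₚ.≤-reflexive (length-map (r *_) (quotient r as))) (ℕₚ.m≤n⇒m≤1+n (length-quotient r as p)))

  eval-quotient : ∀ r as u → eval as u ≈ eval as r + (u - r) * eval (quotient r as) u
  eval-quotient r []       u = solve 1 (λ x → con (+ 0) := con (+ 0) :+ x :* con (+ 0)) refl _
  eval-quotient r (a ∷ as) u = begin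
    a + u * eval as u
      ≈⟨ solve 4 (λ a u r e → a :+ u :* e := a :+ ((u :- r) :* e :+ r :* e)) refl a u r _ ⟩
    a + ((u - r) * eval as u + r * eval as u)
      ≈⟨ +-congˡ (+-congˡ (*-congˡ (eval-quotient r as u))) ⟩
    a + ((u - r) * eval as u + r * (eval as r + (u - r) * eval (quotient r as) u))
      ≈⟨ solve 6 (λ a u r e e′ q → a :+ ((u :- r) :* e :+ r :* (e′ :+ (u :- r) :* q))
             := (a :+ r :* e′) :+ (u :- r) :* (e :+ r :* q)) refl a u r _ _ _ ⟩
    (a + r * eval as r) + (u - r) * (eval as u + r * eval (quotient r as) u)
      ≈⟨ +-congˡ (*-congˡ (trans (+-congˡ (sym (eval-scaleL r (quotient r as) u)))
                                 (sym (eval-addL as _ u)))) ⟩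
    (a + r * eval as r) + (u - r) * eval (addL as (scaleL r (quotient r as))) u ∎

  Distinct : ∀ {n} → (Fin n → Carrier) → Set ℓ
  Distinct r = ∀ i j → i ≢ j → ¬ r i ≈ r j

  eval-roots : ∀ n as → length as ℕ.≤ n → (r : Fin n → Carrier) → Distinct r →
               (∀ i → eval as (r i) ≈ 0#) → ∀ u → eval as u ≈ 0#
  eval-roots zero    [] len r distinct root u = refl
  eval-roots (suc n) as len r distinct root u = begin
    eval as u                       ≈⟨ factor u ⟩
    (u - r zero) * eval qs u        ≈⟨ *-congˡ (eval-roots n qs (length-quotient (r zero) as len) (r ∘ suc)
                                         (λ i j i≢j → distinct (suc i) (suc j) (i≢j ∘ Finₚ.suc-injective))
                                         (λ i → integral (trans (sym (factor (r (suc i)))) (root (suc i)))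
                                                  (difference≉0 (distinct (suc i) zero λ ()))) u) ⟩
    (u - r zero) * 0#               ≈⟨ zeroʳ _ ⟩
    0#                              ∎
    where
    qs : List Carrier
    qs = quotient (r zero) as
    factor : ∀ u → eval as u ≈ (u - r zero) * eval qs u
    factor u = trans (eval-quotient (r zero) as u) (trans (+-congʳ (root zero)) (+-identityˡ _))

  roots⇒zero : ∀ {d φ} → Degree≤ d φ → (r : Fin (suc d) → Carrier) → Distinct r →
               (∀ i → φ (r i) ≈ 0#) → ∀ u → φ u ≈ 0#
  roots⇒zero (degree≤ as b s) r distinct root u =
    trans (s u) (eval-roots _ as b r distinct (λ i → trans (sym (s (r i))) (root i)) u)

  sample-distinct-Fin : ∀ {n} → Distinct {n} (sample ∘ toℕ)
  sample-distinct-Fin i j i≢j = sample-distinct _ _ (i≢j ∘ Finₚ.toℕ-injective)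

  SomeDegree : (Carrier → Carrier) → Set (c ⊔ ℓ)
  SomeDegree φ = ∃ λ d → Degree≤ d φ

  some-const : ∀ x → SomeDegree (λ _ → x)
  some-const x = 0 , degree-const x

  some-id : SomeDegree (λ u → u)
  some-id = 1 , degree-id

  some-+ : ∀ {φ ψ} → SomeDegree φ → SomeDegree ψ → SomeDegree (λ u → φ u + ψ u)
  some-+ (d , p) (e , q) = d ℕ.+ e , degree-+ (degree-weaken (ℕₚ.m≤m+n d e) p) (degree-weaken (ℕₚ.m≤n+m e d) q)

  some-* : ∀ {φ ψ} → SomeDegree φ → SomeDegree ψ → SomeDegree (λ u → φ u * ψ u)
  some-* (d , p) (e , q) = d ℕ.+ e , degree-* p q

  some-neg : ∀ {φ} → SomeDegree φ → SomeDegree (λ u → - φ u)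
  some-neg (d , p) = d , degree-neg p

  -- The algebraic substitute for a limit, by counting roots among the nonzero samples. It permits
  -- dividing an identity by a variable and then setting that variable to 0.
  continuity : ∀ {φ} → SomeDegree φ → (∀ u → ¬ u ≈ 0# → φ u ≈ 0#) → φ 0# ≈ 0#
  continuity (d , p) φ≈0 = roots⇒zero p (sample ∘ toℕ) sample-distinct-Fin (λ i → φ≈0 _ (sample≉0 (toℕ i))) 0#

  -- The derivative is characterised by a Taylor expansion whose remainder is polynomial in the
  -- increment `ε`. This needs no chosen coefficients, composes under sums and products, and
  -- determines `φ′`, because `ε` can be cancelled and then set to 0 by `continuity`.
  record Derivative (φ φ′ : Carrier → Carrier) : Set (c ⊔ ℓ) where
    constructor derivative
    field
      remainder        : Carrier → Carrier → Carrier
      remainder-degree : ∀ u → SomeDegree (remainder u)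
      taylor           : ∀ u ε → φ (u + ε) ≈ (φ u + ε * φ′ u) + ε * (ε * remainder u ε)

  derivative-cong : ∀ {φ ψ φ′ ψ′} → (∀ u → φ u ≈ ψ u) → (∀ u → φ′ u ≈ ψ′ u) →
                    Derivative φ φ′ → Derivative ψ ψ′
  derivative-cong p p′ (derivative r d t) = derivative r d λ u ε →
    trans (sym (p (u + ε))) (trans (t u ε) (+-congʳ (+-cong (p u) (*-congˡ (p′ u)))))

  derivative-const : ∀ x → Derivative (λ _ → x) (λ _ → 0#)
  derivative-const x = derivative (λ _ _ → 0#) (λ _ → some-const 0#)
    (λ u ε → solve 2 (λ x e → x := (x :+ e :* con (+ 0)) :+ e :* (e :* con (+ 0))) refl x ε)

  derivative-id : Derivative (λ u → u) (λ _ → 1#)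
  derivative-id = derivative (λ _ _ → 0#) (λ _ → some-const 0#) λ u ε →
    sym (trans (+-cong (+-congˡ (*-identityʳ ε)) (trans (*-congˡ (zeroʳ ε)) (zeroʳ ε))) (+-identityʳ _))

  derivative-+ : ∀ {φ ψ φ′ ψ′} → Derivative φ φ′ → Derivative ψ ψ′ →
                 Derivative (λ u → φ u + ψ u) (λ u → φ′ u + ψ′ u)
  derivative-+ (derivative r d t) (derivative s e t′) = derivative
    (λ u ε → r u ε + s u ε) (λ u → some-+ (d u) (e u))
    (λ u ε → trans (+-cong (t u ε) (t′ u ε))
      (solve 7 (λ e x x′ r y y′ s → ((x :+ e :* x′) :+ e :* (e :* r)) :+ ((y :+ e :* y′) :+ e :* (e :* s))
         := ((x :+ y) :+ e :* (x′ :+ y′)) :+ e :* (e :* (r :+ s))) refl _ _ _ _ _ _ _))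

  derivative-* : ∀ {φ ψ φ′ ψ′} → Derivative φ φ′ → Derivative ψ ψ′ →
                 Derivative (λ u → φ u * ψ u) (λ u → φ′ u * ψ u + φ u * ψ′ u)
  derivative-* {φ} {ψ} {φ′} {ψ′} (derivative r d t) (derivative s e t′) = derivative
    (λ u ε → ((φ u * s u ε + ψ u * r u ε) + φ′ u * ψ′ u)
             + (ε * (φ′ u * s u ε + ψ′ u * r u ε) + ε * (ε * (r u ε * s u ε))))
    (λ u → some-+ (some-+ (some-+ (some-* (some-const _) (e u)) (some-* (some-const _) (d u))) (some-const _))
             (some-+ (some-* some-id (some-+ (some-* (some-const _) (e u)) (some-* (some-const _) (d u))))
                     (some-* some-id (some-* some-id (some-* (d u) (e u))))))
    (λ u ε → trans (*-cong (t u ε) (t′ u ε))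
      (solve 7 (λ e x x′ r y y′ s → ((x :+ e :* x′) :+ e :* (e :* r)) :* ((y :+ e :* y′) :+ e :* (e :* s))
         := (x :* y :+ e :* (x′ :* y :+ x :* y′))
            :+ e :* (e :* (((x :* s :+ y :* r) :+ x′ :* y′)
                :+ (e :* (x′ :* s :+ y′ :* r) :+ e :* (e :* (r :* s)))))) refl _ _ _ _ _ _ _))

  derivative-scale : ∀ {φ φ′} x → Derivative φ φ′ → Derivative (λ u → x * φ u) (λ u → x * φ′ u)
  derivative-scale {φ} {φ′} x p = derivative-cong (λ _ → refl)
    (λ u → trans (+-congʳ (zeroˡ _)) (+-identityˡ _)) (derivative-* (derivative-const x) p)

  derivative-neg : ∀ {φ φ′} → Derivative φ φ′ → Derivative (λ u → - φ u) (λ u → - φ′ u)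
  derivative-neg {φ} {φ′} p = derivative-cong (λ u → -1*x≈-x (φ u)) (λ u → -1*x≈-x (φ′ u)) (derivative-scale (- 1#) p)

  derivative-of-zero : ∀ {φ φ′} → Derivative φ φ′ → (∀ u → φ u ≈ 0#) → ∀ u → φ′ u ≈ 0#
  derivative-of-zero {φ} {φ′} (derivative r d t) φ≈0 u = begin
    φ′ u                   ≈⟨ solve 2 (λ x y → x := x :+ con (+ 0) :* y) refl _ _ ⟩
    φ′ u + 0# * r u 0#     ≈⟨ continuity (some-+ (some-const (φ′ u)) (some-* some-id (d u)))
                                (λ ε ε≉0 → integral (quotient≈0 ε) ε≉0) ⟩
    0#                     ∎
    where
    quotient≈0 : ∀ ε → ε * (φ′ u + ε * r u ε) ≈ 0#
    quotient≈0 ε = begin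
      ε * (φ′ u + ε * r u ε)                   ≈⟨ solve 3 (λ e x y → e :* (x :+ e :* y) := (con (+ 0) :+ e :* x) :+ e :* (e :* y)) refl _ _ _ ⟩
      (0# + ε * φ′ u) + ε * (ε * r u ε)        ≈⟨ +-congʳ (+-congʳ (φ≈0 u)) ⟨
      (φ u + ε * φ′ u) + ε * (ε * r u ε)       ≈⟨ t u ε ⟨
      φ (u + ε)                                ≈⟨ φ≈0 (u + ε) ⟩
      0#                                       ∎

  eval′ : List Carrier → Carrier → Carrier
  eval′ []       u = 0#
  eval′ (a ∷ as) u = eval as u + u * eval′ as u

  derivative-eval : ∀ as → Derivative (eval as) (eval′ as)
  derivative-eval []       = derivative-const 0#
  derivative-eval (a ∷ as) = derivative-cong (λ _ → refl)
    (λ u → trans (+-identityˡ _) (+-congʳ (*-identityˡ _)))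
    (derivative-+ (derivative-const a) (derivative-* derivative-id (derivative-eval as)))

  derivative-unique : ∀ {φ ψ φ′ ψ′} → (∀ u → φ u ≈ ψ u) → Derivative φ φ′ → Derivative ψ ψ′ → ∀ u → φ′ u ≈ ψ′ u
  derivative-unique {φ} {ψ} {φ′} {ψ′} φ≈ψ p q u = begin
    φ′ u                   ≈⟨ solve 2 (λ x y → x := (x :+ :- y) :+ y) refl _ _ ⟩
    (φ′ u + - ψ′ u) + ψ′ u ≈⟨ +-congʳ (derivative-of-zero (derivative-+ p (derivative-neg q))
                                (λ v → trans (+-congʳ (φ≈ψ v)) (-‿inverseʳ _)) u) ⟩
    0# + ψ′ u              ≈⟨ +-identityˡ _ ⟩
    ψ′ u                   ∎

  some-eval : ∀ as → SomeDegree (eval as)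
  some-eval as = length as , degree≤ as (ℕₚ.n≤1+n _) (λ _ → refl)

  some-eval′ : ∀ as → SomeDegree (eval′ as)
  some-eval′ []       = some-const 0#
  some-eval′ (a ∷ as) = some-+ (some-eval as) (some-* some-id (some-eval′ as))

  -- If H = uᵏ H̃ solves A H′ = Q H then k A H̃ + u (A H̃′ - Q H̃) = 0, which at u = 0
  -- forces one more factor of u.
  ode-zero : ∀ {A Q} → SomeDegree A → SomeDegree Q → ¬ A 0# ≈ 0# → ∀ k as →
             (∀ j → k ℕ.≤ j → j ℕ.< k ℕ.+ length as → ¬ nat j ≈ 0#) →
             (∀ u → nat k * (A u * eval as u) + u * (A u * eval′ as u - Q u * eval as u) ≈ 0#) →
             ∀ u → eval as u ≈ 0#
  ode-zero dA dQ A₀≉0 k [] char eq u = refl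
  ode-zero {A} {Q} dA dQ A₀≉0 k (a ∷ as) char eq u = begin
    a + u * eval as u   ≈⟨ +-cong a≈0 (*-congˡ (ode-zero dA dQ A₀≉0 (suc k) as
                             (λ j k<j j<k+n → char j (ℕₚ.<⇒≤ k<j) (ℕₚ.≤-trans j<k+n (ℕₚ.≤-reflexive (≡.sym (ℕₚ.+-suc k _)))))
                             eq′ u)) ⟩
    0# + u * 0#         ≈⟨ solve 1 (λ u → con (+ 0) :+ u :* con (+ 0) := con (+ 0)) refl u ⟩
    0#                  ∎
    where
    a≈0 : a ≈ 0#
    a≈0 = integral (integral (begin
        nat k * (A 0# * a)
          ≈⟨ solve 6 (λ k A a e x y → k :* (A :* a) := k :* (A :* (a :+ con (+ 0) :* e)) :+ con (+ 0) :* (x :- y)) refl _ _ _ _ _ _ ⟩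
        nat k * (A 0# * (a + 0# * eval as 0#)) + 0# * (A 0# * eval′ (a ∷ as) 0# - Q 0# * eval (a ∷ as) 0#)
          ≈⟨ eq 0# ⟩
        0# ∎)
      (char k ℕₚ.≤-refl (ℕₚ.m<m+n k (s≤s z≤n)))) A₀≉0
    Φ : Carrier → Carrier
    Φ v = nat (suc k) * (A v * eval as v) + v * (A v * eval′ as v - Q v * eval as v)
    uΦ≈0 : ∀ v → v * Φ v ≈ 0#
    uΦ≈0 v = begin
      v * ((1# + nat k) * (A v * eval as v) + v * (A v * eval′ as v - Q v * eval as v))
        ≈⟨ *-congˡ (+-congʳ (trans (distribʳ _ _ _) (+-congʳ (*-identityˡ _)))) ⟩
      v * ((A v * eval as v + nat k * (A v * eval as v)) + v * (A v * eval′ as v - Q v * eval as v))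
        ≈⟨ solve 6 (λ v k A e e′ Q → v :* ((A :* e :+ k :* (A :* e)) :+ v :* (A :* e′ :- Q :* e))
              := k :* (A :* (con (+ 0) :+ v :* e)) :+ v :* (A :* (e :+ v :* e′) :- Q :* (con (+ 0) :+ v :* e))) refl _ _ _ _ _ _ ⟩
      nat k * (A v * (0# + v * eval as v)) + v * (A v * eval′ (a ∷ as) v - Q v * (0# + v * eval as v))
        ≈⟨ +-cong (*-congˡ (*-congˡ (+-congʳ a≈0))) (*-congˡ (+-congˡ (-‿cong (*-congˡ (+-congʳ a≈0))))) ⟨
      nat k * (A v * (a + v * eval as v)) + v * (A v * eval′ (a ∷ as) v - Q v * (a + v * eval as v))
        ≈⟨ eq v ⟩
      0# ∎
    dΦ : SomeDegree Φ
    dΦ = some-+ (some-* (some-const _) (some-* dA (some-eval as)))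
           (some-* some-id (some-+ (some-* dA (some-eval′ as)) (some-neg (some-* dQ (some-eval as)))))
    eq′ : ∀ v → Φ v ≈ 0#
    -- The factor `v` cancels away from 0, and `continuity` supplies the value at 0.
    eq′ v = by-cases {A = v ≈ 0#} stable
      (λ v≈0 → trans (Φ-cong v≈0) (continuity dΦ (λ w w≉0 → integral (uΦ≈0 w) w≉0)))
      (λ v≉0 → integral (uΦ≈0 v) v≉0)
      where
      eval-cong : ∀ as {v w} → v ≈ w → eval as v ≈ eval as w
      eval-cong []       p = refl
      eval-cong (a ∷ as) p = +-congˡ (*-cong p (eval-cong as p))
      degree-respects : ∀ {φ} → SomeDegree φ → ∀ {v w} → v ≈ w → φ v ≈ φ w
      degree-respects (d , degree≤ as _ r) p = trans (r _) (trans (eval-cong as p) (sym (r _)))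
      Φ-cong : ∀ {v w} → v ≈ w → Φ v ≈ Φ w
      Φ-cong = degree-respects dΦ

  -- Starts `ode-zero` at `k = 1`, the first factor `u` coming from `H 0# ≈ 0#`. In characteristic p
  -- the power u^p solves H′ = 0 with H(0) = 0, whence the condition on all positive integers up to
  -- the degree.
  ode-unique : ∀ {A Q H H′ d} → SomeDegree A → SomeDegree Q → ¬ A 0# ≈ 0# →
               Degree≤ d H → Derivative H H′ → (∀ j → 1 ℕ.≤ j → j ℕ.≤ d → ¬ nat j ≈ 0#) →
               H 0# ≈ 0# → (∀ u → A u * H′ u ≈ Q u * H u) → ∀ u → H u ≈ 0#
  ode-unique dA dQ A₀≉0 (degree≤ [] _ r) dH char H₀≈0 eq u = r u
  ode-unique {A} {Q} {H} {H′} {d} dA dQ A₀≉0 (degree≤ (a ∷ as) (s≤s b) r) dH char H₀≈0 eq u = begin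
    H u                 ≈⟨ r′ u ⟩
    u * eval as u       ≈⟨ *-congˡ (ode-zero dA dQ A₀≉0 1 as
                             (λ j 1≤j j<1+n → char j 1≤j (ℕₚ.≤-trans (ℕₚ.≤-pred j<1+n) b)) eq′ u) ⟩
    u * 0#              ≈⟨ zeroʳ u ⟩
    0#                  ∎
    where
    a≈0 : a ≈ 0#
    a≈0 = begin
      a                    ≈⟨ solve 2 (λ a e → a := a :+ con (+ 0) :* e) refl _ _ ⟩
      a + 0# * eval as 0#  ≈⟨ r 0# ⟨
      H 0#                 ≈⟨ H₀≈0 ⟩
      0#                   ∎
    r′ : ∀ u → H u ≈ u * eval as u
    r′ u = trans (r u) (trans (+-congʳ a≈0) (+-identityˡ _))
    eq′ : ∀ u → nat 1 * (A u * eval as u) + u * (A u * eval′ as u - Q u * eval as u) ≈ 0#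
    eq′ u = begin
      nat 1 * (A u * eval as u) + u * (A u * eval′ as u - Q u * eval as u)
        ≈⟨ +-congʳ (trans (*-congʳ (+-identityʳ 1#)) (*-identityˡ _)) ⟩
      A u * eval as u + u * (A u * eval′ as u - Q u * eval as u)
        ≈⟨ solve 5 (λ u A e e′ Q → A :* e :+ u :* (A :* e′ :- Q :* e) := A :* (e :+ u :* e′) :- Q :* (u :* e)) refl _ _ _ _ _ ⟩
      A u * eval′ (a ∷ as) u - Q u * (u * eval as u)
        ≈⟨ +-cong (*-congˡ (derivative-unique r dH (derivative-eval (a ∷ as)) u)) (-‿cong (*-congˡ (r′ u))) ⟨
      A u * H′ u - Q u * H u
        ≈⟨ +-congʳ (eq u) ⟩
      Q u * H u - Q u * H u
        ≈⟨ -‿inverseʳ _ ⟩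
      0# ∎

-- Homogeneous linear systems over a domain.

module LinearSystems {c ℓ : Level} (D : InfiniteDomain c ℓ) where
  open InfiniteDomain D hiding (zero)
  open IntegerSolver commutativeRing
  open RingProperties ring using (-‿distribˡ-*)
  open SetoidReasoning setoid

  record LinearForm (N : ℕ) : Set (c ⊔ ℓ) where
    field
      apply       : (Fin N → Carrier) → Carrier
      apply-cong  : ∀ {x y} → (∀ i → x i ≈ y i) → apply x ≈ apply y
      apply-+     : ∀ x y → apply (λ i → x i + y i) ≈ apply x + apply y
      apply-scale : ∀ a x → apply (λ i → a * x i) ≈ a * apply x

    apply-0 : apply (λ _ → 0#) ≈ 0#
    apply-0 = trans (apply-cong (λ _ → sym (zeroˡ 0#))) (trans (apply-scale 0# (λ _ → 0#)) (zeroˡ _))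

  open LinearForm

  not-all-zero : ∀ {N} {x : Fin N → Carrier} → ¬ (∀ i → x i ≈ 0#) → ¬ ¬ ∃ λ i → ¬ x i ≈ 0#
  not-all-zero x≉0 none = x≉0 λ i → stable λ xᵢ≉0 → none (i , xᵢ≉0)

  insert0 : ∀ {N} → Fin (suc N) → (Fin N → Carrier) → Fin (suc N) → Carrier
  insert0 p x = insertAt x p 0#

  insert0-cong : ∀ {N} p {x y : Fin N → Carrier} → (∀ i → x i ≈ y i) → ∀ i → insert0 p x i ≈ insert0 p y i
  insert0-cong zero            x≈y zero    = refl
  insert0-cong zero            x≈y (suc i) = x≈y i
  insert0-cong {suc N} (suc p) x≈y zero    = x≈y zero
  insert0-cong {suc N} (suc p) x≈y (suc i) = insert0-cong p (x≈y ∘ suc) i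

  insert0-+ : ∀ {N} p (x y : Fin N → Carrier) i → insert0 p (λ j → x j + y j) i ≈ insert0 p x i + insert0 p y i
  insert0-+ zero            x y zero    = sym (+-identityˡ 0#)
  insert0-+ zero            x y (suc i) = refl
  insert0-+ {suc N} (suc p) x y zero    = refl
  insert0-+ {suc N} (suc p) x y (suc i) = insert0-+ p (x ∘ suc) (y ∘ suc) i

  insert0-scale : ∀ {N} p a (x : Fin N → Carrier) i → insert0 p (λ j → a * x j) i ≈ a * insert0 p x i
  insert0-scale zero            a x zero    = sym (zeroʳ a)
  insert0-scale zero            a x (suc i) = refl
  insert0-scale {suc N} (suc p) a x zero    = refl
  insert0-scale {suc N} (suc p) a x (suc i) = insert0-scale p a (x ∘ suc) i

  -- Projection along v onto the kernel of f, cleared of denominators.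
  module Projection {N : ℕ} (f : LinearForm (suc N)) (v : Fin (suc N) → Carrier) (p : Fin (suc N)) where

    project : (Fin N → Carrier) → Fin (suc N) → Carrier
    project x i = apply f v * insert0 p x i - apply f (insert0 p x) * v i

    private
      project-cong : ∀ {x y} → (∀ i → x i ≈ y i) → ∀ i → project x i ≈ project y i
      project-cong x≈y i = +-cong (*-congˡ (insert0-cong p x≈y i))
        (-‿cong (*-congʳ (apply-cong f (insert0-cong p x≈y))))

      project-+ : ∀ x y i → project (λ j → x j + y j) i ≈ project x i + project y i
      project-+ x y i = trans (+-cong (*-congˡ (insert0-+ p x y i))
          (-‿cong (*-congʳ (trans (apply-cong f (insert0-+ p x y)) (apply-+ f _ _)))))
        (solve 6 (λ a b c s t v → a :* (b :+ c) :- (s :+ t) :* v := (a :* b :- s :* v) :+ (a :* c :- t :* v))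
          refl _ _ _ _ _ _)

      project-scale : ∀ a x i → project (λ j → a * x j) i ≈ a * project x i
      project-scale a x i = trans (+-cong (*-congˡ (insert0-scale p a x i))
          (-‿cong (*-congʳ (trans (apply-cong f (insert0-scale p a x)) (apply-scale f _ _)))))
        (solve 5 (λ a s b t v → s :* (a :* b) :- (a :* t) :* v := a :* (s :* b :- t :* v)) refl _ _ _ _ _)

    apply-project : ∀ (g : LinearForm (suc N)) x →
      apply g (project x) ≈ apply f v * apply g (insert0 p x) - apply f (insert0 p x) * apply g v
    apply-project g x = begin
      apply g (λ i → apply f v * insert0 p x i - apply f (insert0 p x) * v i)
        ≈⟨ apply-cong g (λ i → +-congˡ (-‿distribˡ-* _ _)) ⟩
      apply g (λ i → apply f v * insert0 p x i + (- apply f (insert0 p x)) * v i)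
        ≈⟨ apply-+ g _ _ ⟩
      apply g (λ i → apply f v * insert0 p x i) + apply g (λ i → (- apply f (insert0 p x)) * v i)
        ≈⟨ +-cong (apply-scale g _ _) (apply-scale g _ _) ⟩
      apply f v * apply g (insert0 p x) + (- apply f (insert0 p x)) * apply g v
        ≈⟨ +-congˡ (sym (-‿distribˡ-* _ _)) ⟩
      apply f v * apply g (insert0 p x) - apply f (insert0 p x) * apply g v ∎

    apply-project-self : ∀ x → apply f (project x) ≈ 0#
    apply-project-self x = trans (apply-project f x)
      (solve 2 (λ a b → a :* b :- b :* a := con (+ 0)) refl _ _)

    restrict : LinearForm (suc N) → LinearForm N
    restrict g = record
      { apply       = apply g ∘ project
      ; apply-cong  = λ x≈y → apply-cong g (project-cong x≈y)
      ; apply-+     = λ x y → trans (apply-cong g (project-+ x y)) (apply-+ g _ _)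
      ; apply-scale = λ a x → trans (apply-cong g (project-scale a x)) (apply-scale g _ _)
      }

    -- `insert0` puts 0 at `p`, so coordinate `p` of the projection shows that `f` kills the
    -- inserted vector; the other coordinates then reduce to `apply f v * x i`.
    project-injective : ¬ apply f v ≈ 0# → ¬ v p ≈ 0# → ∀ x → (∀ i → project x i ≈ 0#) → ∀ i → x i ≈ 0#
    project-injective fv≉0 vₚ≉0 x zeros i = integral (begin
      apply f v * x i
        ≈⟨ solve 3 (λ a x v → a :* x := a :* x :- con (+ 0) :* v) refl _ _ (v (punchIn p i)) ⟩
      apply f v * x i - 0# * v (punchIn p i)
        ≈⟨ +-cong (*-congˡ (reflexive (insertAt-punchIn x p 0# i))) (-‿cong (*-congʳ f-insert≈0)) ⟨
      project x (punchIn p i)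
        ≈⟨ zeros (punchIn p i) ⟩
      0# ∎) fv≉0
      where
      f-insert≈0 : apply f (insert0 p x) ≈ 0#
      f-insert≈0 = integral (begin
        v p * apply f (insert0 p x)
          ≈⟨ solve 3 (λ a s v → v :* s := :- (a :* con (+ 0) :- s :* v)) refl (apply f v) _ _ ⟩
        - (apply f v * 0# - apply f (insert0 p x) * v p)
          ≈⟨ -‿cong (+-congʳ (*-congˡ (reflexive (insertAt-lookup x p 0#)))) ⟨
        - project x p
          ≈⟨ -‿cong (zeros p) ⟩
        - 0#
          ≈⟨ solve 0 (:- con (+ 0) := con (+ 0)) refl ⟩
        0# ∎) vₚ≉0

  -- Gaussian elimination without division: the kernel of the first form is parametrised by one
  -- coordinate fewer, and the other forms are pulled back along `project`.
  kernel-nontrivial : ∀ M N → M ℕ.< N → (L : Fin M → LinearForm N) →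
    ¬ ¬ ∃ λ x → (∀ i → apply (L i) x ≈ 0#) × ¬ (∀ j → x j ≈ 0#)
  kernel-nontrivial zero    (suc N) _           L k = k ((λ _ → sample 0) , (λ ()) , λ z → sample≉0 0 (z zero))
  kernel-nontrivial (suc M) (suc N) (s≤s M<N) L k = nonzero-value λ (v , fv≉0) →
    not-all-zero (λ v≈0 → fv≉0 (trans (apply-cong f v≈0) (apply-0 f))) λ (p , vₚ≉0) →
    let open Projection f v p in
    kernel-nontrivial M N M<N (restrict ∘ L ∘ suc) λ (x , Lx≈0 , x≉0) →
    k ( project x
      , (λ { zero → apply-project-self x ; (suc i) → Lx≈0 i })
      , λ z → x≉0 (project-injective fv≉0 vₚ≉0 x z))
    where
    f : LinearForm (suc N)
    f = L zero
    nonzero-value : ¬ ¬ ∃ λ v → ¬ apply f v ≈ 0#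
    -- If the first form has no nonzero value, every common zero of the other forms is a zero of it
    -- too.
    nonzero-value none = kernel-nontrivial M (suc N) (ℕₚ.m≤n⇒m≤1+n M<N) (L ∘ suc) λ (x , Lx≈0 , x≉0) →
      k (x , (λ { zero → stable (λ fx≉0 → none (x , fx≉0)) ; (suc i) → Lx≈0 i }) , x≉0)

-- Polynomials in three variables, partial derivatives and restriction to lines.

module Trivariate {c ℓ : Level} (D : InfiniteDomain c ℓ) where
  open InfiniteDomain D hiding (zero)
  open IntegerSolver commutativeRing
  open SetoidReasoning setoid
  open Univariate D
  open LinearSystems D

  horner horner′ : ℕ → (ℕ → Carrier) → Carrier → Carrier
  horner  zero    a x = 0#
  horner  (suc n) a x = a 0 + x * horner n (a ∘ suc) x
  horner′ zero    a x = 0#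
  horner′ (suc n) a x = horner n (a ∘ suc) x + x * horner′ n (a ∘ suc) x

  horner-cong : ∀ n {a b} x → (∀ i → a i ≈ b i) → horner n a x ≈ horner n b x
  horner-cong zero    x a≈b = refl
  horner-cong (suc n) x a≈b = +-cong (a≈b 0) (*-congˡ (horner-cong n x (a≈b ∘ suc)))

  horner-+ : ∀ n a b x → horner n (λ i → a i + b i) x ≈ horner n a x + horner n b x
  horner-+ zero    a b x = sym (+-identityˡ 0#)
  horner-+ (suc n) a b x = trans (+-congˡ (*-congˡ (horner-+ n (a ∘ suc) (b ∘ suc) x)))
    (solve 5 (λ a b x s t → (a :+ b) :+ x :* (s :+ t) := (a :+ x :* s) :+ (b :+ x :* t)) refl _ _ _ _ _)

  horner-scale : ∀ n r a x → horner n (λ i → r * a i) x ≈ r * horner n a x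
  horner-scale zero    r a x = sym (zeroʳ r)
  horner-scale (suc n) r a x = trans (+-congˡ (*-congˡ (horner-scale n r (a ∘ suc) x)))
    (solve 4 (λ r a x s → r :* a :+ x :* (r :* s) := r :* (a :+ x :* s)) refl _ _ _ _)

  horner-zero : ∀ n {a} x → (∀ i → i ℕ.< n → a i ≈ 0#) → horner n a x ≈ 0#
  horner-zero zero    x a≈0 = refl
  horner-zero (suc n) x a≈0 = trans (+-cong (a≈0 0 (s≤s z≤n)) (*-congˡ (horner-zero n x (λ i i<n → a≈0 (suc i) (s≤s i<n)))))
    (solve 1 (λ x → con (+ 0) :+ x :* con (+ 0) := con (+ 0)) refl x)

  horner-head : ∀ n {a} x → (∀ i → suc i ℕ.< suc n → a (suc i) ≈ 0#) → horner (suc n) a x ≈ a 0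
  horner-head n x a≈0 = trans (+-congˡ (trans (*-congˡ (horner-zero n x (λ i i<n → a≈0 i (s≤s i<n)))) (zeroʳ x))) (+-identityʳ _)

  ∂ : (ℕ → Carrier) → ℕ → Carrier
  ∂ a i = nat (suc i) * a (suc i)

  -- The offset `k` serves the induction: peeling off a coefficient raises all remaining weights by
  -- one.
  horner-weighted : ∀ n k a x → horner n (λ i → nat (k ℕ.+ i) * a i) x ≈ nat k * horner n a x + x * horner′ n a x
  horner-weighted zero    k a x = solve 2 (λ k x → con (+ 0) := k :* con (+ 0) :+ x :* con (+ 0)) refl _ _
  horner-weighted (suc n) k a x = begin
    nat (k ℕ.+ 0) * a 0 + x * horner n (λ i → nat (k ℕ.+ suc i) * a (suc i)) x
      ≈⟨ +-cong (*-congʳ (reflexive (≡.cong nat (ℕₚ.+-identityʳ k))))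
                (*-congˡ (trans (horner-cong n x (λ i → *-congʳ (reflexive (≡.cong nat (ℕₚ.+-suc k i)))))
                                (horner-weighted n (suc k) (a ∘ suc) x))) ⟩
    nat k * a 0 + x * ((1# + nat k) * s + x * s′)
      ≈⟨ +-congˡ (*-congˡ (+-congʳ (trans (distribʳ _ _ _) (+-congʳ (*-identityˡ _))))) ⟩
    nat k * a 0 + x * ((s + nat k * s) + x * s′)
      ≈⟨ solve 5 (λ k a x s s′ → k :* a :+ x :* ((s :+ k :* s) :+ x :* s′)
            := k :* (a :+ x :* s) :+ x :* (s :+ x :* s′)) refl _ _ _ _ _ ⟩
    nat k * (a 0 + x * s) + x * (s + x * s′) ∎
    where
    s s′ : Carrier
    s  = horner n (a ∘ suc) x
    s′ = horner′ n (a ∘ suc) x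

  horner′≈horner-∂ : ∀ n a x → horner′ n a x ≈ horner (pred n) (∂ a) x
  horner′≈horner-∂ zero    a x = refl
  horner′≈horner-∂ (suc n) a x = sym (trans (horner-weighted n 1 (a ∘ suc) x)
    (+-congʳ (trans (*-congʳ (+-identityʳ 1#)) (*-identityˡ _))))

  -- The coefficients may vary with the parameter as well, so that `chain-rule` can apply this to
  -- each of three nested Horner schemes.
  horner-derivative : ∀ n {a a′ : ℕ → Carrier → Carrier} {x x′} →
    (∀ i → Derivative (a i) (a′ i)) → Derivative x x′ →
    Derivative (λ v → horner n (λ i → a i v) (x v))
               (λ v → horner n (λ i → a′ i v) (x v) + x′ v * horner′ n (λ i → a i v) (x v))
  horner-derivative zero    da dx = derivative-cong (λ _ → refl)
    (λ v → solve 1 (λ x → con (+ 0) := con (+ 0) :+ x :* con (+ 0)) refl _) (derivative-const 0#)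
  horner-derivative (suc n) da dx = derivative-cong (λ _ → refl)
    (λ v → solve 6 (λ a x x′ s d s′ → a :+ (x′ :* s :+ x :* (d :+ x′ :* s′)) := (a :+ x :* d) :+ x′ :* (s :+ x :* s′)) refl _ _ _ _ _ _)
    (derivative-+ (da 0) (derivative-* dx (horner-derivative n (da ∘ suc) dx)))

  horner-degree : ∀ n {d} {a : ℕ → Carrier → Carrier} {x} → (∀ i → Degree≤ d (a i)) → Degree≤ 1 x →
    Degree≤ (n ℕ.+ d) (λ v → horner n (λ i → a i v) (x v))
  horner-degree zero    da dx = degree-const 0#
  horner-degree (suc n) {d} da dx = degree-+ (degree-weaken (ℕₚ.m≤n+m d (suc n)) (da 0))
    (degree-* dx (horner-degree n (da ∘ suc) dx))

  -- The sizes are exclusive bounds on the three exponents. A partial derivative lowers one of them,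
  -- which makes the later descent terminate.
  record Poly : Set c where
    constructor poly
    field
      size₁ size₂ size₃ : ℕ
      coeff             : ℕ → ℕ → ℕ → Carrier

  -- Bounds the degree on every affinely parametrised line; the final `+ 0` is the degree of the
  -- constant coefficients.
  size : Poly → ℕ
  size (poly n₁ n₂ n₃ _) = n₁ ℕ.+ (n₂ ℕ.+ (n₃ ℕ.+ 0))

  ⟦_⟧ : Poly → Carrier → Carrier → Carrier → Carrier
  ⟦ poly n₁ n₂ n₃ a ⟧ t u w = horner n₁ (λ i → horner n₂ (λ j → horner n₃ (a i j) w) u) t

  ∂T ∂U ∂W : Poly → Poly
  ∂T (poly n₁ n₂ n₃ a) = poly (pred n₁) n₂ n₃ (λ i j k → nat (suc i) * a (suc i) j k)
  ∂U (poly n₁ n₂ n₃ a) = poly n₁ (pred n₂) n₃ (λ i j k → nat (suc j) * a i (suc j) k)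
  ∂W (poly n₁ n₂ n₃ a) = poly n₁ n₂ (pred n₃) (λ i j k → nat (suc k) * a i j (suc k))

  size-∂T : ∀ f → size (∂T f) ℕ.≤ size f
  size-∂T (poly n₁ n₂ n₃ a) = ℕₚ.+-monoˡ-≤ _ (ℕₚ.pred[n]≤n {n₁})

  size-∂U : ∀ f → size (∂U f) ℕ.≤ size f
  size-∂U (poly n₁ n₂ n₃ a) = ℕₚ.+-monoʳ-≤ n₁ (ℕₚ.+-monoˡ-≤ _ (ℕₚ.pred[n]≤n {n₂}))

  size-∂W : ∀ f → size (∂W f) ℕ.≤ size f
  size-∂W (poly n₁ n₂ n₃ a) = ℕₚ.+-monoʳ-≤ n₁ (ℕₚ.+-monoʳ-≤ n₂ (ℕₚ.+-monoˡ-≤ 0 (ℕₚ.pred[n]≤n {n₃})))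

  ⟦⟧-cong-coeff : ∀ n₁ n₂ n₃ {a b} t u w → (∀ i j k → a i j k ≈ b i j k) →
    ⟦ poly n₁ n₂ n₃ a ⟧ t u w ≈ ⟦ poly n₁ n₂ n₃ b ⟧ t u w
  ⟦⟧-cong-coeff n₁ n₂ n₃ t u w p =
    horner-cong n₁ t (λ i → horner-cong n₂ u (λ j → horner-cong n₃ w (p i j)))

  ∂-swap : ∀ x y z → x * (y * z) ≈ y * (x * z)
  ∂-swap = solve 3 (λ x y z → x :* (y :* z) := y :* (x :* z)) refl

  infix 4 _≃_
  -- Only polynomials of equal sizes are compared. This suffices for mixed partial derivatives,
  -- whose coefficients differ by the order of two integer factors.
  data _≃_ : Poly → Poly → Set (c ⊔ ℓ) where
    same : ∀ {n₁ n₂ n₃ f g} → (∀ i j k → f i j k ≈ g i j k) → poly n₁ n₂ n₃ f ≃ poly n₁ n₂ n₃ g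

  ≃-⟦⟧ : ∀ {f g} → f ≃ g → ∀ t u w → ⟦ f ⟧ t u w ≈ ⟦ g ⟧ t u w
  ≃-⟦⟧ (same {n₁} {n₂} {n₃} p) t u w = ⟦⟧-cong-coeff n₁ n₂ n₃ t u w p

  ≃-trans : ∀ {f g h} → f ≃ g → g ≃ h → f ≃ h
  ≃-trans (same p) (same q) = same (λ i j k → trans (p i j k) (q i j k))

  ∂U-cong : ∀ {f g} → f ≃ g → ∂U f ≃ ∂U g
  ∂U-cong (same p) = same (λ i j k → *-congˡ (p _ _ _))

  ∂W-cong : ∀ {f g} → f ≃ g → ∂W f ≃ ∂W g
  ∂W-cong (same p) = same (λ i j k → *-congˡ (p _ _ _))

  ∂T∂U≃ : ∀ f → ∂T (∂U f) ≃ ∂U (∂T f)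
  ∂T∂U≃ f = same (λ i j k → ∂-swap _ _ _)

  ∂U∂T≃ : ∀ f → ∂U (∂T f) ≃ ∂T (∂U f)
  ∂U∂T≃ f = same (λ i j k → ∂-swap _ _ _)

  ∂T∂W≃ : ∀ f → ∂T (∂W f) ≃ ∂W (∂T f)
  ∂T∂W≃ f = same (λ i j k → ∂-swap _ _ _)

  ∂U∂W≃ : ∀ f → ∂U (∂W f) ≃ ∂W (∂U f)
  ∂U∂W≃ f = same (λ i j k → ∂-swap _ _ _)

  chain-rule : ∀ f {T U W T′ U′ W′} → Derivative T T′ → Derivative U U′ → Derivative W W′ →
    Derivative (λ v → ⟦ f ⟧ (T v) (U v) (W v))
               (λ v → (T′ v * ⟦ ∂T f ⟧ (T v) (U v) (W v) + U′ v * ⟦ ∂U f ⟧ (T v) (U v) (W v))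
                      + W′ v * ⟦ ∂W f ⟧ (T v) (U v) (W v))
  chain-rule (poly n₁ n₂ n₃ a) {T} {U} {W} {T′} {U′} {W′} dT dU dW = derivative-cong (λ _ → refl) total (horner-derivative n₁ d₂ dT)
    where
    f₃ f₃′ : ℕ → ℕ → Carrier → Carrier
    f₃  i j v = horner n₃ (a i j) (W v)
    f₃′ i j v = horner (pred n₃) (∂ (a i j)) (W v)
    f₂ f₂ᵘ f₂ʷ : ℕ → Carrier → Carrier
    f₂  i v = horner n₂ (λ j → f₃ i j v) (U v)
    f₂ᵘ i v = horner (pred n₂) (λ j → horner n₃ (λ k → nat (suc j) * a i (suc j) k) (W v)) (U v)
    f₂ʷ i v = horner n₂ (λ j → f₃′ i j v) (U v)

    d₃ : ∀ i j → Derivative (f₃ i j) (λ v → W′ v * f₃′ i j v)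
    d₃ i j = derivative-cong (λ _ → refl)
      (λ v → trans (+-cong (horner-zero n₃ (W v) (λ _ _ → refl)) (*-congˡ (horner′≈horner-∂ n₃ (a i j) (W v)))) (+-identityˡ _))
      (horner-derivative n₃ (λ k → derivative-const (a i j k)) dW)

    d₂ : ∀ i → Derivative (f₂ i) (λ v → U′ v * f₂ᵘ i v + W′ v * f₂ʷ i v)
    d₂ i = derivative-cong (λ _ → refl)
      (λ v → trans (+-comm _ _) (+-cong
         (*-congˡ (trans (horner′≈horner-∂ n₂ (λ j → f₃ i j v) (U v))
           (horner-cong (pred n₂) (U v) (λ j → sym (horner-scale n₃ _ _ (W v))))))
         (horner-scale n₂ _ _ (U v))))
      (horner-derivative n₂ (d₃ i) dU)

    total : ∀ v → _ ≈ _
    total v = begin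
      horner n₁ (λ i → U′ v * f₂ᵘ i v + W′ v * f₂ʷ i v) (T v) + T′ v * horner′ n₁ (λ i → f₂ i v) (T v)
        ≈⟨ +-cong (trans (horner-+ n₁ _ _ (T v)) (+-cong (horner-scale n₁ _ _ (T v)) (horner-scale n₁ _ _ (T v))))
             (*-congˡ (trans (horner′≈horner-∂ n₁ (λ i → f₂ i v) (T v))
               (horner-cong (pred n₁) (T v) (λ i → trans (sym (horner-scale n₂ _ _ (U v)))
                  (horner-cong n₂ (U v) (λ j → sym (horner-scale n₃ _ _ (W v)))))))) ⟩
      (U′ v * horner n₁ (λ i → f₂ᵘ i v) (T v) + W′ v * horner n₁ (λ i → f₂ʷ i v) (T v))
        + T′ v * ⟦ ∂T (poly n₁ n₂ n₃ a) ⟧ (T v) (U v) (W v)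
        ≈⟨ solve 3 (λ x y z → (x :+ y) :+ z := (z :+ x) :+ y) refl _ _ _ ⟩
      (T′ v * ⟦ ∂T (poly n₁ n₂ n₃ a) ⟧ (T v) (U v) (W v) + U′ v * horner n₁ (λ i → f₂ᵘ i v) (T v))
        + W′ v * horner n₁ (λ i → f₂ʷ i v) (T v) ∎

  degree-restriction : ∀ f {T U W} → Degree≤ 1 T → Degree≤ 1 U → Degree≤ 1 W →
    Degree≤ (size f) (λ v → ⟦ f ⟧ (T v) (U v) (W v))
  degree-restriction (poly n₁ n₂ n₃ a) dT dU dW =
    horner-degree n₁ (λ i → horner-degree n₂ (λ j → horner-degree n₃ (λ k → degree-const (a i j k)) dW) dU) dT

  horner-cong-arg : ∀ n {a b} {x y} → x ≈ y → (∀ i → a i ≈ b i) → horner n a x ≈ horner n b y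
  horner-cong-arg zero    x≈y a≈b = refl
  horner-cong-arg (suc n) x≈y a≈b = +-cong (a≈b 0) (*-cong x≈y (horner-cong-arg n x≈y (a≈b ∘ suc)))

  ⟦⟧-cong : ∀ f {t t′ u u′ w w′} → t ≈ t′ → u ≈ u′ → w ≈ w′ → ⟦ f ⟧ t u w ≈ ⟦ f ⟧ t′ u′ w′
  ⟦⟧-cong (poly n₁ n₂ n₃ a) p q r = horner-cong-arg n₁ p (λ i → horner-cong-arg n₂ q (λ j → horner-cong-arg n₃ r (λ _ → refl)))

  extend : ∀ {n} → (Fin n → Carrier) → ℕ → Carrier
  extend {zero}  x i       = 0#
  extend {suc n} x zero    = x zero
  extend {suc n} x (suc i) = extend (x ∘ suc) i

  extend-toℕ : ∀ {n} (x : Fin n → Carrier) i → extend x (toℕ i) ≡ x i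
  extend-toℕ x zero    = ≡.refl
  extend-toℕ x (suc i) = extend-toℕ (x ∘ suc) i

  extend-cong : ∀ {n} {x y : Fin n → Carrier} → (∀ i → x i ≈ y i) → ∀ i → extend x i ≈ extend y i
  extend-cong {zero}  p i       = refl
  extend-cong {suc n} p zero    = p zero
  extend-cong {suc n} p (suc i) = extend-cong (p ∘ suc) i

  extend-+ : ∀ {n} (x y : Fin n → Carrier) i → extend (λ j → x j + y j) i ≈ extend x i + extend y i
  extend-+ {zero}  x y i       = sym (+-identityˡ 0#)
  extend-+ {suc n} x y zero    = refl
  extend-+ {suc n} x y (suc i) = extend-+ (x ∘ suc) (y ∘ suc) i

  extend-scale : ∀ {n} r (x : Fin n → Carrier) i → extend (λ j → r * x j) i ≈ r * extend x i
  extend-scale {zero}  r x i       = sym (zeroʳ r)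
  extend-scale {suc n} r x zero    = refl
  extend-scale {suc n} r x (suc i) = extend-scale r (x ∘ suc) i

  module _ (d : ℕ) where
    unknowns : ℕ
    unknowns = d ℕ.* (d ℕ.* d)

    cube : (Fin unknowns → Carrier) → ℕ → ℕ → ℕ → Carrier
    cube x i j k = extend {d} (λ a → extend {d} (λ b → extend {d} (λ e → x (Fin.combine a (Fin.combine b e))) k) j) i

    fromVector : (Fin unknowns → Carrier) → Poly
    fromVector x = poly d d d (cube x)

    cube-cong : ∀ {x y} → (∀ i → x i ≈ y i) → ∀ i j k → cube x i j k ≈ cube y i j k
    cube-cong p i j k = extend-cong {d} (λ a → extend-cong {d} (λ b → extend-cong {d} (λ e → p _) k) j) i

    cube-+ : ∀ x y i j k → cube (λ l → x l + y l) i j k ≈ cube x i j k + cube y i j k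
    cube-+ x y i j k = trans
      (extend-cong {d} (λ a → trans (extend-cong {d} (λ b → extend-+ {d} _ _ k) j) (extend-+ {d} _ _ j)) i)
      (extend-+ {d} _ _ i)

    cube-scale : ∀ r x i j k → cube (λ l → r * x l) i j k ≈ r * cube x i j k
    cube-scale r x i j k = trans
      (extend-cong {d} (λ a → trans (extend-cong {d} (λ b → extend-scale {d} _ _ k) j) (extend-scale {d} _ _ j)) i)
      (extend-scale {d} _ _ i)

    cube-lookup : ∀ x (a b e : Fin d) → cube x (toℕ a) (toℕ b) (toℕ e) ≡ x (Fin.combine a (Fin.combine b e))
    cube-lookup x a b e = ≡.trans (extend-toℕ {d} _ a) (≡.trans (extend-toℕ {d} _ b) (extend-toℕ {d} _ e))

    evaluationForm : Carrier → Carrier → Carrier → LinearForm unknowns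
    evaluationForm t u w = record
      { apply       = λ x → ⟦ fromVector x ⟧ t u w
      ; apply-cong  = λ p → ⟦⟧-cong-coeff d d d t u w (cube-cong p)
      ; apply-+     = λ x y → trans (⟦⟧-cong-coeff d d d t u w (cube-+ x y))
          (trans (horner-cong d t (λ i → trans (horner-cong d u (λ j → horner-+ d _ _ w)) (horner-+ d _ _ u))) (horner-+ d _ _ t))
      ; apply-scale = λ r x → trans (⟦⟧-cong-coeff d d d t u w (cube-scale r x))
          (trans (horner-cong d t (λ i → trans (horner-cong d u (λ j → horner-scale d _ _ w)) (horner-scale d _ _ u))) (horner-scale d _ _ t))
      }

    -- Parameter count: a box of side `d` holds d³ coefficients, and the degree on a line is at most
    -- 3d, so that 3d + 1 linear conditions, one for each sample, force vanishing on that line.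
    vanishing-exists : ∀ {n} (T U W : Fin n → Carrier → Carrier) →
      (∀ i → Degree≤ 1 (T i)) → (∀ i → Degree≤ 1 (U i)) → (∀ i → Degree≤ 1 (W i)) →
      n ℕ.* suc (d ℕ.+ (d ℕ.+ (d ℕ.+ 0))) ℕ.< unknowns →
      ¬ ¬ ∃ λ a → (∀ i v → ⟦ poly d d d a ⟧ (T i v) (U i v) (W i v) ≈ 0#)
                × ¬ (∀ i j k → i ℕ.< d → j ℕ.< d → k ℕ.< d → a i j k ≈ 0#)
    vanishing-exists {n} T U W dT dU dW few k = kernel-nontrivial _ _ few forms λ (x , zeros , x≉0) →
      k ( cube x
        , (λ i → roots⇒zero (degree-restriction (fromVector x) (dT i) (dU i) (dW i)) (sample ∘ toℕ) sample-distinct-Fin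
            λ j → ≡.subst (λ (i , j) → ⟦ fromVector x ⟧ (T i (sample (toℕ j))) (U i (sample (toℕ j))) (W i (sample (toℕ j))) ≈ 0#)
                    (Finₚ.remQuot-combine i j) (zeros (Fin.combine i j)))
        , λ a≈0 → x≉0 λ l → ≡.subst (λ l → x l ≈ 0#) (split l) (trans (reflexive (≡.sym (cube-lookup x (index₁ l) (index₂ l) (index₃ l))))
            (a≈0 _ _ _ (Finₚ.toℕ<n _) (Finₚ.toℕ<n _) (Finₚ.toℕ<n _))))
      where
      s : ℕ
      s = suc (d ℕ.+ (d ℕ.+ (d ℕ.+ 0)))
      forms : Fin (n ℕ.* s) → LinearForm unknowns
      forms l = let (i , j) = Fin.remQuot {n} s l ; v = sample (toℕ j) in evaluationForm (T i v) (U i v) (W i v)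
      index₁ index₂ index₃ : Fin unknowns → Fin d
      index₁ l = proj₁ (Fin.remQuot {d} (d ℕ.* d) l)
      index₂ l = proj₁ (Fin.remQuot {d} d (proj₂ (Fin.remQuot {d} (d ℕ.* d) l)))
      index₃ l = proj₂ (Fin.remQuot {d} d (proj₂ (Fin.remQuot {d} (d ℕ.* d) l)))
      split : ∀ l → Fin.combine (index₁ l) (Fin.combine (index₂ l) (index₃ l)) ≡ l
      split l = ≡.trans (≡.cong (Fin.combine (index₁ l)) (Finₚ.combine-remQuot {d} d _)) (Finₚ.combine-remQuot {d} (d ℕ.* d) l)

-- Counting indices by injections.

¬¬-all : ∀ {ℓ n} {P : Fin n → Set ℓ} → (∀ i → ¬ ¬ P i) → ¬ ¬ (∀ i → P i)
¬¬-all {n = zero}  p k = k λ ()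
¬¬-all {n = suc n} p k = p zero λ p₀ → ¬¬-all (p ∘ suc) λ ps → k λ { zero → p₀ ; (suc i) → ps i }

infix 4 _Many_

-- A lower bound on a number of indices, given by an injection because `P` need not be decidable and
-- so has no count.
_Many_ : ∀ {ℓ n} → ℕ → (Fin n → Set ℓ) → Set ℓ
_Many_ {n = n} N P = ∃ λ (g : Fin N → Fin n) → Injective _≡_ _≡_ g × (∀ x → P (g x))

many-weaken : ∀ {ℓ n} {P : Fin n → Set ℓ} {M N} → M ℕ.≤ N → N Many P → M Many P
many-weaken M≤N (g , inj , p) = (λ x → g (Fin.inject≤ x M≤N)) , (λ e → Finₚ.inject≤-injective M≤N M≤N _ _ (inj e)) , λ x → p _

many-map : ∀ {ℓ ℓ′ n} {P : Fin n → Set ℓ} {Q : Fin n → Set ℓ′} {N} → (∀ i → P i → Q i) → N Many P → N Many Q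
many-map f (g , inj , p) = g , inj , λ x → f _ (p x)

private
  shift : ∀ {ℓ n N} {P : Fin (suc n) → Set ℓ} → N Many (P ∘ suc) → N Many P
  shift (g , inj , p) = suc ∘ g , (λ e → inj (Finₚ.suc-injective e)) , p

  grow : ∀ {ℓ n N} {P : Fin (suc n) → Set ℓ} → P zero → N Many (P ∘ suc) → suc N Many P
  grow {N = N} {P} p₀ (g , inj , p) = g′ , inj′ , p′
    where
    g′ : Fin (suc N) → Fin _
    g′ zero    = zero
    g′ (suc x) = suc (g x)
    inj′ : Injective _≡_ _≡_ g′
    inj′ {zero}  {zero}  e = ≡.refl
    inj′ {suc x} {suc y} e = ≡.cong suc (inj (Finₚ.suc-injective e))
    p′ : ∀ x → P (g′ x)
    p′ zero    = p₀
    p′ (suc x) = p x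

  none : ∀ {ℓ n} {P : Fin n → Set ℓ} → 0 Many P
  none = (λ ()) , (λ { {()} }) , λ ()

-- Pigeonhole in sharp form: fewer than `M` indices of the first kind and fewer than `N` of the
-- second make at most M + N - 2 in total.
split-Fin : ∀ {ℓ ℓ′ n} {P : Fin n → Set ℓ} {Q : Fin n → Set ℓ′} → (∀ i → P i ⊎ Q i) →
            ∀ M N → M ℕ.+ N ℕ.≤ suc n → M Many P ⊎ N Many Q
split-Fin {n = zero}  {P} {Q} pq zero    N       le = inj₁ (none {P = P})
split-Fin {n = zero}  {P} {Q} pq (suc M) zero    le = inj₂ (none {P = Q})
split-Fin {n = zero}  pq (suc M) (suc N) (s≤s le) with ℕₚ.≤-trans (ℕₚ.≤-reflexive (≡.sym (ℕₚ.+-suc M N))) le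
... | ()
split-Fin {n = suc n} {P} {Q} pq zero    N       le = inj₁ (none {P = P})
split-Fin {n = suc n} {P} {Q} pq (suc M) zero    le = inj₂ (none {P = Q})
split-Fin {n = suc n} {P} {Q} pq (suc M) (suc N) (s≤s le) with pq zero
... | inj₁ p₀ with split-Fin {P = P ∘ suc} {Q ∘ suc} (pq ∘ suc) M (suc N) le
...   | inj₁ ps = inj₁ (grow {P = P} p₀ ps)
...   | inj₂ qs = inj₂ (shift {P = Q} qs)
split-Fin {n = suc n} {P} {Q} pq (suc M) (suc N) (s≤s le) | inj₂ q₀
  with split-Fin {P = P ∘ suc} {Q ∘ suc} (pq ∘ suc) (suc M) N (ℕₚ.≤-trans (ℕₚ.≤-reflexive (≡.sym (ℕₚ.+-suc M N))) le)
...   | inj₁ ps = inj₁ (shift {P = P} ps)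
...   | inj₂ qs = inj₂ (grow {P = Q} q₀ qs)

split-many : ∀ {ℓ ℓ′ ℓ″ n} {R : Fin n → Set ℓ} {P : Fin n → Set ℓ′} {Q : Fin n → Set ℓ″} M N →
             (M ℕ.+ N) Many R → ((i : Fin n) → ¬ ¬ (P i ⊎ Q i)) →
             ¬ ¬ (M Many (λ i → R i × P i) ⊎ N Many (λ i → R i × Q i))
split-many {R = R} {P} {Q} M N (g , inj , r) pq k = ¬¬-all (pq ∘ g) λ pq′ →
  k (via (split-Fin pq′ M N (ℕₚ.n≤1+n _)))
  where
  via : M Many (P ∘ g) ⊎ N Many (Q ∘ g) → M Many (λ i → R i × P i) ⊎ N Many (λ i → R i × Q i)
  via (inj₁ (g′ , inj′ , p)) = inj₁ (g ∘ g′ , (λ e → inj′ (inj e)) , λ x → r _ , p x)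
  via (inj₂ (g′ , inj′ , q)) = inj₂ (g ∘ g′ , (λ e → inj′ (inj e)) , λ x → r _ , q x)

-- Red and blue lines with many crossings: the polynomial method.

-- With red lines T = h U - y, W = z and blue lines T = a - d W, U = - b, a red and a blue
-- line meet iff a + y + b h = d z, and then at (U , W) = (- b , z). The degrees of the polynomials
-- considered are at most σ.
record Configuration {r s : Level} (D : InfiniteDomain r s) : Set (r ⊔ lsuc s) where
  open InfiniteDomain D hiding (zero)
  open Univariate D using (nat)
  field
    m n σ k     : ℕ
    y z h       : Fin m → Carrier
    a b d       : Fin n → Carrier
    z-distinct  : ∀ i i′ → i ≢ i′ → ¬ z i ≈ z i′
    b-distinct  : ∀ j j′ → j ≢ j′ → ¬ b j ≈ b j′
    Red         : Fin m → Set
    Blue        : Fin n → Set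
    Adjacent    : Fin m → Fin n → Set
    incident    : ∀ {i j} → Adjacent i j → (a j + y i) + b j * h i ≈ d j * z i
    red-degree  : ∀ {i} → Red i → (suc (suc k) ℕ.+ suc (σ ℕ.+ (σ ℕ.+ (σ ℕ.+ σ)))) Many (λ j → Blue j × Adjacent i j)
    blue-degree : ∀ {j} → Blue j → suc (σ ℕ.+ (σ ℕ.+ σ)) Many (λ i → Red i × Adjacent i j)
    -- For planes through one point, such an affine relation between `d` and `b` means that they
    -- share a line.
    pencil      : ∀ {i} → Red i → ∀ α β γ → ¬ α ≈ 0# →
                  ¬ suc (suc k) Many (λ j → Adjacent i j × α * d j + β * b j ≈ γ)
    -- The two uses of `ode-unique` concern polynomials of degrees at most 2σ and σ + 1.
    large-char  : ∀ j → 1 ℕ.≤ j → j ℕ.≤ suc (σ ℕ.+ σ) → ¬ nat j ≈ 0#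

module Descent {r s : Level} (D : InfiniteDomain r s) (conf : Configuration D) where
  open InfiniteDomain D hiding (zero)
  open IntegerSolver commutativeRing
  open RingProperties ring using (-‿injective)
  open SetoidReasoning setoid
  open Univariate D
  open Trivariate D
  open Configuration conf

  onRed : Fin m → Poly → Carrier → Carrier
  onRed i f u = ⟦ f ⟧ (h i * u - y i) u (z i)

  onBlue : Fin n → Poly → Carrier → Carrier
  onBlue j f w = ⟦ f ⟧ (a j - d j * w) (- b j) w

  onRed-cong : ∀ i f {u v} → u ≈ v → onRed i f u ≈ onRed i f v
  onRed-cong i f p = ⟦⟧-cong f (+-congʳ (*-congˡ p)) p refl

  -- The incidence equation says precisely that the two lines have the same T-coordinate at U = - b,
  -- W = z.
  crossing : ∀ {i j} → Adjacent i j → ∀ f → onRed i f (- b j) ≈ onBlue j f (z i)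
  crossing {i} {j} ij f = ⟦⟧-cong f (begin
      h i * - b j - y i
        ≈⟨ solve 4 (λ a y b h → h :* (:- b) :- y := a :- ((a :+ y) :+ b :* h)) refl (a j) (y i) (b j) (h i) ⟩
      a j - ((a j + y i) + b j * h i)
        ≈⟨ +-congˡ (-‿cong (incident ij)) ⟩
      a j - d j * z i ∎) refl refl

  degree-minus : ∀ {e φ} x → Degree≤ e φ → Degree≤ e (λ u → φ u - x)
  degree-minus x p = degree-+ p (degree-const (- x))

  onRed-degree : ∀ i f {U} → Degree≤ 1 U → Degree≤ (size f) (λ v → onRed i f (U v))
  onRed-degree i f dU = degree-restriction f (degree-minus (y i) (degree-scale (h i) dU)) dU (degree-const (z i))

  onBlue-degree : ∀ j f → Degree≤ (size f) (onBlue j f)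
  onBlue-degree j f = degree-restriction f
    (degree-+ (degree-const (a j)) (degree-neg (degree-scale (d j) degree-id))) (degree-const (- b j)) degree-id

  onRed-derivative : ∀ i f {U} → Derivative U (λ _ → 1#) →
    Derivative (λ v → onRed i f (U v)) (λ v → onRed i (∂U f) (U v) + h i * onRed i (∂T f) (U v))
  onRed-derivative i f {U} dU = derivative-cong (λ _ → refl)
    (λ v → begin
      ((h i * 1# + 0#) * onRed i (∂T f) (U v) + 1# * onRed i (∂U f) (U v)) + 0# * onRed i (∂W f) (U v)
        ≈⟨ +-congʳ (+-cong (*-congʳ (trans (+-identityʳ _) (*-identityʳ _))) (*-identityˡ _)) ⟩
      (h i * onRed i (∂T f) (U v) + onRed i (∂U f) (U v)) + 0# * onRed i (∂W f) (U v)
        ≈⟨ solve 4 (λ h x y z → (h :* x :+ y) :+ con (+ 0) :* z := y :+ h :* x) refl _ _ _ _ ⟩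
      onRed i (∂U f) (U v) + h i * onRed i (∂T f) (U v) ∎)
    (chain-rule f (derivative-+ (derivative-scale (h i) dU) (derivative-const (- y i))) dU (derivative-const (z i)))

  onBlue-derivative : ∀ j f → Derivative (onBlue j f) (λ w → onBlue j (∂W f) w - d j * onBlue j (∂T f) w)
  onBlue-derivative j f = derivative-cong (λ _ → refl)
    (λ w → begin
      ((0# + - (d j * 1#)) * onBlue j (∂T f) w + 0# * onBlue j (∂U f) w) + 1# * onBlue j (∂W f) w
        ≈⟨ +-cong (+-congʳ (*-congʳ (+-congˡ (-‿cong (*-identityʳ _))))) (*-identityˡ _) ⟩
      ((0# + - d j) * onBlue j (∂T f) w + 0# * onBlue j (∂U f) w) + onBlue j (∂W f) w
        ≈⟨ solve 4 (λ d x y z → ((con (+ 0) :+ :- d) :* x :+ con (+ 0) :* y) :+ z := z :- d :* x) refl _ _ _ _ ⟩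
      onBlue j (∂W f) w - d j * onBlue j (∂T f) w ∎)
    (chain-rule f (derivative-+ (derivative-const (a j)) (derivative-neg (derivative-scale (d j) derivative-id)))
      (derivative-const (- b j)) derivative-id)

  -- The crossings on a red line have distinct parameters `- b j`, and there are more than 4σ of
  -- them. In `blue-zero` the parameters are `z i` and the bound is 3σ.
  red-zero : ∀ {i e φ} → Red i → Degree≤ e φ → e ℕ.≤ σ ℕ.+ (σ ℕ.+ (σ ℕ.+ σ)) →
    (∀ {j} → Blue j → Adjacent i j → φ (- b j) ≈ 0#) → ∀ u → φ u ≈ 0#
  red-zero {i} red deg e≤ zeros with many-weaken {P = λ j → Blue j × Adjacent i j} (ℕₚ.≤-trans (s≤s e≤) (ℕₚ.m≤n+m _ (suc (suc k)))) (red-degree red)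
  ... | g , inj , bg = roots⇒zero deg (λ x → - b (g x))
    (λ x x′ x≢x′ p → b-distinct _ _ (λ e → x≢x′ (inj e)) (-‿injective p))
    (λ x → zeros (proj₁ (bg x)) (proj₂ (bg x)))

  blue-zero : ∀ {j e φ} → Blue j → Degree≤ e φ → e ℕ.≤ σ ℕ.+ (σ ℕ.+ σ) →
    (∀ {i} → Red i → Adjacent i j → φ (z i) ≈ 0#) → ∀ w → φ w ≈ 0#
  blue-zero {j} blue deg e≤ zeros with many-weaken {P = λ i → Red i × Adjacent i j} (s≤s e≤) (blue-degree blue)
  ... | g , inj , rg = roots⇒zero deg (λ x → z (g x))
    (λ x x′ x≢x′ → z-distinct _ _ (λ e → x≢x′ (inj e)))
    (λ x → zeros (proj₁ (rg x)) (proj₂ (rg x)))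

  VanishesOnRed VanishesOnBlue : Poly → Set (r ⊔ s)
  VanishesOnRed  f = ∀ {i} → Red i → ∀ u → onRed i f u ≈ 0#
  VanishesOnBlue f = ∀ {j} → Blue j → ∀ w → onBlue j f w ≈ 0#

  red⇒blue : ∀ {f} → size f ℕ.≤ σ → VanishesOnRed f → VanishesOnBlue f
  red⇒blue {f} small vr blue = blue-zero blue (onBlue-degree _ f) (ℕₚ.≤-trans small (ℕₚ.m≤m+n σ _))
    (λ red ij → trans (sym (crossing ij f)) (vr red _))

  blue⇒red : ∀ {f} → size f ℕ.≤ σ → VanishesOnBlue f → VanishesOnRed f
  blue⇒red {f} small vb red = red-zero red (onRed-degree _ f degree-id) (ℕₚ.≤-trans small (ℕₚ.m≤m+n σ _))
    (λ blue ij → trans (crossing ij f) (vb blue _))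

  module _ (f : Poly) (small : size f ℕ.≤ σ) (vr : VanishesOnRed f) (vb : VanishesOnBlue f) where

    A B C TT UT UU : Poly
    A  = ∂T f
    B  = ∂U f
    C  = ∂W f
    TT = ∂T A
    UT = ∂U A
    UU = ∂U B

    small-∂T : ∀ {g} → size g ℕ.≤ σ → size (∂T g) ℕ.≤ σ
    small-∂T {g} = ℕₚ.≤-trans (size-∂T g)
    small-∂U : ∀ {g} → size g ℕ.≤ σ → size (∂U g) ℕ.≤ σ
    small-∂U {g} = ℕₚ.≤-trans (size-∂U g)
    small-∂W : ∀ {g} → size g ℕ.≤ σ → size (∂W g) ℕ.≤ σ
    small-∂W {g} = ℕₚ.≤-trans (size-∂W g)

    sA : size A ℕ.≤ σ
    sA = small-∂T {f} small
    sB : size B ℕ.≤ σ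
    sB = small-∂U {f} small
    sC : size C ℕ.≤ σ
    sC = small-∂W {f} small

    red₁ : ∀ {i} → Red i → ∀ u → onRed i B u + h i * onRed i A u ≈ 0#
    red₁ {i} red = derivative-of-zero (onRed-derivative i f derivative-id) (vr red)

    red₁′ : ∀ {i} → Red i → ∀ u → onRed i B u ≈ - (h i * onRed i A u)
    red₁′ {i} red u = trans (solve 2 (λ x y → x := (x :+ y) :- y) refl _ _)
      (trans (+-congʳ (red₁ red u)) (+-identityˡ _))

    -- `red₁` differentiated once more along the red direction (h , 1 , 0).
    red₂ : ∀ {i} → Red i → ∀ u →
      onRed i UU u ≈ - ((h i * onRed i UT u + h i * onRed i UT u) + h i * (h i * onRed i TT u))
    red₂ {i} red u = begin
      onRed i UU u
        ≈⟨ solve 4 (λ h x y z → x := ((x :+ h :* y) :+ h :* (y :+ h :* z)) :- ((h :* y :+ h :* y) :+ h :* (h :* z))) refl _ _ _ _ ⟩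
      ((onRed i UU u + h i * onRed i UT u) + h i * (onRed i UT u + h i * onRed i TT u))
        - ((h i * onRed i UT u + h i * onRed i UT u) + h i * (h i * onRed i TT u))
        ≈⟨ +-congʳ (+-congʳ (+-congˡ (*-congˡ (≃-⟦⟧ (∂T∂U≃ f) _ _ _)))) ⟨
      ((onRed i UU u + h i * onRed i (∂T B) u) + h i * (onRed i UT u + h i * onRed i TT u))
        - ((h i * onRed i UT u + h i * onRed i UT u) + h i * (h i * onRed i TT u))
        ≈⟨ +-congʳ (derivative-of-zero (derivative-+ (onRed-derivative i B derivative-id)
             (derivative-scale (h i) (onRed-derivative i A derivative-id))) (red₁ red) u) ⟩
      0# - ((h i * onRed i UT u + h i * onRed i UT u) + h i * (h i * onRed i TT u))
        ≈⟨ +-identityˡ _ ⟩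
      - ((h i * onRed i UT u + h i * onRed i UT u) + h i * (h i * onRed i TT u)) ∎

    -- The blue direction is (- d , 0 , 1), so the derivative of `f` along a blue line is C - d A.
    blue₁ : ∀ {j} → Blue j → ∀ w → onBlue j C w ≈ d j * onBlue j A w
    blue₁ {j} blue w = trans (solve 2 (λ x y → x := (x :- y) :+ y) refl _ _)
      (trans (+-congʳ (derivative-of-zero (onBlue-derivative j f) (vb blue) w)) (+-identityˡ _))

    -- The second derivative of f along the tangent (-B , A) of the plane section W = const,
    -- so it vanishes on lines inside such sections.
    form : (A B UU UT TT : Carrier) → Carrier
    form A B UU UT TT = ((A * A * UU - A * B * UT) - A * B * UT) + B * B * TT

    -- The product rule for `form`. The derivatives of the arguments are separate inputs, to be
    -- filled with partial derivatives in `Ψ` and with derivatives along a line in `Ψ-blue`.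
    form′ : (A B UU UT TT A′ B′ UU′ UT′ TT′ : Carrier) → Carrier
    form′ A B UU UT TT A′ B′ UU′ UT′ TT′ =
      ((((A′ * A + A * A′) * UU + A * A * UU′) - ((A′ * B + A * B′) * UT + A * B * UT′))
        - ((A′ * B + A * B′) * UT + A * B * UT′)) + ((B′ * B + B * B′) * TT + B * B * TT′)

    form-degree : ∀ {A B UU UT TT} → Degree≤ σ A → Degree≤ σ B → Degree≤ σ UU → Degree≤ σ UT → Degree≤ σ TT →
      Degree≤ (σ ℕ.+ σ ℕ.+ σ) (λ v → form (A v) (B v) (UU v) (UT v) (TT v))
    form-degree A B UU UT TT = degree-+ (degree-+ (degree-+ (degree-* (degree-* A A) UU)
      (degree-neg (degree-* (degree-* A B) UT))) (degree-neg (degree-* (degree-* A B) UT))) (degree-* (degree-* B B) TT)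

    form′-degree : ∀ {A B UU UT TT A′ B′ UU′ UT′ TT′} → Degree≤ σ A → Degree≤ σ B → Degree≤ σ UU → Degree≤ σ UT → Degree≤ σ TT →
      Degree≤ σ A′ → Degree≤ σ B′ → Degree≤ σ UU′ → Degree≤ σ UT′ → Degree≤ σ TT′ →
      Degree≤ (σ ℕ.+ σ ℕ.+ σ) (λ v → form′ (A v) (B v) (UU v) (UT v) (TT v) (A′ v) (B′ v) (UU′ v) (UT′ v) (TT′ v))
    form′-degree A B UU UT TT A′ B′ UU′ UT′ TT′ =
      degree-+ (degree-+ (degree-+ (Leibniz A A UU A′ A′ UU′) (degree-neg (Leibniz A B UT A′ B′ UT′)))
        (degree-neg (Leibniz A B UT A′ B′ UT′))) (Leibniz B B TT B′ B′ TT′)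
      where
      Leibniz : ∀ {x y z x′ y′ z′} → Degree≤ σ x → Degree≤ σ y → Degree≤ σ z → Degree≤ σ x′ → Degree≤ σ y′ → Degree≤ σ z′ →
        Degree≤ (σ ℕ.+ σ ℕ.+ σ) (λ v → (x′ v * y v + x v * y′ v) * z v + x v * y v * z′ v)
      Leibniz x y z x′ y′ z′ = degree-+ (degree-* (degree-+ (degree-* x′ y) (degree-* x y′)) z) (degree-* (degree-* x y) z′)

    form-cong : ∀ {A B UU UT TT Ā B̄ ŪŪ ŪT̄ T̄T̄} → A ≈ Ā → B ≈ B̄ → UU ≈ ŪŪ → UT ≈ ŪT̄ → TT ≈ T̄T̄ →
      form A B UU UT TT ≈ form Ā B̄ ŪŪ ŪT̄ T̄T̄
    form-cong p q r s t = +-cong (+-cong (+-cong (*-cong (*-cong p p) r) (-‿cong (*-cong (*-cong p q) s)))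
      (-‿cong (*-cong (*-cong p q) s))) (*-cong (*-cong q q) t)

    redDegree : ∀ i {g} {U} → size g ℕ.≤ σ → Degree≤ 1 U → Degree≤ σ (λ v → onRed i g (U v))
    redDegree i {g} sg dU = degree-weaken sg (onRed-degree i g dU)

    blueDegree : ∀ j {g} → size g ℕ.≤ σ → Degree≤ σ (onBlue j g)
    blueDegree j {g} sg = degree-weaken sg (onBlue-degree j g)

    sTT : size TT ℕ.≤ σ
    sTT = small-∂T {A} sA
    sUT : size UT ℕ.≤ σ
    sUT = small-∂U {A} sA
    sUU : size UU ℕ.≤ σ
    sUU = small-∂U {B} sB

    Φ : Carrier → Carrier → Carrier → Carrier
    Φ t u w = form (⟦ A ⟧ t u w) (⟦ B ⟧ t u w) (⟦ UU ⟧ t u w) (⟦ UT ⟧ t u w) (⟦ TT ⟧ t u w)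

    -- The derivative of `Φ` in the direction (- C , 0 , A). On a blue line C = d A makes this A
    -- times the derivative along the line; but it is defined on the whole space without reference
    -- to `d j`, and can therefore be carried over to red lines.
    Ψ : Carrier → Carrier → Carrier → Carrier
    Ψ t u w = ⟦ A ⟧ t u w * along ∂W - ⟦ C ⟧ t u w * along ∂T
      where
      along : (Poly → Poly) → Carrier
      along ∂ = form′ (⟦ A ⟧ t u w) (⟦ B ⟧ t u w) (⟦ UU ⟧ t u w) (⟦ UT ⟧ t u w) (⟦ TT ⟧ t u w)
                      (⟦ ∂ A ⟧ t u w) (⟦ ∂ B ⟧ t u w) (⟦ ∂ UU ⟧ t u w) (⟦ ∂ UT ⟧ t u w) (⟦ ∂ TT ⟧ t u w)

    form′-cong : ∀ {A B UU UT TT A′ B′ UU′ UT′ TT′ Ā B̄ ŪŪ ŪT̄ T̄T̄ Ā′ B̄′ ŪŪ′ ŪT̄′ T̄T̄′} →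
      A ≈ Ā → B ≈ B̄ → UU ≈ ŪŪ → UT ≈ ŪT̄ → TT ≈ T̄T̄ → A′ ≈ Ā′ → B′ ≈ B̄′ → UU′ ≈ ŪŪ′ → UT′ ≈ ŪT̄′ → TT′ ≈ T̄T̄′ →
      form′ A B UU UT TT A′ B′ UU′ UT′ TT′ ≈ form′ Ā B̄ ŪŪ ŪT̄ T̄T̄ Ā′ B̄′ ŪŪ′ ŪT̄′ T̄T̄′
    form′-cong p q r s t p′ q′ r′ s′ t′ =
      +-cong (+-cong (+-cong (Leibniz p p r p′ p′ r′) (-‿cong (Leibniz p q s p′ q′ s′)))
        (-‿cong (Leibniz p q s p′ q′ s′))) (Leibniz q q t q′ q′ t′)
      where
      Leibniz : ∀ {x y z x′ y′ z′ x̄ ȳ z̄ x̄′ ȳ′ z̄′} → x ≈ x̄ → y ≈ ȳ → z ≈ z̄ → x′ ≈ x̄′ → y′ ≈ ȳ′ → z′ ≈ z̄′ →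
        (x′ * y + x * y′) * z + x * y * z′ ≈ (x̄′ * ȳ + x̄ * ȳ′) * z̄ + x̄ * ȳ * z̄′
      Leibniz x y z x′ y′ z′ = +-cong (*-cong (+-cong (*-cong x′ y) (*-cong x y′)) z) (*-cong (*-cong x y) z′)

    -- Since B = - h A, the vector (- B , A) is A times the red direction, and `Φ` is A² times the
    -- second derivative that vanishes by `red₂`.
    Φ-red : ∀ {i} → Red i → ∀ u → Φ (h i * u - y i) u (z i) ≈ 0#
    Φ-red red u = trans (form-cong refl (red₁′ red u) (red₂ red u) refl refl)
      (solve 4 (λ A h ut tt → let B = :- (h :* A) ; uu = :- ((h :* ut :+ h :* ut) :+ h :* (h :* tt)) in
        ((A :* A :* uu :- A :* B :* ut) :- A :* B :* ut) :+ B :* B :* tt := con (+ 0)) refl _ _ _ _)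

    Φ-blue : ∀ {j} → Blue j → ∀ w → Φ (a j - d j * w) (- b j) w ≈ 0#
    Φ-blue {j} blue = blue-zero blue
      (form-degree (blueDegree j {A} sA) (blueDegree j {B} sB) (blueDegree j {UU} sUU) (blueDegree j {UT} sUT) (blueDegree j {TT} sTT))
      (ℕₚ.≤-reflexive (ℕₚ.+-assoc σ σ σ))
      (λ red ij → trans (sym (form-cong (crossing ij A) (crossing ij B) (crossing ij UU) (crossing ij UT) (crossing ij TT)))
        (Φ-red red _))

    Ψ-blue : ∀ {j} → Blue j → ∀ w → Ψ (a j - d j * w) (- b j) w ≈ 0#
    Ψ-blue {j} blue w = begin
      Ψ (a j - d j * w) (- b j) w
        ≈⟨ +-congˡ (-‿cong (*-congʳ (blue₁ blue w))) ⟩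
      X A * form′ (X A) (X B) (X UU) (X UT) (X TT) (X (∂W A)) (X (∂W B)) (X (∂W UU)) (X (∂W UT)) (X (∂W TT))
        - d j * X A * form′ (X A) (X B) (X UU) (X UT) (X TT) (X (∂T A)) (X (∂T B)) (X (∂T UU)) (X (∂T UT)) (X (∂T TT))
        -- `form′` is linear in its primed arguments, so the two partial derivatives merge into the
        -- derivative along the blue line.
        ≈⟨ solve 16 (λ d A B uu ut tt Aw Bw uuw utw ttw At Bt uut utt ttt →
             A :* F A B uu ut tt Aw Bw uuw utw ttw :- d :* A :* F A B uu ut tt At Bt uut utt ttt
             := A :* F A B uu ut tt (Aw :- d :* At) (Bw :- d :* Bt) (uuw :- d :* uut) (utw :- d :* utt) (ttw :- d :* ttt))
             refl _ _ _ _ _ _ _ _ _ _ _ _ _ _ _ _ ⟩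
      X A * form′ (X A) (X B) (X UU) (X UT) (X TT) (X′ A) (X′ B) (X′ UU) (X′ UT) (X′ TT)
        ≈⟨ *-congˡ (derivative-of-zero dΦ (Φ-blue blue) w) ⟩
      X A * 0#
        ≈⟨ zeroʳ _ ⟩
      0# ∎
      where
      X X′ : Poly → Carrier
      X  g = onBlue j g w
      X′ g = onBlue j (∂W g) w - d j * onBlue j (∂T g) w
      F : ∀ {N} → (A B uu ut tt A′ B′ uu′ ut′ tt′ : Polynomial N) → Polynomial N
      F A B uu ut tt A′ B′ uu′ ut′ tt′ =
        ((((A′ :* A :+ A :* A′) :* uu :+ A :* A :* uu′) :- ((A′ :* B :+ A :* B′) :* ut :+ A :* B :* ut′))
          :- ((A′ :* B :+ A :* B′) :* ut :+ A :* B :* ut′)) :+ ((B′ :* B :+ B :* B′) :* tt :+ B :* B :* tt′)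
      dΦ : Derivative (λ w → Φ (a j - d j * w) (- b j) w) _
      dΦ = derivative-+ (derivative-+ (derivative-+ (derivative-* (derivative-* dA dA) dUU)
             (derivative-neg (derivative-* (derivative-* dA dB) dUT))) (derivative-neg (derivative-* (derivative-* dA dB) dUT)))
             (derivative-* (derivative-* dB dB) dTT)
        where
        dA  = onBlue-derivative j A
        dB  = onBlue-derivative j B
        dUU = onBlue-derivative j UU
        dUT = onBlue-derivative j UT
        dTT = onBlue-derivative j TT

    Ψ-red : ∀ {i} → Red i → ∀ u → Ψ (h i * u - y i) u (z i) ≈ 0#
    Ψ-red {i} red = red-zero red
      (degree-+ (degree-* (δ {A} sA) (form′-degree (δ {A} sA) (δ {B} sB) (δ {UU} sUU) (δ {UT} sUT) (δ {TT} sTT)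
                   (δ {∂W A} (small-∂W {A} sA)) (δ {∂W B} (small-∂W {B} sB)) (δ {∂W UU} (small-∂W {UU} sUU))
                   (δ {∂W UT} (small-∂W {UT} sUT)) (δ {∂W TT} (small-∂W {TT} sTT))))
                (degree-neg (degree-* (δ {C} sC) (form′-degree (δ {A} sA) (δ {B} sB) (δ {UU} sUU) (δ {UT} sUT) (δ {TT} sTT)
                   (δ {∂T A} (small-∂T {A} sA)) (δ {∂T B} (small-∂T {B} sB)) (δ {∂T UU} (small-∂T {UU} sUU))
                   (δ {∂T UT} (small-∂T {UT} sUT)) (δ {∂T TT} (small-∂T {TT} sTT))))))
      (ℕₚ.≤-reflexive (≡.cong (σ ℕ.+_) (ℕₚ.+-assoc σ σ σ)))
      (λ blue ij → let χ = crossing ij in trans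
        (+-cong (*-cong (χ A) (form′-cong (χ A) (χ B) (χ UU) (χ UT) (χ TT) (χ (∂W A)) (χ (∂W B)) (χ (∂W UU)) (χ (∂W UT)) (χ (∂W TT))))
          (-‿cong (*-cong (χ C) (form′-cong (χ A) (χ B) (χ UU) (χ UT) (χ TT) (χ (∂T A)) (χ (∂T B)) (χ (∂T UU)) (χ (∂T UT)) (χ (∂T TT))))))
        (Ψ-blue blue _))
      where
      δ : ∀ {g} → size g ℕ.≤ σ → Degree≤ σ (onRed i g)
      δ {g} sg = redDegree i {g} sg degree-id

    -- The base point `u₀` moves to parameter 0, where `ode-unique` takes its initial value.
    module AlongRed {i : Fin m} (red : Red i) (u₀ : Carrier) where
      U : Carrier → Carrier
      U v = u₀ + v

      U-degree : Degree≤ 1 U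
      U-degree = degree-+ (degree-const u₀) degree-id

      U-derivative : Derivative U (λ _ → 1#)
      U-derivative = derivative-cong (λ _ → refl) (λ _ → +-identityˡ 1#) (derivative-+ (derivative-const u₀) derivative-id)

      at : Poly → Carrier → Carrier
      at g v = onRed i g (U v)

      -- Third derivatives are written as `∂T` or `∂W` of a second derivative, the shape in which
      -- they occur in `Ψ`.
      α γ α′ γ′ α″ γ″ : Carrier → Carrier
      α  = at A
      γ  = at C
      α′ v = at UT v + h i * at TT v
      γ′ v = at (∂W B) v + h i * at (∂W A) v
      α″ v = (at (∂T UU) v + (h i * at (∂T UT) v + h i * at (∂T UT) v)) + h i * (h i * at (∂T TT) v)
      γ″ v = (at (∂W UU) v + (h i * at (∂W UT) v + h i * at (∂W UT) v)) + h i * (h i * at (∂W TT) v)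

      at-≃ : ∀ {g g′} → g ≃ g′ → ∀ v → at g v ≈ at g′ v
      at-≃ p v = ≃-⟦⟧ p _ _ _

      dα : Derivative α α′
      dα = onRed-derivative i A U-derivative

      dγ : Derivative γ γ′
      dγ = derivative-cong (λ _ → refl) (λ v → +-cong (at-≃ (∂U∂W≃ f) v) (*-congˡ (at-≃ (∂T∂W≃ f) v)))
        (onRed-derivative i C U-derivative)

      regroup : ∀ h x y z → (x + h * y) + h * (y + h * z) ≈ (x + (h * y + h * y)) + h * (h * z)
      regroup = solve 4 (λ h x y z → (x :+ h :* y) :+ h :* (y :+ h :* z) := (x :+ (h :* y :+ h :* y)) :+ h :* (h :* z)) refl

      dα′ : Derivative α′ α″
      dα′ = derivative-cong (λ _ → refl)
        (λ v → trans (+-cong (+-congʳ (at-≃ (≃-trans (∂U-cong (∂U∂T≃ f)) (∂U∂T≃ B)) v))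
                             (*-congˡ (+-congʳ (at-≃ (∂U∂T≃ A) v)))) (regroup _ _ _ _))
        (derivative-+ (onRed-derivative i UT U-derivative) (derivative-scale (h i) (onRed-derivative i TT U-derivative)))

      dγ′ : Derivative γ′ γ″
      dγ′ = derivative-cong (λ _ → refl)
        (λ v → trans (+-cong (+-cong (at-≃ (∂U∂W≃ B) v) (*-congˡ (at-≃ (≃-trans (∂T∂W≃ B) (∂W-cong (∂T∂U≃ f))) v)))
                             (*-congˡ (+-cong (at-≃ (∂U∂W≃ A) v) (*-congˡ (at-≃ (∂T∂W≃ A) v))))) (regroup _ _ _ _))
        (derivative-+ (onRed-derivative i (∂W B) U-derivative) (derivative-scale (h i) (onRed-derivative i (∂W A) U-derivative)))

      -- Along a red line Ψ = A (A G′ - 2 A′ G) where G = A C′ - C A′, i.e. A⁴ (C / A)″.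
      second-order : ∀ v → α v * (α v * (α v * γ″ v - γ v * α″ v) - (α′ v + α′ v) * (α v * γ′ v - γ v * α′ v)) ≈ 0#
      second-order v = begin
        α v * (α v * (α v * γ″ v - γ v * α″ v) - (α′ v + α′ v) * (α v * γ′ v - γ v * α′ v))
          ≈⟨ solve 13 (λ A C h tt ut tw uw uut utt ttt uuw utw ttw →
             let B = :- (h :* A)
                 uu = :- ((h :* ut :+ h :* ut) :+ h :* (h :* tt))
                 a′ = ut :+ h :* tt
                 c′ = uw :+ h :* tw
                 a″ = (uut :+ (h :* utt :+ h :* utt)) :+ h :* (h :* ttt)
                 c″ = (uuw :+ (h :* utw :+ h :* utw)) :+ h :* (h :* ttw)
             in A :* (A :* (A :* c″ :- C :* a″) :- (a′ :+ a′) :* (A :* c′ :- C :* a′))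
             := A :* (((((tw :* A :+ A :* tw) :* uu :+ A :* A :* uuw) :- ((tw :* B :+ A :* uw) :* ut :+ A :* B :* utw))
                       :- ((tw :* B :+ A :* uw) :* ut :+ A :* B :* utw)) :+ ((uw :* B :+ B :* uw) :* tt :+ B :* B :* ttw))
             :- C :* (((((tt :* A :+ A :* tt) :* uu :+ A :* A :* uut) :- ((tt :* B :+ A :* ut) :* ut :+ A :* B :* utt))
                       :- ((tt :* B :+ A :* ut) :* ut :+ A :* B :* utt)) :+ ((ut :* B :+ B :* ut) :* tt :+ B :* B :* ttt)))
             refl _ _ _ _ _ _ _ _ _ _ _ _ _ ⟩
        α v * form′ (α v) (- (h i * α v)) UU′ (at UT v) (at TT v) (at (∂W A) v) (at (∂W B) v) (at (∂W UU) v) (at (∂W UT) v) (at (∂W TT) v)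
          - γ v * form′ (α v) (- (h i * α v)) UU′ (at UT v) (at TT v) (at TT v) (at UT v) (at (∂T UU) v) (at (∂T UT) v) (at (∂T TT) v)
          ≈⟨ +-cong (*-congˡ (form′-cong refl (red₁′ red _) (red₂ red _) refl refl refl refl refl refl refl))
               (-‿cong (*-congˡ (form′-cong refl (red₁′ red _) (red₂ red _) refl refl refl (at-≃ (∂T∂U≃ f) v) refl refl refl))) ⟨
        Ψ (h i * U v - y i) (U v) (z i)
          ≈⟨ Ψ-red red (U v) ⟩
        0# ∎
        where
        UU′ : Carrier
        UU′ = - ((h i * at UT v + h i * at UT v) + h i * (h i * at TT v))

      α-degree : Degree≤ σ α
      α-degree = redDegree i {A} sA U-degree
      γ-degree : Degree≤ σ γ
      γ-degree = redDegree i {C} sC U-degree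
      α′-degree : Degree≤ σ α′
      α′-degree = degree-+ (redDegree i {UT} sUT U-degree) (degree-scale (h i) (redDegree i {TT} sTT U-degree))
      γ′-degree : Degree≤ σ γ′
      γ′-degree = degree-+ (redDegree i {∂W B} (small-∂W {B} sB) U-degree)
                           (degree-scale (h i) (redDegree i {∂W A} (small-∂W {A} sA) U-degree))

      G G′ : Carrier → Carrier
      G  v = α v * γ′ v - γ v * α′ v
      G′ v = (α′ v * γ′ v + α v * γ″ v) - (γ′ v * α′ v + γ v * α″ v)

      G-degree : Degree≤ (σ ℕ.+ σ) G
      G-degree = degree-+ (degree-* α-degree γ′-degree) (degree-neg (degree-* γ-degree α′-degree))

      dG : Derivative G G′
      dG = derivative-+ (derivative-* dα dγ′) (derivative-neg (derivative-* dγ dα′))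

      α₀ γ₀ G₀ : Carrier
      α₀ = α 0#
      γ₀ = γ 0#
      G₀ = G 0#

      module _ (α₀≉0 : ¬ α₀ ≈ 0#) where
        -- G / A² is the derivative of C / A. By `second-order` its own derivative is zero, so it
        -- equals its value at 0; here denominators are cleared.
        wronskian : ∀ v → (α₀ * α₀) * G v - G₀ * (α v * α v) ≈ 0#
        wronskian = ode-unique
          (_ , degree-* α-degree α-degree) (_ , degree-* (degree-+ α′-degree α′-degree) α-degree)
          (λ p → α₀≉0 (integral p α₀≉0))
          (degree-+ (degree-scale _ G-degree) (degree-neg (degree-scale _ (degree-* α-degree α-degree))))
          (derivative-+ (derivative-scale _ dG) (derivative-neg (derivative-scale _ (derivative-* dα dα))))
          (λ j 1≤j j≤ → large-char j 1≤j (ℕₚ.m≤n⇒m≤1+n j≤))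
          (solve 2 (λ x g → (x :* x) :* g :- g :* (x :* x) := con (+ 0)) refl α₀ G₀)
          (λ v → trans
            (solve 8 (λ x g a c a′ c′ a″ c″ →
               (a :* a) :* ((x :* x) :* ((a′ :* c′ :+ a :* c″) :- (c′ :* a′ :+ c :* a″)) :- g :* (a′ :* a :+ a :* a′))
               := ((a′ :+ a′) :* a) :* ((x :* x) :* (a :* c′ :- c :* a′) :- g :* (a :* a))
                  :+ (x :* x) :* (a :* (a :* (a :* c″ :- c :* a″) :- (a′ :+ a′) :* (a :* c′ :- c :* a′))))
               refl _ _ _ _ _ _ _ _)
            (trans (+-congˡ (trans (*-congˡ (second-order v)) (zeroʳ _))) (+-identityʳ _)))

        -- `α₀ * α₀` times the affine function that C / A turns out to be.
        slope : Carrier → Carrier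
        slope v = G₀ * v + α₀ * γ₀

        -- By `wronskian` the derivative of C / A is the constant G₀ / α₀². Hence H = α₀² C -
        -- `slope` A satisfies A H′ = A′ H, and it vanishes at 0.
        proportional : ∀ v → (α₀ * α₀) * γ v - slope v * α v ≈ 0#
        proportional = ode-unique
          (_ , α-degree) (_ , α′-degree) α₀≉0
          (degree-+ (degree-weaken (ℕₚ.m≤n⇒m≤1+n (ℕₚ.m≤m+n σ σ)) (degree-scale _ γ-degree))
            (degree-weaken (s≤s (ℕₚ.m≤m+n σ σ)) (degree-neg (degree-* slope-degree α-degree))))
          (derivative-+ (derivative-scale _ dγ) (derivative-neg (derivative-* slope-derivative dα)))
          (λ j 1≤j j≤ → large-char j 1≤j j≤)
          (solve 3 (λ x c g → (x :* x) :* c :- (g :* con (+ 0) :+ x :* c) :* x := con (+ 0)) refl α₀ γ₀ G₀)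
          (λ v → trans
            (solve 7 (λ x g L a c a′ c′ →
               a :* ((x :* x) :* c′ :- (g :* a :+ L :* a′))
               := a′ :* ((x :* x) :* c :- L :* a) :+ ((x :* x) :* (a :* c′ :- c :* a′) :- g :* (a :* a)))
               refl _ _ _ _ _ _ _)
            (trans (+-congˡ (wronskian v)) (+-identityʳ _)))
          where
          slope-degree : Degree≤ 1 slope
          slope-degree = degree-+ (degree-scale G₀ degree-id) (degree-const _)
          slope-derivative : Derivative slope (λ _ → G₀)
          slope-derivative = derivative-cong (λ _ → refl) (λ _ → trans (+-identityʳ _) (*-identityʳ _))
            (derivative-+ (derivative-scale G₀ derivative-id) (derivative-const _))

        -- At this crossing C / A equals `d j` by `blue₁`, while `proportional` makes it affine in
        -- `- b j`. A crossing with A = 0 would say nothing about `d j`.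
        on-pencil : ∀ {j} → Blue j → Adjacent i j → ¬ onRed i A (- b j) ≈ 0# →
          (α₀ * α₀) * d j + G₀ * b j ≈ α₀ * γ₀ - G₀ * u₀
        on-pencil {j} blue ij A≉0 = begin
          (α₀ * α₀) * d j + G₀ * b j
            ≈⟨ solve 5 (λ x d g b e → x :* d :+ g :* b := (x :* d :- (g :* (:- b :- e))) :- g :* e)
                 refl _ _ _ _ _ ⟩
          ((α₀ * α₀) * d j - G₀ * v) - G₀ * u₀
            ≈⟨ solve 4 (λ x y e c → (x :- y) :- e := (x :- (y :+ c)) :+ (c :- e)) refl _ _ _ _ ⟩
          ((α₀ * α₀) * d j - (G₀ * v + α₀ * γ₀)) + (α₀ * γ₀ - G₀ * u₀)
            ≈⟨ +-congʳ (integral (begin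
                 onRed i A (- b j) * ((α₀ * α₀) * d j - slope v)
                   ≈⟨ solve 4 (λ a x d s → a :* (x :* d :- s) := x :* (d :* a) :- s :* a) refl _ _ _ _ ⟩
                 (α₀ * α₀) * (d j * onRed i A (- b j)) - slope v * onRed i A (- b j)
                   ≈⟨ +-cong (*-congˡ C≈dA) (-‿cong (*-congˡ (onRed-cong i A base))) ⟨
                 (α₀ * α₀) * γ v - slope v * α v
                   ≈⟨ proportional v ⟩
                 0# ∎) A≉0) ⟩
          0# + (α₀ * γ₀ - G₀ * u₀)
            ≈⟨ +-identityˡ _ ⟩
          α₀ * γ₀ - G₀ * u₀ ∎
          where
          v : Carrier
          v = - b j - u₀
          base : U v ≈ - b j
          base = solve 2 (λ u b → u :+ (:- b :- u) := :- b) refl u₀ (b j)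
          C≈dA : γ v ≈ d j * onRed i A (- b j)
          C≈dA = trans (onRed-cong i C base) (trans (crossing ij C)
            (trans (blue₁ blue _) (*-congˡ (sym (crossing ij A)))))

    -- Either k + 2 crossings on the red line have A ≠ 0, and `on-pencil` contradicts `pencil`, or
    -- 4σ + 1 of them have A = 0, more than the degree of A allows.
    A-vanishes : VanishesOnRed A
    A-vanishes {i} red u = stable λ A≉0 →
      split-many {R = λ j → Blue j × Adjacent i j} {P = λ j → ¬ onRed i A (- b j) ≈ 0#} {Q = λ j → onRed i A (- b j) ≈ 0#}
        (suc (suc k)) _ (red-degree red) (λ j ¬pq → ¬pq (inj₁ λ q → ¬pq (inj₂ q)))
        λ { (inj₁ (g , inj , p)) →
              -- Taking a crossing with A ≠ 0 as base point makes the coefficient `α₀ * α₀` of the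
              -- pencil nonzero.
              let open AlongRed red (- b (g zero))
                  α₀≉0 : ¬ α₀ ≈ 0#
                  α₀≉0 e = proj₂ (p zero) (trans (onRed-cong i A (sym (+-identityʳ _))) e)
              in pencil red (α₀ * α₀) G₀ (α₀ * γ₀ - G₀ * - b (g zero)) (λ e → α₀≉0 (integral e α₀≉0))
                   (g , inj , λ x → proj₂ (proj₁ (p x))
                       , on-pencil α₀≉0 (proj₁ (proj₁ (p x))) (proj₂ (proj₁ (p x))) (proj₂ (p x)))
          ; (inj₂ many) →
              let (g , inj , q) = many-weaken {P = λ j → (Blue j × Adjacent i j) × onRed i A (- b j) ≈ 0#}
                                    (s≤s (ℕₚ.≤-trans sA (ℕₚ.m≤m+n σ _))) many
              in A≉0 (roots⇒zero (onRed-degree i A degree-id) (λ x → - b (g x))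
                   (λ x x′ x≢x′ e → b-distinct _ _ (λ e → x≢x′ (inj e)) (-‿injective e))
                   (λ x → proj₂ (q x)) u) }
  
    B-vanishes : VanishesOnRed B
    B-vanishes red u = trans (red₁′ red u)
      (trans (-‿cong (trans (*-congˡ (A-vanishes red u)) (zeroʳ _))) (solve 0 (:- con (+ 0) := con (+ 0)) refl))

    C-vanishes : VanishesOnRed C
    C-vanishes {i} red = red-zero red (onRed-degree i C degree-id) (ℕₚ.≤-trans sC (ℕₚ.m≤m+n σ _))
      (λ blue ij → trans (crossing ij C) (trans (blue₁ blue _)
        (trans (*-congˡ (trans (sym (crossing ij A)) (A-vanishes red _))) (zeroʳ _))))

  -- All partial derivatives vanish on the lines again, so by induction on the size their
  -- coefficients are zero. Exponents are invertible in the sense of `large-char`, which leaves only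
  -- the constant term, and that is the value at a point of a red line.
  coefficients-zero : ∃ Red → ∀ fuel n₁ n₂ n₃ f → n₁ ℕ.+ (n₂ ℕ.+ (n₃ ℕ.+ 0)) ℕ.≤ fuel →
    n₁ ℕ.+ (n₂ ℕ.+ (n₃ ℕ.+ 0)) ℕ.≤ σ →
    VanishesOnRed (poly n₁ n₂ n₃ f) → VanishesOnBlue (poly n₁ n₂ n₃ f) →
    ∀ i j k → i ℕ.< n₁ → j ℕ.< n₂ → k ℕ.< n₃ → f i j k ≈ 0#
  coefficients-zero some zero (suc n₁) n₂ n₃ f () small vr vb i j k i< j< k<
  coefficients-zero some (suc fuel) n₁@(suc p₁) n₂@(suc p₂) n₃@(suc p₃) f (s≤s le) small vr vb = go
    where
    F : Poly
    F = poly n₁ n₂ n₃ f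

    tail-T : ∀ i j k → suc i ℕ.< n₁ → j ℕ.< n₂ → k ℕ.< n₃ → f (suc i) j k ≈ 0#
    tail-T i j k (s≤s i<) j< k< = integral
      (coefficients-zero some fuel p₁ n₂ n₃ (Poly.coeff (∂T F)) le (ℕₚ.<⇒≤ small) (A-vanishes F small vr vb)
        (red⇒blue {∂T F} (ℕₚ.<⇒≤ small) (A-vanishes F small vr vb)) i j k i< j< k<)
      (large-char (suc i) (s≤s z≤n) (ℕₚ.≤-trans (ℕₚ.≤-trans i< (ℕₚ.m≤m+n p₁ _))
        (ℕₚ.≤-trans (ℕₚ.<⇒≤ small) (ℕₚ.m≤n⇒m≤1+n (ℕₚ.m≤m+n σ σ)))))

    tail-U : ∀ i j k → i ℕ.< n₁ → suc j ℕ.< n₂ → k ℕ.< n₃ → f i (suc j) k ≈ 0#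
    tail-U i j k i< (s≤s j<) k< = integral
      (coefficients-zero some fuel n₁ p₂ n₃ (Poly.coeff (∂U F)) (ℕₚ.≤-trans (ℕₚ.≤-reflexive (≡.sym (ℕₚ.+-suc p₁ _))) le)
        size-U (B-vanishes F small vr vb)
        (red⇒blue {∂U F} size-U (B-vanishes F small vr vb)) i j k i< j< k<)
      (large-char (suc j) (s≤s z≤n) (ℕₚ.≤-trans (ℕₚ.≤-trans (ℕₚ.≤-trans j< (ℕₚ.m≤m+n p₂ _)) (ℕₚ.m≤n+m _ n₁))
        (ℕₚ.≤-trans size-U (ℕₚ.m≤n⇒m≤1+n (ℕₚ.m≤m+n σ σ)))))
      where
      size-U : size (∂U F) ℕ.≤ σ
      size-U = ℕₚ.≤-trans (size-∂U F) small

    tail-W : ∀ i j k → i ℕ.< n₁ → j ℕ.< n₂ → suc k ℕ.< n₃ → f i j (suc k) ≈ 0#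
    tail-W i j k i< j< (s≤s k<) = integral
      (coefficients-zero some fuel n₁ n₂ p₃ (Poly.coeff (∂W F))
        (ℕₚ.≤-trans (ℕₚ.≤-reflexive (≡.sym (≡.trans (≡.cong (p₁ ℕ.+_) (ℕₚ.+-suc n₂ (p₃ ℕ.+ 0))) (ℕₚ.+-suc p₁ _)))) le)
        size-W (C-vanishes F small vr vb)
        (red⇒blue {∂W F} size-W (C-vanishes F small vr vb)) i j k i< j< k<)
      (large-char (suc k) (s≤s z≤n) (ℕₚ.≤-trans (ℕₚ.≤-trans (ℕₚ.≤-trans (ℕₚ.≤-trans k< (ℕₚ.m≤m+n p₃ 0)) (ℕₚ.m≤n+m _ n₂)) (ℕₚ.m≤n+m _ n₁))
        (ℕₚ.≤-trans size-W (ℕₚ.m≤n⇒m≤1+n (ℕₚ.m≤m+n σ σ)))))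
      where
      size-W : size (∂W F) ℕ.≤ σ
      size-W = ℕₚ.≤-trans (size-∂W F) small

    constant-term : f 0 0 0 ≈ 0#
    constant-term = let (i , red) = some ; t = h i * 0# - y i in begin
      f 0 0 0
        ≈⟨ horner-head p₃ {f 0 0} (z i) (λ c c< → tail-W 0 0 c (s≤s z≤n) (s≤s z≤n) c<) ⟨
      horner n₃ (f 0 0) (z i)
        ≈⟨ horner-head p₂ {λ b → horner n₃ (f 0 b) (z i)} 0#
             (λ b b< → horner-zero n₃ {f 0 (suc b)} (z i) (λ c c< → tail-U 0 b c (s≤s z≤n) b< c<)) ⟨
      horner n₂ (λ b → horner n₃ (f 0 b) (z i)) 0#
        ≈⟨ horner-head p₁ {λ a → horner n₂ (λ b → horner n₃ (f a b) (z i)) 0#} t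
             (λ a a< → horner-zero n₂ {λ b → horner n₃ (f (suc a) b) (z i)} 0#
                (λ b b< → horner-zero n₃ {f (suc a) b} (z i) (λ c c< → tail-T a b c a< b< c<))) ⟨
      ⟦ F ⟧ t 0# (z i)
        ≈⟨ vr red 0# ⟩
      0# ∎

    go : ∀ i j k → i ℕ.< n₁ → j ℕ.< n₂ → k ℕ.< n₃ → f i j k ≈ 0#
    go (suc i) j       k       i< j< k< = tail-T i j k i< j< k<
    go zero    (suc j) k       i< j< k< = tail-U 0 j k i< j< k<
    go zero    zero    (suc k) i< j< k< = tail-W 0 0 k i< j< k<
    go zero    zero    zero    i< j< k< = constant-term

  -- The polynomial is made to vanish on all `n` lines of the blue family, whether or not they
  -- satisfy `Blue`, so the count involves `n` alone.
  impossible : ∃ Red → ∀ e → e ℕ.+ (e ℕ.+ (e ℕ.+ 0)) ℕ.≤ σ → n ℕ.* suc (e ℕ.+ (e ℕ.+ (e ℕ.+ 0))) ℕ.< e ℕ.* (e ℕ.* e) → ⊥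
  impossible some e small few = vanishing-exists e
    (λ j w → a j - d j * w) (λ j _ → - b j) (λ _ w → w)
    (λ j → degree-+ (degree-const (a j)) (degree-neg (degree-scale (d j) degree-id)))
    (λ j → degree-const (- b j)) (λ _ → degree-id) few
    λ (f , vanishes , f≉0) → f≉0 (coefficients-zero some _ e e e f ℕₚ.≤-refl small
      (blue⇒red {poly e e e f} small (λ {j} _ → vanishes j)) (λ {j} _ → vanishes j))

-- Passing to a subgraph in which every vertex has large degree.

length-partition : ∀ {a p} {A : Set a} {P : A → Set p} (P? : Decidable P) xs →
  length (filter P? xs) ℕ.+ length (filter (¬? ∘ P?) xs) ≡ length xs
length-partition P? []       = ≡.refl
length-partition P? (x ∷ xs) with P? x
... | yes _ = ≡.cong suc (length-partition P? xs)
... | no  _ = ≡.trans (ℕₚ.+-suc _ _) (≡.cong suc (length-partition P? xs))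

lookup-injective : ∀ {a} {A : Set a} {xs : List A} → Unique xs → ∀ i j → lookup xs i ≡ lookup xs j → i ≡ j
lookup-injective (_ AllPairs.∷ _) zero    zero    e = ≡.refl
lookup-injective (x∉ AllPairs.∷ _) zero    (suc j) e = ⊥-elim (All.lookup x∉ (∈-lookup j) e)
lookup-injective (x∉ AllPairs.∷ _) (suc i) zero    e = ⊥-elim (All.lookup x∉ (∈-lookup i) (≡.sym e))
lookup-injective (_ AllPairs.∷ u) (suc i) (suc j) e = ≡.cong suc (lookup-injective u i j e)

module Pruning {m n : ℕ} where
  open import Data.Nat using (_≤_; _<_; _+_; _*_)

  Edge : Set
  Edge = Fin m × Fin n

  redDegree : Fin m → List Edge → ℕ
  redDegree i es = length (filter (λ e → proj₁ e Fin.≟ i) es)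

  blueDegree : Fin n → List Edge → ℕ
  blueDegree j es = length (filter (λ e → proj₂ e Fin.≟ j) es)

  record Core {q} (Q : Edge → Set q) (Kr Kb : ℕ) : Set q where
    field
      reds      : List (Fin m)
      blues     : List (Fin n)
      edges     : List Edge
      unique    : Unique edges
      endpoints : All (λ e → proj₁ e ∈ reds × proj₂ e ∈ blues) edges
      holds     : All Q edges
      reds-rich  : ∀ {i} → i ∈ reds → Kr ≤ redDegree i edges
      blues-rich : ∀ {j} → j ∈ blues → Kb ≤ blueDegree j edges
      nonempty  : 0 < length edges

  -- Deleting a vertex of degree below its threshold keeps the edge count above the total threshold.
  prune : ∀ {q} {Q : Edge → Set q} Kr Kb fuel reds blues edges → length reds + length blues ≤ fuel →
    Unique edges → All (λ e → proj₁ e ∈ reds × proj₂ e ∈ blues) edges → All Q edges →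
    length reds * Kr + length blues * Kb < length edges → Core Q Kr Kb
  prune {Q = Q} Kr Kb fuel reds blues edges fuel≥ unique ends holds dense
    with All.all? (λ i → Kr ℕ.≤? redDegree i edges) reds | All.all? (λ j → Kb ℕ.≤? blueDegree j edges) blues
  ... | yes rs | yes bs = record
    { reds = reds ; blues = blues ; edges = edges ; unique = unique ; endpoints = ends ; holds = holds
    ; reds-rich = All.lookup rs ; blues-rich = All.lookup bs
    ; nonempty = ℕₚ.≤-trans (s≤s z≤n) dense }
  ... | no ¬rs | _ with find (Allₚ.¬All⇒Any¬ (λ i → Kr ℕ.≤? redDegree i edges) reds ¬rs)
  ...   | i , i∈ , poor = step fuel fuel≥
    where
    reds′ : List (Fin m)
    reds′ = filter (λ i′ → ¬? (i′ Fin.≟ i)) reds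
    edges′ : List Edge
    edges′ = filter (λ e → ¬? (proj₁ e Fin.≟ i)) edges
    fewer : length reds′ < length reds
    fewer = filter-notAll (λ i′ → ¬? (i′ Fin.≟ i)) reds (lose i∈ (λ ¬e → ¬e ≡.refl))
    dense′ : length reds′ * Kr + length blues * Kb < length edges′
    dense′ = ℕₚ.+-cancelˡ-< (redDegree i edges) _ _ (begin-strict
      redDegree i edges + (length reds′ * Kr + length blues * Kb)   ≤⟨ ℕₚ.+-monoˡ-≤ _ (ℕₚ.≰⇒≥ poor) ⟩
      Kr + (length reds′ * Kr + length blues * Kb)                  ≡⟨ ℕₚ.+-assoc Kr _ _ ⟨
      suc (length reds′) * Kr + length blues * Kb                   ≤⟨ ℕₚ.+-monoˡ-≤ _ (ℕₚ.*-monoˡ-≤ Kr fewer) ⟩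
      length reds * Kr + length blues * Kb                          <⟨ dense ⟩
      length edges                                                  ≡⟨ length-partition (λ e → proj₁ e Fin.≟ i) edges ⟨
      redDegree i edges + length edges′                             ∎)
      where open ℕₚ.≤-Reasoning
    step : ∀ fuel → length reds + length blues ≤ fuel → Core Q Kr Kb
    step zero       le = ⊥-elim (ℕₚ.n≮0 (ℕₚ.≤-trans fewer (ℕₚ.≤-trans (ℕₚ.m≤m+n _ _) le)))
    step (suc fuel) le = prune Kr Kb fuel reds′ blues edges′
      (ℕₚ.≤-pred (ℕₚ.≤-trans (ℕₚ.+-monoˡ-≤ _ fewer) le))
      (Uniqueₚ.filter⁺ _ unique)
      (All.tabulate λ e∈ → let (e∈′ , ≢i) = ∈-filter⁻ (λ e → ¬? (proj₁ e Fin.≟ i)) e∈ ; (r , b) = All.lookup ends e∈′ in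
        ∈-filter⁺ (λ i′ → ¬? (i′ Fin.≟ i)) r ≢i , b)
      (Allₚ.filter⁺ _ holds) dense′
  prune {Q = Q} Kr Kb fuel reds blues edges fuel≥ unique ends holds dense
    | yes _ | no ¬bs with find (Allₚ.¬All⇒Any¬ (λ j → Kb ℕ.≤? blueDegree j edges) blues ¬bs)
  ...   | j , j∈ , poor = step fuel fuel≥
    where
    blues′ : List (Fin n)
    blues′ = filter (λ j′ → ¬? (j′ Fin.≟ j)) blues
    edges′ : List Edge
    edges′ = filter (λ e → ¬? (proj₂ e Fin.≟ j)) edges
    fewer : length blues′ < length blues
    fewer = filter-notAll (λ j′ → ¬? (j′ Fin.≟ j)) blues (lose j∈ (λ ¬e → ¬e ≡.refl))
    dense′ : length reds * Kr + length blues′ * Kb < length edges′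
    dense′ = ℕₚ.+-cancelˡ-< (blueDegree j edges) _ _ (begin-strict
      blueDegree j edges + (length reds * Kr + length blues′ * Kb)  ≤⟨ ℕₚ.+-monoˡ-≤ _ (ℕₚ.≰⇒≥ poor) ⟩
      Kb + (length reds * Kr + length blues′ * Kb)                  ≡⟨ ℕₚ.+-assoc Kb _ _ ⟨
      Kb + length reds * Kr + length blues′ * Kb                    ≡⟨ ≡.cong (_+ length blues′ * Kb) (ℕₚ.+-comm Kb _) ⟩
      length reds * Kr + Kb + length blues′ * Kb                    ≡⟨ ℕₚ.+-assoc (length reds * Kr) Kb _ ⟩
      length reds * Kr + suc (length blues′) * Kb                   ≤⟨ ℕₚ.+-monoʳ-≤ _ (ℕₚ.*-monoˡ-≤ Kb fewer) ⟩
      length reds * Kr + length blues * Kb                          <⟨ dense ⟩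
      length edges                                                  ≡⟨ length-partition (λ e → proj₂ e Fin.≟ j) edges ⟨
      blueDegree j edges + length edges′                            ∎)
      where open ℕₚ.≤-Reasoning
    step : ∀ fuel → length reds + length blues ≤ fuel → Core Q Kr Kb
    step zero       le = ⊥-elim (ℕₚ.n≮0 (ℕₚ.≤-trans fewer (ℕₚ.≤-trans (ℕₚ.m≤n+m _ _) le)))
    step (suc fuel) le = prune Kr Kb fuel reds blues′ edges′
      (ℕₚ.≤-pred (ℕₚ.≤-trans (ℕₚ.≤-reflexive (≡.sym (ℕₚ.+-suc _ _))) (ℕₚ.≤-trans (ℕₚ.+-monoʳ-≤ (length reds) fewer) le)))
      (Uniqueₚ.filter⁺ _ unique)
      (All.tabulate λ e∈ → let (e∈′ , ≢j) = ∈-filter⁻ (λ e → ¬? (proj₂ e Fin.≟ j)) e∈ ; (r , b) = All.lookup ends e∈′ in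
        r , ∈-filter⁺ (λ j′ → ¬? (j′ Fin.≟ j)) b ≢j)
      (Allₚ.filter⁺ _ holds) dense′

  red-neighbours : ∀ {K i edges} → Unique edges → K ≤ redDegree i edges → K Many (λ j → (i , j) ∈ edges)
  red-neighbours {K} {i} {edges} unique rich = proj₂ ∘ edge , inj , mem
    where
    P? = λ (e : Edge) → proj₁ e Fin.≟ i
    edge : Fin K → Edge
    edge x = lookup (filter P? edges) (Fin.inject≤ x rich)
    good : ∀ x → edge x ∈ edges × proj₁ (edge x) ≡ i
    good x = ∈-filter⁻ P? (∈-lookup (Fin.inject≤ x rich))
    inj : ∀ {x y} → proj₂ (edge x) ≡ proj₂ (edge y) → x ≡ y
    inj {x} {y} e = Finₚ.inject≤-injective rich rich x y (lookup-injective (Uniqueₚ.filter⁺ P? unique) _ _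
      (≡.cong₂ _,_ (≡.trans (proj₂ (good x)) (≡.sym (proj₂ (good y)))) e))
    mem : ∀ x → (i , proj₂ (edge x)) ∈ edges
    mem x = ≡.subst (λ i → (i , proj₂ (edge x)) ∈ edges) (proj₂ (good x)) (proj₁ (good x))

  blue-neighbours : ∀ {K j edges} → Unique edges → K ≤ blueDegree j edges → K Many (λ i → (i , j) ∈ edges)
  blue-neighbours {K} {j} {edges} unique rich = proj₁ ∘ edge , inj , mem
    where
    P? = λ (e : Edge) → proj₂ e Fin.≟ j
    edge : Fin K → Edge
    edge x = lookup (filter P? edges) (Fin.inject≤ x rich)
    good : ∀ x → edge x ∈ edges × proj₂ (edge x) ≡ j
    good x = ∈-filter⁻ P? (∈-lookup (Fin.inject≤ x rich))
    inj : ∀ {x y} → proj₁ (edge x) ≡ proj₁ (edge y) → x ≡ y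
    inj {x} {y} e = Finₚ.inject≤-injective rich rich x y (lookup-injective (Uniqueₚ.filter⁺ P? unique) _ _
      (≡.cong₂ _,_ e (≡.trans (proj₂ (good x)) (≡.sym (proj₂ (good y))))))
    mem : ∀ x → (proj₁ (edge x) , j) ∈ edges
    mem x = ≡.subst (λ j → (proj₁ (edge x) , j) ∈ edges) (proj₂ (good x)) (proj₁ (good x))

-- Points, planes and lines over the field.

module ProjectiveSpace {c ℓ : Level} (F : Field c ℓ) where
  open Geometry F hiding (u; v)
  open Field F hiding (zero)
  open IntegerSolver commutativeRing
  open SetoidReasoning setoid
  open RingProperties ring using (-‿involutive; -0#≈0#)
  open Stabilise commutativeRing using (stabilised)

  cancelˡ : ∀ {x y} → ¬ x ≈ 0# → x * y ≈ 0# → y ≈ 0#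
  cancelˡ {x} {y} x≉0 xy≈0 = let (x⁻¹ , xx⁻¹≈1) = inverse x x≉0 in begin
    y               ≈⟨ *-identityˡ y ⟨
    1# * y          ≈⟨ *-congʳ xx⁻¹≈1 ⟨
    x * x⁻¹ * y     ≈⟨ solve 3 (λ x y z → x :* z :* y := z :* (x :* y)) refl x y x⁻¹ ⟩
    x⁻¹ * (x * y)   ≈⟨ *-congˡ xy≈0 ⟩
    x⁻¹ * 0#        ≈⟨ zeroʳ _ ⟩
    0#              ∎

  fieldDomain : StableDomain c ℓ
  fieldDomain = record
    { commutativeRing = stabilised
    ; stable   = λ ¬¬p k → ¬¬p λ p → p k
    ; integral = λ xy≈0 x≉0 y≉0 → xy≈0 λ xy≈0 → y≉0 (cancelˡ (λ x≈0 → x≉0 λ k → k x≈0) xy≈0)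
    }

  minor : V4 → V4 → Fin 4 → Fin 4 → Carrier
  minor v w i j = v i * w j - v j * w i

  MinorsVanish : V4 → V4 → Set ℓ
  MinorsVanish v w = ∀ i j → ¬ ¬ minor v w i j ≈ 0#

  nonzero-entry : ∀ {v} → NonZero v → ¬ ¬ ∃ λ i → ¬ v i ≈ 0#
  nonzero-entry v≉0 none = ¬¬-all (λ i vᵢ≉0 → none (i , vᵢ≉0)) v≉0

  -- If `w l` is nonzero and all minors vanish, then v = (v l / w l) w, so the representatives are
  -- proportional.
  distinct⇒minor : ∀ {m} {X : Fin m → V4} → IsProjSet X → ∀ i j → i ≢ j → ¬ MinorsVanish (X i) (X j)
  distinct⇒minor {X = X} (nonzero , distinct) i j i≢j vanish =
    nonzero-entry (nonzero j) λ (l , w≉0) → ¬¬-all (λ k → vanish k l) λ vanish →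
    let (w⁻¹ , ww⁻¹≈1) = inverse (w l) w≉0 in
    i≢j (distinct i j (v l * w⁻¹ , λ k → begin
      v k                                       ≈⟨ *-identityʳ _ ⟨
      v k * 1#                                  ≈⟨ *-congˡ ww⁻¹≈1 ⟨
      v k * (w l * w⁻¹)
        ≈⟨ solve 5 (λ a b c d e → a :* (b :* e) := (a :* b :- c :* d) :* e :+ c :* e :* d) refl _ _ _ _ _ ⟩
      (v k * w l - v l * w k) * w⁻¹ + v l * w⁻¹ * w k
        ≈⟨ +-congʳ (trans (*-congʳ (vanish k)) (zeroˡ _)) ⟩
      0# + v l * w⁻¹ * w k                      ≈⟨ +-identityˡ _ ⟩
      v l * w⁻¹ * w k                           ∎))
    where
    v w : V4
    v = X i
    w = X j

  -- The rows of the dual Plücker matrix span the line in which the planes a and b meet.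
  dualPlücker : V4 → V4 → Fin 4 → V4
  dualPlücker a b = matrix
    where
    p : Fin 4 → Fin 4 → Carrier
    p = minor a b
    matrix : Fin 4 → V4
    matrix 0F 0F = 0#
    matrix 0F 1F = p 2F 3F
    matrix 0F 2F = - p 1F 3F
    matrix 0F 3F = p 1F 2F
    matrix 1F 0F = - p 2F 3F
    matrix 1F 1F = 0#
    matrix 1F 2F = p 0F 3F
    matrix 1F 3F = - p 0F 2F
    matrix 2F 0F = p 1F 3F
    matrix 2F 1F = - p 0F 3F
    matrix 2F 2F = 0#
    matrix 2F 3F = p 0F 1F
    matrix 3F 0F = - p 1F 2F
    matrix 3F 1F = p 0F 2F
    matrix 3F 2F = - p 0F 1F
    matrix 3F 3F = 0#

  dualPlücker-meet : ∀ a b k → dot a (dualPlücker a b k) ≈ 0# × dot b (dualPlücker a b k) ≈ 0#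
  dualPlücker-meet a b = rows
    where
    M : ∀ {N} → (x y x′ y′ : Polynomial N) → Polynomial N
    M x y x′ y′ = x :* y′ :- x′ :* y
    D : ∀ {N} → (x₀ x₁ x₂ x₃ y₀ y₁ y₂ y₃ : Polynomial N) → Polynomial N
    D x₀ x₁ x₂ x₃ y₀ y₁ y₂ y₃ = x₀ :* y₀ :+ (x₁ :* y₁ :+ (x₂ :* y₂ :+ x₃ :* y₃))
    O : ∀ {N} → Polynomial N
    O = con (+ 0)
    rows : ∀ k → dot a (dualPlücker a b k) ≈ 0# × dot b (dualPlücker a b k) ≈ 0#
    rows 0F =
        solve 8 (λ a₀ a₁ a₂ a₃ b₀ b₁ b₂ b₃ → D a₀ a₁ a₂ a₃ O (M a₂ b₂ a₃ b₃) (:- M a₁ b₁ a₃ b₃) (M a₁ b₁ a₂ b₂) := O)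
          refl (a 0F) (a 1F) (a 2F) (a 3F) (b 0F) (b 1F) (b 2F) (b 3F)
      , solve 8 (λ a₀ a₁ a₂ a₃ b₀ b₁ b₂ b₃ → D b₀ b₁ b₂ b₃ O (M a₂ b₂ a₃ b₃) (:- M a₁ b₁ a₃ b₃) (M a₁ b₁ a₂ b₂) := O)
          refl (a 0F) (a 1F) (a 2F) (a 3F) (b 0F) (b 1F) (b 2F) (b 3F)
    rows 1F =
        solve 8 (λ a₀ a₁ a₂ a₃ b₀ b₁ b₂ b₃ → D a₀ a₁ a₂ a₃ (:- M a₂ b₂ a₃ b₃) O (M a₀ b₀ a₃ b₃) (:- M a₀ b₀ a₂ b₂) := O)
          refl (a 0F) (a 1F) (a 2F) (a 3F) (b 0F) (b 1F) (b 2F) (b 3F)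
      , solve 8 (λ a₀ a₁ a₂ a₃ b₀ b₁ b₂ b₃ → D b₀ b₁ b₂ b₃ (:- M a₂ b₂ a₃ b₃) O (M a₀ b₀ a₃ b₃) (:- M a₀ b₀ a₂ b₂) := O)
          refl (a 0F) (a 1F) (a 2F) (a 3F) (b 0F) (b 1F) (b 2F) (b 3F)
    rows 2F =
        solve 8 (λ a₀ a₁ a₂ a₃ b₀ b₁ b₂ b₃ → D a₀ a₁ a₂ a₃ (M a₁ b₁ a₃ b₃) (:- M a₀ b₀ a₃ b₃) O (M a₀ b₀ a₁ b₁) := O)
          refl (a 0F) (a 1F) (a 2F) (a 3F) (b 0F) (b 1F) (b 2F) (b 3F)
      , solve 8 (λ a₀ a₁ a₂ a₃ b₀ b₁ b₂ b₃ → D b₀ b₁ b₂ b₃ (M a₁ b₁ a₃ b₃) (:- M a₀ b₀ a₃ b₃) O (M a₀ b₀ a₁ b₁) := O)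
          refl (a 0F) (a 1F) (a 2F) (a 3F) (b 0F) (b 1F) (b 2F) (b 3F)
    rows 3F =
        solve 8 (λ a₀ a₁ a₂ a₃ b₀ b₁ b₂ b₃ → D a₀ a₁ a₂ a₃ (:- M a₁ b₁ a₂ b₂) (M a₀ b₀ a₂ b₂) (:- M a₀ b₀ a₁ b₁) O := O)
          refl (a 0F) (a 1F) (a 2F) (a 3F) (b 0F) (b 1F) (b 2F) (b 3F)
      , solve 8 (λ a₀ a₁ a₂ a₃ b₀ b₁ b₂ b₃ → D b₀ b₁ b₂ b₃ (:- M a₁ b₁ a₂ b₂) (M a₀ b₀ a₂ b₂) (:- M a₀ b₀ a₁ b₁) O := O)
          refl (a 0F) (a 1F) (a 2F) (a 3F) (b 0F) (b 1F) (b 2F) (b 3F)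

  dualPlücker-skew : ∀ a b k l → dualPlücker a b k l ≈ - dualPlücker a b l k
  dualPlücker-skew a b 0F 0F = sym -0#≈0#
  dualPlücker-skew a b 0F 1F = sym (-‿involutive _)
  dualPlücker-skew a b 0F 2F = refl
  dualPlücker-skew a b 0F 3F = sym (-‿involutive _)
  dualPlücker-skew a b 1F 0F = refl
  dualPlücker-skew a b 1F 1F = sym -0#≈0#
  dualPlücker-skew a b 1F 2F = sym (-‿involutive _)
  dualPlücker-skew a b 1F 3F = refl
  dualPlücker-skew a b 2F 0F = sym (-‿involutive _)
  dualPlücker-skew a b 2F 1F = refl
  dualPlücker-skew a b 2F 2F = sym -0#≈0#
  dualPlücker-skew a b 2F 3F = sym (-‿involutive _)
  dualPlücker-skew a b 3F 0F = refl
  dualPlücker-skew a b 3F 1F = sym (-‿involutive _)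
  dualPlücker-skew a b 3F 2F = refl
  dualPlücker-skew a b 3F 3F = sym -0#≈0#

  minors-from-six : ∀ {x y} → minor x y 0F 1F ≈ 0# → minor x y 0F 2F ≈ 0# → minor x y 0F 3F ≈ 0# →
    minor x y 1F 2F ≈ 0# → minor x y 1F 3F ≈ 0# → minor x y 2F 3F ≈ 0# → ∀ i j → minor x y i j ≈ 0#
  minors-from-six {x} {y} p01 p02 p03 p12 p13 p23 = table
    where
    flip : ∀ i j → minor x y i j ≈ 0# → minor x y j i ≈ 0#
    flip i j p = begin
      minor x y j i    ≈⟨ solve 4 (λ a b c d → a :* b :- c :* d := :- (c :* d :- a :* b)) refl _ _ _ _ ⟩
      - minor x y i j  ≈⟨ -‿cong p ⟩
      - 0#             ≈⟨ -0#≈0# ⟩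
      0#               ∎
    table : ∀ i j → minor x y i j ≈ 0#
    table 0F 0F = -‿inverseʳ _
    table 0F 1F = p01
    table 0F 2F = p02
    table 0F 3F = p03
    table 1F 0F = flip 0F 1F p01
    table 1F 1F = -‿inverseʳ _
    table 1F 2F = p12
    table 1F 3F = p13
    table 2F 0F = flip 0F 2F p02
    table 2F 1F = flip 1F 2F p12
    table 2F 2F = -‿inverseʳ _
    table 2F 3F = p23
    table 3F 0F = flip 0F 3F p03
    table 3F 1F = flip 1F 3F p13
    table 3F 2F = flip 2F 3F p23
    table 3F 3F = -‿inverseʳ _

  -- All rows of `dualPlücker a b` lie on both planes. Suppose they are all parallel to `q`, and
  -- `q l` is nonzero. A row is then zero as soon as its entry at `l` is. Row `l` is such a row, its
  -- diagonal entry being 0; by skewness column `l` vanishes, hence the whole matrix, and with it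
  -- every minor of `a` and `b`.
  second-point : ∀ {a b q} → ¬ MinorsVanish a b → NonZero q →
    ¬ ¬ ∃ λ r → dot a r ≈ 0# × dot b r ≈ 0# × ∃₂ λ i j → ¬ minor q r i j ≈ 0#
  second-point {a} {b} {q} independent q≉0 none =
    nonzero-entry q≉0 λ (l , qₗ≉0) →
    ¬¬-all (λ k → ¬¬-all λ i → ¬¬-all λ j p → none (M k , proj₁ (dualPlücker-meet a b k) , proj₂ (dualPlücker-meet a b k) , i , j , p)) λ parallel →
    let M-ratio : ∀ k j → M k l ≈ 0# → M k j ≈ 0#
        M-ratio k j Mₖₗ≈0 = cancelˡ qₗ≉0 (begin
          q l * M k j                               ≈⟨ solve 2 (λ x y → x := (x :- y) :+ y) refl _ _ ⟩
          (q l * M k j - q j * M k l) + q j * M k l ≈⟨ +-cong (parallel k l j) (trans (*-congˡ Mₖₗ≈0) (zeroʳ _)) ⟩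
          0# + 0#                                   ≈⟨ +-identityˡ 0# ⟩
          0#                                        ∎)
        M≈0 : ∀ k j → M k j ≈ 0#
        M≈0 k j = M-ratio k j (trans (dualPlücker-skew a b k l)
          (trans (-‿cong (M-ratio l k (diagonal l))) -0#≈0#))
        p≈0 = minors-from-six {a} {b} (M≈0 2F 3F) (M≈0 3F 1F) (M≈0 1F 2F) (M≈0 0F 3F) (M≈0 2F 0F) (M≈0 0F 1F)
    in independent λ i j k → k (p≈0 i j)
    where
    M : Fin 4 → V4
    M = dualPlücker a b
    diagonal : ∀ l → M l l ≈ 0#
    diagonal 0F = refl
    diagonal 1F = refl
    diagonal 2F = refl
    diagonal 3F = refl

  lineThrough : ∀ q r i j → ¬ minor q r i j ≈ 0# → Line
  lineThrough q r i j μ≉0 = record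
    { u = q
    ; v = r
    ; independent = λ s t p → cancelˡ μ≉0 (begin
          minor q r i j * s
            ≈⟨ solve 6 (λ s t a b c d → (a :* d :- b :* c) :* s
                 := d :* (s :* a :+ t :* c) :- c :* (s :* b :+ t :* d)) refl s t (q i) (q j) (r i) (r j) ⟩
          r j * (s * q i + t * r i) - r i * (s * q j + t * r j)
            ≈⟨ zero-combination (p i) (p j) ⟩
          0# ∎)
      , cancelˡ μ≉0 (begin
          minor q r i j * t
            ≈⟨ solve 6 (λ s t a b c d → (a :* d :- b :* c) :* t
                 := a :* (s :* b :+ t :* d) :- b :* (s :* a :+ t :* c)) refl s t (q i) (q j) (r i) (r j) ⟩
          q i * (s * q j + t * r j) - q j * (s * q i + t * r i)
            ≈⟨ zero-combination (p j) (p i) ⟩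
          0# ∎)
    }
    where
    zero-combination : ∀ {x y a b} → a ≈ 0# → b ≈ 0# → x * a - y * b ≈ 0#
    zero-combination {x} {y} p q = trans (+-cong (*-congˡ p) (-‿cong (*-congˡ q)))
      (solve 2 (λ x y → x :* con (+ 0) :- y :* con (+ 0) := con (+ 0)) refl x y)

  span-in-plane : ∀ l a x → LineInPlane l a → InSpan x l → OnPlane x a
  span-in-plane l a x (pu , pv) (s , t , e) = begin
    dot a x
      ≈⟨ +-cong (*-congˡ (e 0F)) (+-cong (*-congˡ (e 1F)) (+-cong (*-congˡ (e 2F)) (*-congˡ (e 3F)))) ⟩
    dot a (λ i → s * Line.u l i + t * Line.v l i)
      ≈⟨ solve 14 (λ s t a₀ a₁ a₂ a₃ u₀ u₁ u₂ u₃ v₀ v₁ v₂ v₃ →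
           a₀ :* (s :* u₀ :+ t :* v₀) :+ (a₁ :* (s :* u₁ :+ t :* v₁) :+ (a₂ :* (s :* u₂ :+ t :* v₂) :+ a₃ :* (s :* u₃ :+ t :* v₃)))
           := s :* (a₀ :* u₀ :+ (a₁ :* u₁ :+ (a₂ :* u₂ :+ a₃ :* u₃))) :+ t :* (a₀ :* v₀ :+ (a₁ :* v₁ :+ (a₂ :* v₂ :+ a₃ :* v₃))))
           refl _ _ _ _ _ _ _ _ _ _ _ _ _ _ ⟩
    s * dot a (Line.u l) + t * dot a (Line.v l)
      ≈⟨ +-cong (*-congˡ pu) (*-congˡ pv) ⟩
    s * 0# + t * 0#
      ≈⟨ solve 2 (λ s t → s :* con (+ 0) :+ t :* con (+ 0) := con (+ 0)) refl s t ⟩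
    0# ∎

  -- The line through `q` and a second common point of the first two planes would lie in all k + 2
  -- planes. It is no line of `Ls`: such a line would contain `q` and lie in the first plane, which
  -- `IStar` forbids at this incidence. So `atMost` applies and yields k + 2 ≤ k.
  concurrent-planes : ∀ {r n k} {Ls : Fin r → Line} {Π : Fin n → V4} {q} → PlanesPerLineAtMost Ls Π k → NonZero q →
    ∀ (g : Fin (suc (suc k)) → Fin n) → Injective _≡_ _≡_ g → (∀ x → IStar Ls q (Π (g x))) →
    ¬ MinorsVanish (Π (g 0F)) (Π (g 1F)) →
    ¬ (∀ r → dot (Π (g 0F)) r ≈ 0# → dot (Π (g 1F)) r ≈ 0# → ∀ x → ¬ ¬ dot (Π (g x)) r ≈ 0#)
  concurrent-planes {k = k} {Ls} {Π} {q} atMost q≉0 g inj star independent contain =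
    second-point independent q≉0 λ (r , p₀ , p₁ , i , j , μ≉0) →
    ¬¬-all (contain r p₀ p₁) λ on →
    let l = lineThrough q r i j μ≉0 in
    ℕₚ.<-irrefl ≡.refl (ℕₚ.≤-trans (ℕₚ.n≤1+n _) (atMost l
      (λ j′ ((q∈ , _) , (u∈ , v∈)) → excluded j′ q∈
        (span-in-plane l (Π (g 0F)) _ (proj₁ (star 0F) , p₀) u∈ , span-in-plane l (Π (g 0F)) _ (proj₁ (star 0F) , p₀) v∈))
      (suc (suc k)) g inj (λ x → proj₁ (star x) , on x)))
    where
    excluded : ∀ j → OnLine q (Ls j) → LineInPlane (Ls j) (Π (g 0F)) → ⊥
    excluded j on within with proj₂ (star 0F) j
    ... | inj₁ off     = off on
    ... | inj₂ outside = outside within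

-- Generic coordinates over the power series.

common-multiple : ∀ {c ℓ} (D : InfiniteDomain c ℓ) → let open InfiniteDomain D in
  ∀ {m} (x : Fin m → Carrier) → (∀ i → ¬ x i ≈ 0#) →
  ∃₂ λ Δ (e : Fin m → Carrier) → ¬ Δ ≈ 0# × (∀ i → e i * x i ≈ Δ)
common-multiple D = go
  where
  open InfiniteDomain D hiding (zero)
  go : ∀ {m} (x : Fin m → Carrier) → (∀ i → ¬ x i ≈ 0#) →
    ∃₂ λ Δ (e : Fin m → Carrier) → ¬ Δ ≈ 0# × (∀ i → e i * x i ≈ Δ)
  go {zero}  x x≉0 = sample 0 , (λ ()) , sample≉0 0 , λ ()
  go {suc m} x x≉0 with go (x ∘ suc) (x≉0 ∘ suc)
  ... | Δ , e , Δ≉0 , ex≈Δ =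
      x zero * Δ
    , (λ { zero → Δ ; (suc i) → x zero * e i })
    , (λ p → Δ≉0 (integral p (x≉0 zero)))
    , (λ { zero → *-comm _ _ ; (suc i) → trans (*-assoc _ _ _) (*-congˡ (ex≈Δ i)) })

module GenericCoordinates {c ℓ : Level} (F : Field c ℓ) where
  open Geometry F using (V4; dot; NonZero; IsProjSet)
  open ProjectiveSpace F
  private
    module F = Field F
    module K = StableDomain fieldDomain
  open PowerSeries fieldDomain public

  seriesDomain : InfiniteDomain c ℓ
  seriesDomain = record
    { stableDomain    = series
    ; sample          = λ i → power (suc i)
    ; sample-distinct = λ i j i≢j p → 1≉0 (K.trans (K.sym (power-self i)) (K.trans (p (suc i)) (power-other j i (i≢j ∘ ≡.sym))))
    ; sample≉0        = λ i p → 1≉0 (K.trans (K.sym (power-self i)) (p (suc i)))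
    }
    where
    1≉0 : ¬ F.1# K.≈ F.0#
    1≉0 p = p λ 1≈0 → F.0≉1 (F.sym 1≈0)

  open InfiniteDomain seriesDomain hiding (zero)
  open IntegerSolver commutativeRing
  open SetoidReasoning setoid

  ι : F.Carrier → Series
  ι = constant

  horner : List Series → Series
  horner []       = 0#
  horner (a ∷ as) = a + t * horner as

  data Constants : List Series → List F.Carrier → Set (c ⊔ ℓ) where
    []  : Constants [] []
    _∷_ : ∀ {s x ss xs} → s ≈ ι x → Constants ss xs → Constants (s ∷ ss) (x ∷ xs)

  infixr 5 _∷_

  -- Powers of t are independent over the field. Both genericity conditions reduce to this after
  -- expansion in powers of t.
  horner-independent : ∀ {ss xs} → Constants ss xs → horner ss ≈ 0# → ∀ i → lookup xs i K.≈ F.0#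
  horner-independent {s ∷ ss} {x ∷ xs} (p ∷ ps) q i with constant+t⊛≈0 x (horner ss) (trans (+-congʳ (sym p)) q)
  horner-independent (p ∷ ps) q zero    | x≈0 , _    = x≈0
  horner-independent (p ∷ ps) q (suc i) | _ , rest≈0 = horner-independent ps rest≈0 i

  0≈ι0 : 0# ≈ ι F.0#
  0≈ι0 zero    = K.refl
  0≈ι0 (suc n) = K.refl

  t² t³ t⁴ : Series
  t² = t * t
  t³ = t * t²
  t⁴ = t * t³

  -- Without the summand `t³ * Z v`, the form `X` would vanish at (0 , 0 , 0 , 1). Adding a multiple
  -- of `Z` does not affect the determinant in `separate`.
  module Generic (β γ : Series) where
    Z X : V4 → Series
    Z v = (ι (v 3F) - β * ι (v 0F)) - t³ * ι (v 1F)
    X v = ((ι (v 2F) - t * ι (v 0F)) - γ * ι (v 1F)) + t³ * Z v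

  private
    module KP = RingProperties K.ring

    neg-zero : ∀ {x} → F.- x K.≈ F.0# → x K.≈ F.0#
    neg-zero {x} q = K.trans (K.sym (KP.-‿involutive x)) (K.trans (K.-‿cong q) KP.-0#≈0#)

    sum-zero : ∀ {x y} → x F.+ y K.≈ F.0# → y K.≈ F.0# → x K.≈ F.0#
    sum-zero {x} q r = K.trans (K.sym (K.+-identityʳ x)) (K.trans (K.+-congˡ (K.sym r)) q)

    six : ∀ {v w} → minor v w 0F 1F K.≈ F.0# → minor v w 0F 2F K.≈ F.0# → minor v w 0F 3F K.≈ F.0# →
      minor v w 1F 2F K.≈ F.0# → minor v w 1F 3F K.≈ F.0# → minor v w 2F 3F K.≈ F.0# → MinorsVanish v w
    six {v} {w} p01 p02 p03 p12 p13 p23 i j k = p01 λ p01 → p02 λ p02 → p03 λ p03 → p12 λ p12 → p13 λ p13 → p23 λ p23 →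
      k (minors-from-six {v} {w} p01 p02 p03 p12 p13 p23 i j)

    four : ∀ {v : V4} → v 0F K.≈ F.0# → v 1F K.≈ F.0# → v 2F K.≈ F.0# → v 3F K.≈ F.0# → ¬ NonZero v
    four v₀ v₁ v₂ v₃ v≉0 = ¬¬-all (λ { 0F → v₀ ; 1F → v₁ ; 2F → v₂ ; 3F → v₃ }) v≉0

    ι-+ : ∀ {s s′ x y} → s ≈ ι x → s′ ≈ ι y → s + s′ ≈ ι (x F.+ y)
    ι-+ p q = trans (+-cong p q) (sym (constant-+ _ _))

    ι-neg : ∀ {s x} → s ≈ ι x → - s ≈ ι (F.- x)
    ι-neg p = trans (-‿cong p) (sym (constant-neg _))

    ιp : V4 → V4 → Fin 4 → Fin 4 → Series
    ιp v w i j = ι (v i) * ι (w j) - ι (v j) * ι (w i)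

    ι-minor : ∀ v w i j → ιp v w i j ≈ ι (minor v w i j)
    ι-minor v w i j = sym (trans (constant-+ _ _) (+-cong (constant-* _ _) (trans (constant-neg _) (-‿cong (constant-* _ _)))))

  -- `X≉0` keeps every point defined over the field in one affine chart, and `separate` makes the
  -- coordinate Z / X injective on these points.
  record IsGeneric (β γ : Series) : Set (c ⊔ ℓ) where
    open Generic β γ
    field
      X≉0      : ∀ {v} → NonZero v → ¬ X v ≈ 0#
      separate : ∀ {v w} → ¬ MinorsVanish v w → ¬ X v * Z w - X w * Z v ≈ 0#

  -- The Plücker coordinates 1, t, β, γ, t³ and t⁴ - β γ of the line X = Z = 0 are linearly
  -- independent over F, so this line is skew to every line defined over F.
  points-generic : IsGeneric t⁴ t²
  points-generic = record
    { X≉0 = λ {v} v≉0 Xv≈0 →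
        let zeros = horner-independent
              {ι (v 2F) ∷ - ι (v 0F) ∷ - ι (v 1F) ∷ ι (v 3F) ∷ 0# ∷ 0# ∷ - ι (v 1F) ∷ - ι (v 0F) ∷ []}
              (refl ∷ ι-neg refl ∷ ι-neg refl ∷ refl ∷ 0≈ι0 ∷ 0≈ι0 ∷ ι-neg refl ∷ ι-neg refl ∷ [])
              (trans (solve 5 (λ t v₀ v₁ v₂ v₃ → let t² = t :* t ; t³ = t :* t² ; t⁴ = t :* t³ ; O = con (+ 0) in
                 v₂ :+ t :* (:- v₀ :+ t :* (:- v₁ :+ t :* (v₃ :+ t :* (O :+ t :* (O :+ t :* (:- v₁ :+ t :* (:- v₀ :+ t :* O)))))))
                 := ((v₂ :- t :* v₀) :- t² :* v₁) :+ t³ :* ((v₃ :- t⁴ :* v₀) :- t³ :* v₁)) refl _ _ _ _ _) Xv≈0)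
        in four {v} (neg-zero (zeros 1F)) (neg-zero (zeros 2F)) (zeros 0F) (zeros 3F) v≉0
    ; separate = λ {v} {w} independent XZ≈0 →
        let q = ιp v w
            zeros = horner-independent
              {q 2F 3F ∷ - q 0F 3F ∷ - q 1F 3F ∷ q 1F 2F ∷ q 0F 2F + q 0F 1F ∷ 0# ∷ - q 0F 1F ∷ []}
              (ι-minor v w 2F 3F ∷ ι-neg (ι-minor v w 0F 3F) ∷ ι-neg (ι-minor v w 1F 3F) ∷ ι-minor v w 1F 2F
                ∷ ι-+ (ι-minor v w 0F 2F) (ι-minor v w 0F 1F) ∷ 0≈ι0 ∷ ι-neg (ι-minor v w 0F 1F) ∷ [])
              (trans (solve 9 (λ t v₀ v₁ v₂ v₃ w₀ w₁ w₂ w₃ →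
                 let t² = t :* t ; t³ = t :* t² ; t⁴ = t :* t³ ; O = con (+ 0)
                     m = λ x y x′ y′ → x :* y′ :- x′ :* y
                     z = λ x₀ x₁ x₃ → (x₃ :- t⁴ :* x₀) :- t³ :* x₁
                     x = λ x₀ x₁ x₂ x₃ → ((x₂ :- t :* x₀) :- t² :* x₁) :+ t³ :* z x₀ x₁ x₃
                 in m v₂ w₂ v₃ w₃ :+ t :* (:- m v₀ w₀ v₃ w₃ :+ t :* (:- m v₁ w₁ v₃ w₃ :+ t :* (m v₁ w₁ v₂ w₂
                      :+ t :* ((m v₀ w₀ v₂ w₂ :+ m v₀ w₀ v₁ w₁) :+ t :* (O :+ t :* (:- m v₀ w₀ v₁ w₁ :+ t :* O))))))
                 := x v₀ v₁ v₂ v₃ :* z w₀ w₁ w₃ :- x w₀ w₁ w₂ w₃ :* z v₀ v₁ v₃) refl _ _ _ _ _ _ _ _ _) XZ≈0)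
            p01 = neg-zero (zeros 6F)
        in independent (six {v} {w} p01 (sum-zero (zeros 4F) p01) (neg-zero (zeros 1F)) (zeros 3F) (neg-zero (zeros 2F)) (zeros 0F))
    }

  -- The duality of points and planes exchanges `β` and `γ`, so the opposite choice of exponents has
  -- to be generic too. Five minors stand alone in the expansion; the remaining one, with indices 1
  -- and 3, shares degree 4 with the minor that degree 6 shows to be zero.
  planes-generic : IsGeneric t² t⁴
  planes-generic = record
    { X≉0 = λ {v} v≉0 Xv≈0 →
        let zeros = horner-independent
              {ι (v 2F) ∷ - ι (v 0F) ∷ 0# ∷ ι (v 3F) ∷ - ι (v 1F) ∷ - ι (v 0F) ∷ - ι (v 1F) ∷ []}
              (refl ∷ ι-neg refl ∷ 0≈ι0 ∷ refl ∷ ι-neg refl ∷ ι-neg refl ∷ ι-neg refl ∷ [])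
              (trans (solve 5 (λ t v₀ v₁ v₂ v₃ → let t² = t :* t ; t³ = t :* t² ; t⁴ = t :* t³ ; O = con (+ 0) in
                 v₂ :+ t :* (:- v₀ :+ t :* (O :+ t :* (v₃ :+ t :* (:- v₁ :+ t :* (:- v₀ :+ t :* (:- v₁ :+ t :* O))))))
                 := ((v₂ :- t :* v₀) :- t⁴ :* v₁) :+ t³ :* ((v₃ :- t² :* v₀) :- t³ :* v₁)) refl _ _ _ _ _) Xv≈0)
        in four {v} (neg-zero (zeros 1F)) (neg-zero (zeros 4F)) (zeros 0F) (zeros 3F) v≉0
    ; separate = λ {v} {w} independent XZ≈0 →
        let q = ιp v w
            zeros = horner-independent
              {q 2F 3F ∷ - q 0F 3F ∷ q 0F 2F ∷ q 1F 2F ∷ - q 1F 3F + q 0F 1F ∷ 0# ∷ - q 0F 1F ∷ []}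
              (ι-minor v w 2F 3F ∷ ι-neg (ι-minor v w 0F 3F) ∷ ι-minor v w 0F 2F ∷ ι-minor v w 1F 2F
                ∷ ι-+ (ι-neg (ι-minor v w 1F 3F)) (ι-minor v w 0F 1F) ∷ 0≈ι0 ∷ ι-neg (ι-minor v w 0F 1F) ∷ [])
              (trans (solve 9 (λ t v₀ v₁ v₂ v₃ w₀ w₁ w₂ w₃ →
                 let t² = t :* t ; t³ = t :* t² ; t⁴ = t :* t³ ; O = con (+ 0)
                     m = λ x y x′ y′ → x :* y′ :- x′ :* y
                     z = λ x₀ x₁ x₃ → (x₃ :- t² :* x₀) :- t³ :* x₁
                     x = λ x₀ x₁ x₂ x₃ → ((x₂ :- t :* x₀) :- t⁴ :* x₁) :+ t³ :* z x₀ x₁ x₃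
                 in m v₂ w₂ v₃ w₃ :+ t :* (:- m v₀ w₀ v₃ w₃ :+ t :* (m v₀ w₀ v₂ w₂ :+ t :* (m v₁ w₁ v₂ w₂
                      :+ t :* ((:- m v₁ w₁ v₃ w₃ :+ m v₀ w₀ v₁ w₁) :+ t :* (O :+ t :* (:- m v₀ w₀ v₁ w₁ :+ t :* O))))))
                 := x v₀ v₁ v₂ v₃ :* z w₀ w₁ w₃ :- x w₀ w₁ w₂ w₃ :* z v₀ v₁ v₃) refl _ _ _ _ _ _ _ _ _) XZ≈0)
            p01 = neg-zero (zeros 6F)
        in independent (six {v} {w} p01 (zeros 2F) (neg-zero (zeros 1F)) (zeros 3F) (neg-zero (sum-zero (zeros 4F) p01)) (zeros 0F))
    }

-- From point-plane incidences to crossings of red and blue lines.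

module IncidenceModel {c ℓ : Level} (F : Field c ℓ) where
  open Geometry F hiding (u; v)
  open ProjectiveSpace F
  open GenericCoordinates F
  private
    module F = Field F
    module K = StableDomain fieldDomain
    module Point = Generic t⁴ t²
    module Plane = Generic t² t⁴
  open InfiniteDomain seriesDomain hiding (zero)
  open IntegerSolver commutativeRing
  open SetoidReasoning setoid

  -- Exchanging (q₀ , q₁) with (- π₂ , - π₃), (q₂ , q₃) with (π₀ , π₁) and β with γ turns the
  -- coordinate forms X and Z of points into the corresponding ones of planes.
  dual : V4 → V4
  dual π 0F = F.- π 2F
  dual π 1F = F.- π 3F
  dual π 2F = π 0F
  dual π 3F = π 1F

  dual-isProjSet : ∀ {n} {Π : Fin n → V4} → IsProjSet Π → IsProjSet (dual ∘ Π)
  dual-isProjSet {Π = Π} (nonzero , distinct) =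
      (λ j z → nonzero j λ { 0F → z 2F ; 1F → z 3F ; 2F → neg-zero (z 0F) ; 3F → neg-zero (z 1F) })
    , (λ j j′ (s , p) → distinct j j′ (s , λ { 0F → p 2F ; 1F → p 3F ; 2F → neg-cancel (p 0F) ; 3F → neg-cancel (p 1F) }))
    where
    open RingProperties F.ring using (-‿injective; -‿distribʳ-*; -0#≈0#)
    neg-zero : ∀ {x} → F.- x F.≈ F.0# → x F.≈ F.0#
    neg-zero p = -‿injective (F.trans p (F.sym -0#≈0#))
    neg-cancel : ∀ {x s y} → F.- x F.≈ s F.* (F.- y) → x F.≈ s F.* y
    neg-cancel p = -‿injective (F.trans p (F.sym (-‿distribʳ-* _ _)))

  pointY pointH : V4 → Series
  pointY q = ι (q 0F)
  pointH q = ι (q 1F) - t³ * ι (q 0F)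

  planeA planeB planeC planeD : V4 → Series
  planeA π = ι (π 2F)
  planeB π = Plane.X (dual π)
  planeC π = Plane.Z (dual π)
  planeD π = t³ * ι (π 2F) - ι (π 3F)

  -- Incidence in generic point coordinates and the contragredient plane coordinates. Scaling will
  -- make the coordinates X and B constant; those named Z and C then separate points and planes.
  pairing : V4 → V4 → Series
  pairing π q = ((planeA π * Point.X q + planeB π * pointY q) + planeC π * pointH q) - planeD π * Point.Z q

  pairing≈dot : ∀ π q → pairing π q ≈ ι (dot π q)
  pairing≈dot π q = begin
    pairing π q
      ≈⟨ +-congʳ (+-cong (+-congˡ (*-congʳ (+-cong (+-cong (+-congˡ (-‿cong (*-congˡ (constant-neg _))))
                                                         (-‿cong (*-congˡ (constant-neg _)))) (*-congˡ C≈))))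
                         (*-congʳ C≈)) ⟩
    ((planeA π * Point.X q + (((ι (π 0F) - t * - ι (π 2F)) - t⁴ * - ι (π 3F)) + t³ * C′) * pointY q) + C′ * pointH q) - planeD π * Point.Z q
      ≈⟨ solve 9 (λ t a₀ a₁ a₂ a₃ q₀ q₁ q₂ q₃ →
           let t² = t :* t ; t³ = t :* t² ; t⁴ = t :* t³
               z = (q₃ :- t⁴ :* q₀) :- t³ :* q₁
               x = ((q₂ :- t :* q₀) :- t² :* q₁) :+ t³ :* z
               c = (a₁ :- t² :* (:- a₂)) :- t³ :* (:- a₃)
               b = ((a₀ :- t :* (:- a₂)) :- t⁴ :* (:- a₃)) :+ t³ :* c
           in ((a₂ :* x :+ b :* q₀) :+ c :* (q₁ :- t³ :* q₀)) :- (t³ :* a₂ :- a₃) :* z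
              := a₀ :* q₀ :+ (a₁ :* q₁ :+ (a₂ :* q₂ :+ a₃ :* q₃))) refl _ _ _ _ _ _ _ _ _ ⟩
    ι (π 0F) * ι (q 0F) + (ι (π 1F) * ι (q 1F) + (ι (π 2F) * ι (q 2F) + ι (π 3F) * ι (q 3F)))
      ≈⟨ trans (constant-+ _ _) (+-cong (constant-* _ _) (trans (constant-+ _ _) (+-cong (constant-* _ _)
           (trans (constant-+ _ _) (+-cong (constant-* _ _) (constant-* _ _)))))) ⟨
    ι (dot π q) ∎
    where
    C′ : Series
    C′ = (ι (π 1F) - t² * - ι (π 2F)) - t³ * - ι (π 3F)
    C≈ : planeC π ≈ C′
    C≈ = +-cong (+-congˡ (-‿cong (*-congˡ (constant-neg _)))) (-‿cong (*-congˡ (constant-neg _)))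

  dot≈0⇒pairing≈0 : ∀ π q → dot π q F.≈ F.0# → pairing π q ≈ 0#
  dot≈0⇒pairing≈0 π q p = trans (pairing≈dot π q) (trans (constant-cong (λ k → k p)) (sym 0≈ι0))

  scaled-distinct : ∀ {β γ} → IsGeneric β γ → let open Generic β γ in ∀ {v w Δ e e′} → ¬ MinorsVanish v w → ¬ Δ ≈ 0# →
    e * X v ≈ Δ → e′ * X w ≈ Δ → ¬ e * Z v ≈ e′ * Z w
  scaled-distinct {β} {γ} generic {v} {w} {Δ} {e} {e′} independent Δ≉0 eX e′X eZ = IsGeneric.separate generic independent
    (integral (begin
      Δ * (X v * Z w - X w * Z v)
        ≈⟨ solve 5 (λ d x z x′ z′ → d :* (x :* z′ :- x′ :* z) := x :* (d :* z′) :- x′ :* (d :* z)) refl _ _ _ _ _ ⟩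
      X v * (Δ * Z w) - X w * (Δ * Z v)
        ≈⟨ +-cong (*-congˡ (*-congʳ e′X)) (-‿cong (*-congˡ (*-congʳ eX))) ⟨
      X v * (e′ * X w * Z w) - X w * (e * X v * Z v)
        ≈⟨ solve 6 (λ e e′ x z x′ z′ → x :* (e′ :* x′ :* z′) :- x′ :* (e :* x :* z) := x :* x′ :* (e′ :* z′ :- e :* z)) refl _ _ _ _ _ _ ⟩
      X v * X w * (e′ * Z w - e * Z v)
        ≈⟨ *-congˡ (trans (+-congʳ (sym eZ)) (-‿inverseʳ _)) ⟩
      X v * X w * 0#
        ≈⟨ zeroʳ _ ⟩
      0# ∎) Δ≉0)
    where open Generic β γ

  -- Cramer's rule: (B , C) is a combination of (B₁ , C₁) and (B₂ , C₂), so the functional u B + v C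
  -- vanishes on it if it vanishes on those two.
  span-zero : ∀ {κ u v B₁ C₁ φ₁ B₂ C₂ φ₂ B C φ} → ¬ κ ≈ 0# → ¬ B₁ * C₂ - B₂ * C₁ ≈ 0# →
    κ * φ₁ ≈ u * B₁ + v * C₁ → κ * φ₂ ≈ u * B₂ + v * C₂ → κ * φ ≈ u * B + v * C →
    φ₁ ≈ 0# → φ₂ ≈ 0# → φ ≈ 0#
  span-zero {κ} {u} {v} {B₁} {C₁} {φ₁} {B₂} {C₂} {φ₂} {B} {C} {φ} κ≉0 det≉0 e₁ e₂ e z₁ z₂ = integral (integral (begin
    κ * ((B₁ * C₂ - B₂ * C₁) * φ)
      ≈⟨ solve 3 (λ κ d φ → κ :* (d :* φ) := d :* (κ :* φ)) refl _ _ _ ⟩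
    (B₁ * C₂ - B₂ * C₁) * (κ * φ)
      ≈⟨ *-congˡ e ⟩
    (B₁ * C₂ - B₂ * C₁) * (u * B + v * C)
      ≈⟨ solve 8 (λ u v b₁ c₁ b₂ c₂ b c → (b₁ :* c₂ :- b₂ :* c₁) :* (u :* b :+ v :* c)
           := (b :* c₂ :- c :* b₂) :* (u :* b₁ :+ v :* c₁) :+ (b₁ :* c :- c₁ :* b) :* (u :* b₂ :+ v :* c₂)) refl _ _ _ _ _ _ _ _ ⟩
    (B * C₂ - C * B₂) * (u * B₁ + v * C₁) + (B₁ * C - C₁ * B) * (u * B₂ + v * C₂)
      ≈⟨ +-cong (*-congˡ (trans (sym e₁) (trans (*-congˡ z₁) (zeroʳ κ)))) (*-congˡ (trans (sym e₂) (trans (*-congˡ z₂) (zeroʳ κ)))) ⟩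
    (B * C₂ - C * B₂) * 0# + (B₁ * C - C₁ * B) * 0#
      ≈⟨ solve 2 (λ x y → x :* con (+ 0) :+ y :* con (+ 0) := con (+ 0)) refl _ _ ⟩
    0# ∎) κ≉0) det≉0

  module Model {m n r k σ : ℕ} {P : Fin m → V4} {Π : Fin n → V4} {Ls : Fin r → Line}
    (P-set : IsProjSet P) (Π-set : IsProjSet Π) (atMost : PlanesPerLineAtMost Ls Π k)
    (large-char : ∀ j → 1 ℕ.≤ j → j ℕ.≤ suc (σ ℕ.+ σ) → ¬ natMul j F.≈ F.0#)
    (core : Pruning.Core (λ (i , j) → IStar Ls (P i) (Π j))
              (suc (suc k) ℕ.+ suc (σ ℕ.+ (σ ℕ.+ (σ ℕ.+ σ)))) (suc (σ ℕ.+ (σ ℕ.+ σ)))) where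
    open Pruning.Core core

    private
      points = common-multiple seriesDomain (Point.X ∘ P) (λ i → IsGeneric.X≉0 points-generic (proj₁ P-set i))
      planes = common-multiple seriesDomain (planeB ∘ Π) (λ j → IsGeneric.X≉0 planes-generic (proj₁ (dual-isProjSet Π-set) j))
      Δ Δ′ : Series
      Δ  = proj₁ points
      Δ′ = proj₁ planes
      e : Fin m → Series
      e = proj₁ (proj₂ points)
      e′ : Fin n → Series
      e′ = proj₁ (proj₂ planes)
      Δ≉0 : ¬ Δ ≈ 0#
      Δ≉0 = proj₁ (proj₂ (proj₂ points))
      Δ′≉0 : ¬ Δ′ ≈ 0#
      Δ′≉0 = proj₁ (proj₂ (proj₂ planes))
      eX : ∀ i → e i * Point.X (P i) ≈ Δ
      eX = proj₂ (proj₂ (proj₂ points))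
      e′B : ∀ j → e′ j * planeB (Π j) ≈ Δ′
      e′B = proj₂ (proj₂ (proj₂ planes))

      star : ∀ {i j} → (i , j) ∈ edges → IStar Ls (P i) (Π j)
      star = All.lookup holds

      -- The vanishing of `pairing`, multiplied by `e i * e′ j`; the coordinates X and B are
      -- absorbed into `Δ` and `Δ′`.
      incident : ∀ {i j} → (i , j) ∈ edges →
        (Δ * (e′ j * planeA (Π j)) + Δ′ * (e i * pointY (P i))) + (e′ j * planeC (Π j)) * (e i * pointH (P i))
          ≈ (e′ j * planeD (Π j)) * (e i * Point.Z (P i))
      incident {i} {j} ij = begin
        (Δ * (e′ j * planeA (Π j)) + Δ′ * (e i * pointY (P i))) + (e′ j * planeC (Π j)) * (e i * pointH (P i))
          ≈⟨ +-congʳ (+-cong (*-congʳ (eX i)) (*-congʳ (e′B j))) ⟨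
        (e i * Point.X (P i) * (e′ j * planeA (Π j)) + e′ j * planeB (Π j) * (e i * pointY (P i))) + (e′ j * planeC (Π j)) * (e i * pointH (P i))
          ≈⟨ solve 10 (λ e e′ a b c d x y z h → (e :* x :* (e′ :* a) :+ e′ :* b :* (e :* y)) :+ (e′ :* c) :* (e :* h)
               := (e′ :* d) :* (e :* z) :+ e :* e′ :* (((a :* x :+ b :* y) :+ c :* h) :- d :* z)) refl _ _ _ _ _ _ _ _ _ _ ⟩
        (e′ j * planeD (Π j)) * (e i * Point.Z (P i)) + e i * e′ j * pairing (Π j) (P i)
          ≈⟨ +-congˡ (trans (*-congˡ (dot≈0⇒pairing≈0 (Π j) (P i) (proj₁ (star ij)))) (zeroʳ _)) ⟩
        (e′ j * planeD (Π j)) * (e i * Point.Z (P i)) + 0#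
          ≈⟨ +-identityʳ _ ⟩
        (e′ j * planeD (Π j)) * (e i * Point.Z (P i)) ∎

      -- The assumed relation expresses D through B and C, and incidence with `P i` does the same
      -- for A. The planes thus depend linearly on (B , C) alone, and the line common to two of them
      -- lies in all the others.
      pencil : ∀ {i} → i ∈ reds → ∀ α β γ → ¬ α ≈ 0# →
        ¬ suc (suc k) Many (λ j → (i , j) ∈ edges × α * (e′ j * planeD (Π j)) + β * (e′ j * planeC (Π j)) ≈ γ)
      pencil {i} _ α β γ α≉0 (g , inj , p) = concurrent-planes {Ls = Ls} {Π} {P i} atMost (proj₁ P-set i) g inj (star ∘ proj₁ ∘ p)
        (distinct⇒minor Π-set _ _ g₀≢g₁)
        λ r p₀ p₁ x → let φ≈0 = span-zero
                              (λ q → IsGeneric.X≉0 points-generic (proj₁ P-set i) (integral q κ≉0))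
                              (IsGeneric.separate planes-generic (distinct⇒minor (dual-isProjSet Π-set) _ _ g₀≢g₁))
                              (reduce r 0F) (reduce r 1F) (reduce r x)
                              (dot≈0⇒pairing≈0 (Π (g 0F)) r p₀) (dot≈0⇒pairing≈0 (Π (g 1F)) r p₁)
                      -- The pairing is a constant series, so its coefficient 0 is the equation over
                      -- the field.
                      in trans (sym (pairing≈dot (Π (g x)) r)) φ≈0 0
        where
        g₀≢g₁ : g 0F ≢ g 1F
        g₀≢g₁ q with inj q
        ... | ()
        -- Multiplying the assumed relation by B and replacing e′ B by `Δ′` gives α Δ′ D = γ B - β
        -- Δ′ C.
        κ u v : Series
        κ = α * Δ′
        u = γ
        v = - (β * Δ′)
        κ≉0 : ¬ κ ≈ 0#
        κ≉0 q = Δ′≉0 (integral q α≉0)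
        X Y Z H : Series
        X = Point.X (P i)
        Y = pointY (P i)
        Z = Point.Z (P i)
        H = pointH (P i)
        planeD-relation : ∀ x → let π = Π (g x) in (κ * planeD π - u * planeB π) - v * planeC π ≈ 0#
        planeD-relation x = begin
          (κ * D - γ * B) - v * C
            ≈⟨ +-cong (+-cong (*-congʳ (*-congˡ (sym (e′B (g x))))) (-‿cong (*-congʳ (sym (proj₂ (p x))))))
                      (-‿cong (*-congʳ (-‿cong (*-congˡ (sym (e′B (g x))))))) ⟩
          (α * (e′ (g x) * B) * D - (α * (e′ (g x) * D) + β * (e′ (g x) * C)) * B) - (- (β * (e′ (g x) * B))) * C
            ≈⟨ solve 6 (λ α β e b c d → (α :* (e :* b) :* d :- (α :* (e :* d) :+ β :* (e :* c)) :* b)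
                 :- (:- (β :* (e :* b))) :* c := con (+ 0)) refl _ _ _ _ _ _ ⟩
          0# ∎
          where
          B C D : Series
          B = planeB (Π (g x))
          C = planeC (Π (g x))
          D = planeD (Π (g x))
        -- A is eliminated by incidence with `P i` and D by `planeD-relation`; the factor `κ * X`
        -- clears both denominators.
        reduce : ∀ r x → let π = Π (g x) in κ * X * pairing π r ≈
          (((X * κ * pointY r - Point.X r * κ * Y) + (Point.X r * Z - X * Point.Z r) * u) * planeB π)
          + (((X * κ * pointH r - Point.X r * κ * H) + (Point.X r * Z - X * Point.Z r) * v) * planeC π)
        reduce r x = let π = Π (g x) in begin
          κ * X * pairing π r
            ≈⟨ solve 15 (λ κ u v x y z h x′ y′ z′ h′ a b c d →
                 κ :* x :* (((a :* x′ :+ b :* y′) :+ c :* h′) :- d :* z′)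
                 := ((((x :* κ :* y′ :- x′ :* κ :* y) :+ (x′ :* z :- x :* z′) :* u) :* b)
                    :+ (((x :* κ :* h′ :- x′ :* κ :* h) :+ (x′ :* z :- x :* z′) :* v) :* c))
                    :+ (x′ :* κ :* (((a :* x :+ b :* y) :+ c :* h) :- d :* z) :+ (x′ :* z :- x :* z′) :* ((κ :* d :- u :* b) :- v :* c)))
                 refl κ u v X Y Z H (Point.X r) (pointY r) (Point.Z r) (pointH r) (planeA π) (planeB π) (planeC π) (planeD π) ⟩
          ((((X * κ * pointY r - Point.X r * κ * Y) + (Point.X r * Z - X * Point.Z r) * u) * planeB π)
          + (((X * κ * pointH r - Point.X r * κ * H) + (Point.X r * Z - X * Point.Z r) * v) * planeC π))
            + (Point.X r * κ * pairing π (P i) + (Point.X r * Z - X * Point.Z r) * ((κ * planeD π - u * planeB π) - v * planeC π))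
            ≈⟨ +-congˡ (+-cong (*-congˡ (dot≈0⇒pairing≈0 π (P i) (proj₁ (star (proj₁ (p x)))))) (*-congˡ (planeD-relation x))) ⟩
          _ + (Point.X r * κ * 0# + (Point.X r * Z - X * Point.Z r) * 0#)
            ≈⟨ solve 3 (λ s x y → s :+ (x :* con (+ 0) :+ y :* con (+ 0)) := s) refl _ _ _ ⟩
          _ ∎

      natMul≡ : ∀ j → Mult._×_ K.semiring j F.1# ≡ natMul j
      natMul≡ zero    = ≡.refl
      natMul≡ (suc j) = ≡.cong (λ x → F.1# F.+ x) (natMul≡ j)

    configuration : Configuration seriesDomain
    configuration = record
      { m = m ; n = n ; σ = σ ; k = k
      ; y = λ i → Δ′ * (e i * pointY (P i))
      ; z = λ i → e i * Point.Z (P i)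
      ; h = λ i → e i * pointH (P i)
      ; a = λ j → Δ * (e′ j * planeA (Π j))
      ; b = λ j → e′ j * planeC (Π j)
      ; d = λ j → e′ j * planeD (Π j)
      ; z-distinct = λ i i′ i≢i′ → scaled-distinct points-generic (distinct⇒minor P-set i i′ i≢i′) Δ≉0 (eX i) (eX i′)
      ; b-distinct = λ j j′ j≢j′ → scaled-distinct planes-generic (distinct⇒minor (dual-isProjSet Π-set) j j′ j≢j′) Δ′≉0 (e′B j) (e′B j′)
      ; Red = _∈ reds
      ; Blue = _∈ blues
      ; Adjacent = λ i j → (i , j) ∈ edges
      ; incident = incident
      ; red-degree = λ {i} i∈ → many-map {P = λ j → (i , j) ∈ edges} (λ j ij → proj₂ (All.lookup endpoints ij) , ij)
                       (Pruning.red-neighbours unique (reds-rich i∈))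
      ; blue-degree = λ {j} j∈ → many-map {P = λ i → (i , j) ∈ edges} (λ i ij → proj₁ (All.lookup endpoints ij) , ij)
                       (Pruning.blue-neighbours unique (blues-rich j∈))
      ; pencil = pencil
      ; large-char = λ j 1≤j j≤ p → p 0 λ q → large-char j 1≤j j≤
          (≡.subst (F._≈ F.0#) (≡.trans (constant-term-×1 j) (natMul≡ j)) q)
      }

    some-red : ∃ (_∈ reds)
    some-red = _ , proj₁ (All.lookup endpoints (∈-lookup {xs = edges} (Fin.fromℕ< nonempty)))

-- Choice of constants and conclusion.

open import Data.Nat using (_≤_; _<_; _+_; _*_; _^_; _∸_)

-- The root grows only when `s * s` is exactly the previous argument, which keeps it within a factor
-- 2 of the true square root.
upper-sqrt : ∀ n → ∃ λ s → 1 ≤ s × suc n ≤ s * s × s * s ≤ 4 * suc n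
upper-sqrt zero    = 1 , s≤s z≤n , s≤s z≤n , s≤s z≤n
upper-sqrt (suc n) with upper-sqrt n
... | s , 1≤s , n<ss , ss≤4n with suc (suc n) ℕ.≤? s * s
...   | yes p = s , 1≤s , p , ℕₚ.≤-trans ss≤4n (ℕₚ.*-monoʳ-≤ 4 (ℕₚ.n≤1+n (suc n)))
...   | no ¬p = suc s , s≤s z≤n , lower , upper
  where
  ss≡ : s * s ≡ suc n
  ss≡ = ℕₚ.≤-antisym (ℕₚ.≤-pred (ℕₚ.≰⇒> ¬p)) n<ss
  open ℕₚ.≤-Reasoning
  expand : ∀ s → suc s * suc s ≡ s * s + (1 + 2 * s)
  expand = solve-∀
  lower : suc (suc n) ≤ suc s * suc s
  lower = begin
    suc (suc n)            ≡⟨ ≡.cong suc ss≡ ⟨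
    suc (s * s)            ≡⟨ ℕₚ.+-comm 1 _ ⟩
    s * s + 1              ≤⟨ ℕₚ.+-monoʳ-≤ (s * s) (s≤s z≤n) ⟩
    s * s + (1 + 2 * s)    ≡⟨ expand s ⟨
    suc s * suc s          ∎
  upper : suc s * suc s ≤ 4 * suc (suc n)
  upper = begin
    suc s * suc s             ≡⟨ expand s ⟩
    s * s + (1 + 2 * s)       ≤⟨ ℕₚ.+-monoʳ-≤ (s * s) (ℕₚ.+-mono-≤ (s≤s {n = 3} z≤n)
                                   (ℕₚ.*-mono-≤ (s≤s (s≤s {n = 1} z≤n)) (ℕₚ.m≤m*n s s ⦃ ℕ.>-nonZero 1≤s ⦄))) ⟩
    s * s + (4 + 3 * (s * s)) ≡⟨ collect (s * s) ⟩
    4 * suc (s * s)           ≡⟨ ≡.cong (λ x → 4 * suc x) ss≡ ⟩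
    4 * suc (suc n)           ∎
    where
    collect : ∀ x → x + (4 + 3 * x) ≡ 4 * suc x
    collect = solve-∀

square-cancel-< : ∀ {a b} → a * a < b * b → a < b
square-cancel-< {a} {b} p = ℕₚ.≰⇒> λ b≤a → ℕₚ.<-irrefl ≡.refl (ℕₚ.<-≤-trans p (ℕₚ.*-mono-≤ b≤a b≤a))

module Arithmetic {s : ℕ} (1≤s : 1 ≤ s) where
  open ℕₚ.≤-Reasoning

  -- `e` is the side of the coefficient box and `σ`, equal to 6s, its degree bound on lines. With n
  -- ≤ s² there are at most s² (6s + 1) ≤ 7s³ conditions on 8s³ coefficients.
  e σ : ℕ
  e = 2 * s
  σ = e + (e + (e + 0))

  few-conditions : ∀ {n} → n ≤ s * s → n * suc σ < e * (e * e)
  few-conditions {n} n≤ss = begin-strict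
    n * suc σ                                 ≤⟨ ℕₚ.*-monoˡ-≤ (suc σ) n≤ss ⟩
    s * s * suc σ                             ≡⟨ lhs s ⟩
    6 * (s * s * s) + s * s * 1               ≤⟨ ℕₚ.+-monoʳ-≤ (6 * (s * s * s)) (ℕₚ.*-monoʳ-≤ (s * s) 1≤s) ⟩
    6 * (s * s * s) + s * s * s               <⟨ ℕₚ.m<m+n _ (ℕₚ.*-mono-≤ (ℕₚ.*-mono-≤ 1≤s 1≤s) 1≤s) ⟩
    6 * (s * s * s) + s * s * s + s * s * s   ≡⟨ rhs s ⟩
    e * (e * e)                               ∎
    where
    lhs : ∀ s → s * s * suc (2 * s + (2 * s + (2 * s + 0))) ≡ 6 * (s * s * s) + s * s * 1
    lhs = solve-∀
    rhs : ∀ s → 6 * (s * s * s) + s * s * s + s * s * s ≡ (2 * s) * ((2 * s) * (2 * s))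
    rhs = solve-∀

  -- Origin of `b = 1024`: 2σ + 1 = 12s + 1 < 16s, and (16s)² ≤ 256 · 4n.
  characteristic-bound : ∀ {n p} → s * s ≤ 4 * n → 1024 * n ≤ 1 * (p * p) → suc (σ + σ) < p
  characteristic-bound {n} {p} ss≤4n bn≤pp = square-cancel-< (begin-strict
    suc (σ + σ) * suc (σ + σ)     <⟨ ℕₚ.*-mono-< small small ⟩
    16 * s * (16 * s)             ≡⟨ regroup s ⟩
    256 * (s * s)                 ≤⟨ ℕₚ.*-monoʳ-≤ 256 ss≤4n ⟩
    256 * (4 * n)                 ≡⟨ ℕₚ.*-assoc 256 4 n ⟨
    1024 * n                      ≤⟨ bn≤pp ⟩
    1 * (p * p)                   ≡⟨ ℕₚ.*-identityˡ _ ⟩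
    p * p                         ∎)
    where
    regroup : ∀ s → 16 * s * (16 * s) ≡ 256 * (s * s)
    regroup = solve-∀
    sum : ∀ s → (2 * s + (2 * s + (2 * s + 0))) + (2 * s + (2 * s + (2 * s + 0))) ≡ 12 * s
    sum = solve-∀
    small : suc (σ + σ) < 16 * s
    small = begin-strict
      suc (σ + σ)       ≡⟨ ≡.cong suc (sum s) ⟩
      1 + 12 * s        <⟨ ℕₚ.+-monoˡ-< (12 * s) (ℕₚ.≤-trans (s≤s (s≤s z≤n)) (ℕₚ.*-monoʳ-≤ 4 1≤s)) ⟩
      4 * s + 12 * s    ≡⟨ ℕₚ.*-distribʳ-+ s 4 12 ⟨
      16 * s            ∎

  redThreshold : ℕ → ℕ
  redThreshold  k = suc (suc k) + suc (σ + (σ + (σ + σ)))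

  blueThreshold : ℕ
  blueThreshold = suc (σ + (σ + σ))

  -- Origin of `C = 100`: with n ≤ m both thresholds are charged to `m`. Their sum k + 4 + 42s is at
  -- most 100k + 50s, and 50s ≤ 100 √n because s ≤ 2 √n.
  many-edges : ∀ {m n k N} → n ≤ m → s * s ≤ 4 * n → ¬ (N ∸ 100 * k * m) ^ 2 ≤ (100 * m) ^ 2 * n →
    m * redThreshold k + n * blueThreshold < N
  many-edges {m} {n} {k} {N} n≤m ss≤4n large = begin-strict
    m * redThreshold k + n * blueThreshold     ≤⟨ ℕₚ.+-monoʳ-≤ _ (ℕₚ.*-monoˡ-≤ blueThreshold n≤m) ⟩
    m * redThreshold k + m * blueThreshold     ≡⟨ collect m k s ⟩
    m * (k + 4 * 1 + 42 * s)                     ≤⟨ ℕₚ.*-monoʳ-≤ m (ℕₚ.+-mono-≤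
                                                      (ℕₚ.+-mono-≤ (ℕₚ.m≤n*m k 100) (ℕₚ.*-monoʳ-≤ 4 1≤s)) (ℕₚ.≤-refl {42 * s})) ⟩
    m * (100 * k + 4 * s + 42 * s)               ≤⟨ ℕₚ.m≤m+n _ (m * (4 * s)) ⟩
    m * (100 * k + 4 * s + 42 * s) + m * (4 * s) ≡⟨ regroup m k s ⟩
    50 * m * s + 100 * k * m                     <⟨ ℕₚ.+-monoˡ-< (100 * k * m) excess ⟩
    N ∸ 100 * k * m + 100 * k * m                ≡⟨ ℕₚ.m∸n+n≡m {N} {100 * k * m} (ℕₚ.<⇒≤ (ℕₚ.m∸n≢0⇒n<m {N} {100 * k * m} (ℕₚ.m<n⇒n≢0 excess))) ⟩
    N                                            ∎
    where
    collect : ∀ m k s → let e = 2 * s ; σ = e + (e + (e + 0)) in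
      m * (suc (suc k) + suc (σ + (σ + (σ + σ)))) + m * suc (σ + (σ + σ)) ≡ m * (k + 4 * 1 + 42 * s)
    collect = solve-∀
    regroup : ∀ m k s → m * (100 * k + 4 * s + 42 * s) + m * (4 * s) ≡ 50 * m * s + 100 * k * m
    regroup = solve-∀
    square : ∀ x → x ^ 2 ≡ x * x
    square x = ≡.cong (x *_) (ℕₚ.*-identityʳ x)
    excess : 50 * m * s < N ∸ 100 * k * m
    excess = ℕₚ.≰⇒> λ le → large (begin
      (N ∸ 100 * k * m) ^ 2            ≡⟨ square (N ∸ 100 * k * m) ⟩
      (N ∸ 100 * k * m) * (N ∸ 100 * k * m) ≤⟨ ℕₚ.*-mono-≤ le le ⟩
      50 * m * s * (50 * m * s)        ≡⟨ split m s ⟩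
      50 * m * (50 * m) * (s * s)      ≤⟨ ℕₚ.*-monoʳ-≤ (50 * m * (50 * m)) ss≤4n ⟩
      50 * m * (50 * m) * (4 * n)      ≡⟨ merge m n ⟩
      100 * m * (100 * m) * n          ≡⟨ ≡.cong (_* n) (square (100 * m)) ⟨
      (100 * m) ^ 2 * n                ∎)
      where
      split : ∀ m s → 50 * m * s * (50 * m * s) ≡ 50 * m * (50 * m) * (s * s)
      split = solve-∀
      merge : ∀ m n → 50 * m * (50 * m) * (4 * n) ≡ 100 * m * (100 * m) * n
      merge = solve-∀

mainTheorem6 : Theorem6Constants
mainTheorem6 = record
  { a = 1 ; b = 1024 ; C = 100
  ; a>0 = s≤s z≤n ; b>0 = s≤s z≤n ; C>0 = s≤s z≤n
  ; claim = claim
  }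
  where
  claim : ∀ {c ℓ} (F : Field c ℓ) → let open Geometry F in
    ∀ (p : ℕ) → HasChar p →
    ∀ (m n r : ℕ) (P : Fin m → V4) (Π : Fin n → V4) (Ls : Fin r → Line) (k : ℕ) →
    IsProjSet P → IsProjSet Π → n ≤ m →
    (p ≢ 0 → p ≢ 2 × 1024 * n ≤ 1 * (p * p)) →
    PlanesPerLineAtMost Ls Π k → IStarBound P Π Ls 100 k
  -- Without planes there is no incidence; the case is separate because no s ≥ 1 satisfies s² ≤ 4n
  -- for n = 0.
  claim F p hasChar m zero    r P Π Ls k P-set Π-set n≤m small atMost zero    f inj star =
    ℕₚ.≤-trans (ℕₚ.≤-reflexive (≡.cong (_^ 2) (ℕₚ.0∸n≡0 (100 * k * m)))) z≤n
  claim F p hasChar m zero    r P Π Ls k P-set Π-set n≤m small atMost (suc N) f inj star with proj₂ (f zero)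
  ... | ()
  claim F p hasChar m (suc n) r P Π Ls k P-set Π-set n≤m small atMost N       f inj star
    with upper-sqrt n
  -- The bound is decidable, so it is enough to refute its failure; this discharges all double
  -- negations.
  ... | s , 1≤s , n≤ss , ss≤4n = decidable-stable (_ ℕ.≤? _) λ large →
    let core = Pruning.prune {Q = λ (i , j) → IStar Ls (P i) (Π j)} (redThreshold k) blueThreshold _ (allFin m) (allFin (suc n)) (tabulate f)
                 ℕₚ.≤-refl (Uniqueₚ.tabulate⁺ inj) (All.tabulate (λ _ → ∈-allFin _ , ∈-allFin _)) (Allₚ.tabulate⁺ star)
                 (dense (many-edges {m} {suc n} {k} {N} n≤m ss≤4n large))
        open Model {k = k} {σ = σ} {Ls = Ls} P-set Π-set atMost large-char core
    in Descent.impossible seriesDomain configuration some-red e ℕₚ.≤-refl (few-conditions n≤ss)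
    where
    open Geometry F
    open Arithmetic 1≤s
    open IncidenceModel F
    open GenericCoordinates F using (seriesDomain)
    dense : m * redThreshold k + suc n * blueThreshold < N →
      length (allFin m) * redThreshold k + length (allFin (suc n)) * blueThreshold < length (tabulate f)
    dense = ≡.subst₂ _<_
      (≡.cong₂ (λ x y → x * redThreshold k + y * blueThreshold)
        (≡.sym (length-tabulate {n = m} id)) (≡.sym (length-tabulate {n = suc n} id)))
      (≡.sym (length-tabulate f))
    large-char : ∀ j → 1 ≤ j → j ≤ suc (σ + σ) → ¬ Field._≈_ F (natMul j) (Field.0# F)
    large-char j 1≤j j≤ j≈0 with p ℕ.≟ 0 | proj₁ (hasChar j) j≈0
    ... | yes ≡.refl | 0∣j = ℕₚ.<⇒≢ 1≤j (≡.sym (0∣⇒≡0 0∣j))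
    ... | no p≢0     | p∣j = ℕₚ.<-irrefl ≡.refl (ℕₚ.≤-trans (characteristic-bound {suc n} ss≤4n (proj₂ (small p≢0)))
                               (ℕₚ.≤-trans (∣⇒≤ ⦃ ℕ.>-nonZero 1≤j ⦄ p∣j) j≤))
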